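{- Let $n\ge 4$ and let $\mathcal{O}_{2,n}$ be the matrix defined recursively below. Then the convex hull of the columns of $\mathcal{O}_{2,n}$ is the polytope of all matroids $\Omega_{2,n}$ of rank $2$ on $[n]$ (with coordinates of $\mathbb{R}^{\binom n2}$ indexed by Schubert matroids in the order $\sigma_n$ below). Construction. Set $\mathcal{O}_{2,4}$ to be the $6\times 7$ matrix $\big(I_6 \mid v\big)$ with $v=(0,0,0,0,2,-1)^{T}$. For $n\ge 4$, let $\mathcal{U}(n)$ be the matrix with $n-2$ rows whose columns are all distinct vectors $u\in\mathbb{Z}_{\ge0}^{n-2}$ with $(n-1,n-2,\dots,3,2)\,u=n$. Let $\mathcal{V}(4)=(0,2,-1)^{T}$, and for $n\ge 5$ let $\mathcal{V}(n)$ be the $(n-1)$-row matrix whose columns consist of a left block equal to the zero row $\mathbf 0^T$ stacked on top of $\mathcal{V}(n-1)$, and a right block equal to $\mathcal{U}(n)$ stacked on top of the row $\mathbf 1^{T}-\mathbf 1^{T}\mathcal{U}(n)$. For $n\ge 5$ define $$\mathcal{O}_{2,n}=\begin{pmatrix}\mathcal{O}_{2,n-1} & \mathbf 0 & \mathbf 0\\ \mathbf 0 & I_{n-1} & \mathcal{V}(n)\end{pmatrix}.$$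
   Context: For $1\le x_1<x_2\le n$, $S(x_1,x_2)$ is the rank-$2$ Schubert matroid on $[n]$ whose bases are the $2$-subsets $\{b_1<b_2\}$ with $b_1\ge x_1,b_2\ge x_2$; these represent the $\binom n2$ isomorphism classes of rank-2 Schubert matroids on $[n]$. Order them as follows: $\sigma_3=(S(2,3),S(1,3),S(1,2))$, and for $n\ge4$, $\sigma_n$ consists of $S(a+1,b+1)$ for $S(a,b)$ running through $\sigma_{n-1}$ in order, followed by $S(1,n),S(1,n-1),\dots,S(1,2)$. For a matroid $M$ on $[n]$, $\mathcal{P}(M)$ is its base polytope (convex hull of indicator vectors of bases), and $\mathbbm{1}(X)(x)=\frac1{n!}\sum_{\sigma\in S_n}\overline{\mathbbm 1}(X)(\sigma(x))$ is the symmetrized indicator function. For every isomorphism class $M$ of rank $r$ matroids on $[n]$ there is a unique expression $\mathbbm 1(\mathcal P(M))=\sum_{S}a_S\,\mathbbm 1(\mathcal P(S))$ over isomorphism classes $S$ of rank $r$ Schubert matroids on $[n]$ (its Schubert expansion); $o_M=(a_S)_S$. The polytope of all matroids is $\Omega_{r,n}=\operatorname{conv}\{o_M : M \text{ an isomorphism class of rank } r \text{ matroids on } [n]\}$.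
   Formalization: Points of the convex hulls, convex weights, arguments of the indicator functions and the coefficients of Schubert expansions are rational instead of real. -}

module Defs where

open import Data.Bool using (Bool; true; false; if_then_else_; _∨_; T)
open import Data.Nat as ℕ using (ℕ; zero; suc; _!)
open import Data.Nat.Properties using (_!≢0)
open import Data.Integer using (+_; -[1+_])
open import Data.Rational as ℚ using (ℚ; 0ℚ; 1ℚ; _≤_)
open import Data.Fin as Fin using (Fin; toℕ; _↑ˡ_; _↑ʳ_; inject₁; fromℕ)
open import Data.Fin.Subset using (Subset; _∈_; _∉_; ∣_∣; inside; outside)
open import Data.Vec as Vec using (Vec; []; _∷_; lookup; _[_]≔_)
open import Data.List as List using (List; []; _∷_; length; zipWith; map; allFin; concatMap)
open import Data.List.Relation.Unary.All using (All)
open import Data.List.Relation.Binary.Pointwise using (Pointwise)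
open import Data.Product using (Σ; ∃; _×_; _,_; proj₁; proj₂)
open import Data.Sum using (_⊎_)
open import Relation.Nullary using (¬_; ⌊_⌋)
open import Relation.Binary.PropositionalEquality using (_≡_)

sumℚ : List ℚ → ℚ
sumℚ = List.foldr ℚ._+_ 0ℚ

Σℚ : (d : ℕ) → (Fin d → ℚ) → ℚ
Σℚ d f = sumℚ (map f (allFin d))

InConv : {d : ℕ} → List (Fin d → ℚ) → (Fin d → ℚ) → Set
InConv {d} ps x =
  Σ (List ℚ) λ w →
    length w ≡ length ps
    × All (0ℚ ≤_) w
    × sumℚ w ≡ 1ℚ
    × (∀ i → x i ≡ sumℚ (zipWith (λ c p → c ℚ.* p i) w ps))

InHull : {d : ℕ} → ((Fin d → ℚ) → Set) → (Fin d → ℚ) → Set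
InHull {d} P x = Σ (List (Fin d → ℚ)) λ ps → All P ps × InConv ps x

record Matroid2 (n : ℕ) : Set where
  field
    isBasis  : Subset n → Bool
    rank2    : ∀ B → T (isBasis B) → ∣ B ∣ ≡ 2
    nonempty : Σ (Subset n) λ B → T (isBasis B)
    exchange : ∀ B₁ B₂ → T (isBasis B₁) → T (isBasis B₂) →
               ∀ x → x ∈ B₁ → x ∉ B₂ →
               Σ (Fin n) λ y → y ∈ B₂ × y ∉ B₁ ×
                 T (isBasis ((B₁ [ x ]≔ outside) [ y ]≔ inside))
open Matroid2 public

subInd : {n : ℕ} → Subset n → Fin n → ℚ
subInd B k = if lookup B k then 1ℚ else 0ℚ

MatVert : {n : ℕ} → Matroid2 n → (Fin n → ℚ) → Set
MatVert {n} M y = Σ (Subset n) λ B → T (isBasis M B) × (∀ k → y k ≡ subInd B k)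

pairInd : {n : ℕ} → Fin n → Fin n → Fin n → ℚ
pairInd i j k = if ⌊ k Fin.≟ i ⌋ ∨ ⌊ k Fin.≟ j ⌋ then 1ℚ else 0ℚ

-- vertices of P(S(a,b)): indicator vectors of {b₁ < b₂} with b₁ ≥ a, b₂ ≥ b
-- (elements of [n] are 1-based: Fin index i stands for toℕ i + 1)
SchubVert : (n a b : ℕ) → (Fin n → ℚ) → Set
SchubVert n a b y =
  Σ (Fin n) λ i → Σ (Fin n) λ j →
    toℕ i ℕ.< toℕ j × a ℕ.≤ suc (toℕ i) × b ℕ.≤ suc (toℕ j)
    × (∀ k → y k ≡ pairInd i j k)

ins : {A : Set} {m : ℕ} → A → Vec A m → List (Vec A (suc m))
ins a []       = (a ∷ []) ∷ []
ins a (b ∷ bs) = (a ∷ b ∷ bs) ∷ map (b ∷_) (ins a bs)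

perms : (n : ℕ) → List (Vec (Fin n) n)
perms zero    = [] ∷ []
perms (suc n) = concatMap (λ σ → ins Fin.zero (Vec.map Fin.suc σ)) (perms n)

IndVal : {d : ℕ} → ((Fin d → ℚ) → Set) → (Fin d → ℚ) → ℚ → Set
IndVal P x v = (InHull P x × v ≡ 1ℚ) ⊎ (¬ InHull P x × v ≡ 0ℚ)

SymVal : (n : ℕ) → ((Fin n → ℚ) → Set) → (Fin n → ℚ) → ℚ → Set
SymVal n P x q =
  Σ (List ℚ) λ vs →
    Pointwise (λ σ v → IndVal P (λ i → x (lookup σ i)) v) (perms n) vs
    × q ≡ ((+ 1) ℚ./ (n !)) {{n !≢0}} ℚ.* sumℚ vs

tri : ℕ → ℕ
tri zero    = zero
tri (suc n) = tri n ℕ.+ n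

tailPairs : (n : ℕ) → Vec (ℕ × ℕ) n
tailPairs zero    = []
tailPairs (suc n) = (1 , suc n ℕ.+ 1) ∷ tailPairs n

-- σ_n, as the list of pairs (x₁, x₂) of S(x₁, x₂); σ_3 = (S(2,3), S(1,3), S(1,2))
sigma : (n : ℕ) → Vec (ℕ × ℕ) (tri n)
sigma zero    = []
sigma (suc n) = Vec.map (λ p → suc (proj₁ p) , suc (proj₂ p)) (sigma n) Vec.++ tailPairs n

schub : (n : ℕ) → Fin (tri n) → (Fin n → ℚ) → Set
schub n k = SchubVert n (proj₁ (lookup (sigma n) k)) (proj₂ (lookup (sigma n) k))

-- a is the Schubert expansion o_M of M:
--   𝟙(P(M)) = Σ_k a_k 𝟙(P(S_k)) as functions (tested on rational points)
IsSchubExp : (n : ℕ) → Matroid2 n → (Fin (tri n) → ℚ) → Set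
IsSchubExp n M a =
  ∀ (x : Fin n → ℚ) (q : ℚ) (qs : Fin (tri n) → ℚ) →
    SymVal n (MatVert M) x q →
    (∀ k → SymVal n (schub n k) x (qs k)) →
    q ≡ Σℚ (tri n) (λ k → a k ℚ.* qs k)

Omega : (n : ℕ) → (Fin (tri n) → ℚ) → Set
Omega n = InHull (λ a → Σ (Matroid2 n) λ M → IsSchubExp n M a)

-- The matrix 𝒪_{2,n} (described by its set of columns), n = 4 + m

ℕtoℚ : ℕ → ℚ
ℕtoℚ k = (+ k) ℚ./ 1

unit : {d : ℕ} → Fin d → Fin d → ℚ
unit i k = if ⌊ k Fin.≟ i ⌋ then 1ℚ else 0ℚ

v4 : Vec ℚ 6
v4 = 0ℚ ∷ 0ℚ ∷ 0ℚ ∷ 0ℚ ∷ ℕtoℚ 2 ∷ (-[1+ 0 ] ℚ./ 1) ∷ []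

-- z is a column of 𝒰(n) stacked over the row 1 - 1ᵀ𝒰(n), n = 5 + k,
-- 𝒰(n) rows = n - 2 = 3 + k, weights (n-1, …, 2)
ColUext : (k : ℕ) → (Fin (suc (3 ℕ.+ k)) → ℚ) → Set
ColUext k z =
  Σ (Vec ℕ (3 ℕ.+ k)) λ u →
    Vec.sum (Vec.zipWith ℕ._*_ (Vec.tabulate (λ i → (4 ℕ.+ k) ℕ.∸ toℕ i)) u)
      ≡ 5 ℕ.+ k
    × (∀ i → z (inject₁ i) ≡ ℕtoℚ (lookup u i))
    × z (fromℕ (3 ℕ.+ k)) ≡ 1ℚ ℚ.- ℕtoℚ (Vec.sum u)

-- z is a column of 𝒱(4 + k) (which has 3 + k rows)
ColV : (k : ℕ) → (Fin (3 ℕ.+ k) → ℚ) → Set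
ColV zero z =
  z Fin.zero ≡ 0ℚ × z (Fin.suc Fin.zero) ≡ ℕtoℚ 2
  × z (Fin.suc (Fin.suc Fin.zero)) ≡ (-[1+ 0 ] ℚ./ 1)
ColV (suc k) z = (z Fin.zero ≡ 0ℚ × ColV k (λ i → z (Fin.suc i))) ⊎ ColUext k z

ColO : (m : ℕ) → (Fin (tri (4 ℕ.+ m)) → ℚ) → Set
ColO zero y =
  (Σ (Fin 6) λ i → ∀ k → y k ≡ unit i k) ⊎ (∀ k → y k ≡ lookup v4 k)
ColO (suc m) y =
  (ColO m top × (∀ k → bot k ≡ 0ℚ))
  ⊎ ((∀ k → top k ≡ 0ℚ) × Σ (Fin (4 ℕ.+ m)) λ i → ∀ k → bot k ≡ unit i k)
  ⊎ ((∀ k → top k ≡ 0ℚ) × ColV (suc m) bot)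
  where
    top : Fin (tri (4 ℕ.+ m)) → ℚ
    top k = y (k ↑ˡ (4 ℕ.+ m))
    bot : Fin (4 ℕ.+ m) → ℚ
    bot k = y (tri (4 ℕ.+ m) ↑ʳ k)

-- A rank-2 matroid is a set of ℓ loops together with a partition of the other elements into
-- parallel classes P₁, …, P_k, and its base polytope is cut out of the hypersimplex by x = 0 on the
-- loops and x(Pᵢ) ≤ 1.  As the coordinates sum to 2, the regions x(Pᵢ) > 1 are disjoint, whence
--   𝟙(P(M)) = 𝟙(Δ) + Σᵢ (𝟙(P(Sᵢ)) - 𝟙(Δ)),
-- where Δ has the same loops and otherwise only singleton classes and Sᵢ keeps the class Pᵢ only.
-- After symmetrization Sᵢ becomes S(ℓ + 1, ℓ + 1 + |Pᵢ|) and Δ becomes S(ℓ + 1, ℓ + 2).  So o_M counts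
-- the classes of each size p ≥ 2 in the block of the S(ℓ + 1, -), with 1 minus their number in the
-- last place, and these vectors are exactly the columns of the matrix.  That every Schubert expansion has this
-- form needs the linear independence of the symmetrized Schubert indicators, tested on a pair of
-- nearby points whose memberships differ only for one Schubert matroid.

module Submission where

open import Defs
import Algebra.Properties.CommutativeMonoid.Sum as MonoidSum
open import Data.Bool using (Bool; true; false; if_then_else_; _∨_; T)
open import Data.Bool.Properties as Boolₚ using (∨-comm; ∨-zeroʳ; ∨-identityʳ; T?)
open import Data.Empty using (⊥)
open import Data.Fin as Fin using (Fin; toℕ; punchIn; punchOut; inject₁; fromℕ; fromℕ<; _↑ˡ_; _↑ʳ_)
open import Data.Fin.Permutation as Perm using (Permutation′; _⟨$⟩ʳ_; _⟨$⟩ˡ_)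
import Data.Fin.Properties as Finₚ
open import Data.Fin.Subset using (Subset; _∈_; _∉_; ∣_∣; inside; outside)
open import Data.Integer as ℤ using ()
import Data.Integer.Properties as ℤₚ
open import Data.List as List using (List; []; _∷_; length; map; zipWith; concatMap; _++_)
open import Data.List.Membership.Propositional using () renaming (_∈_ to _∈ᴸ_)
import Data.List.Membership.Propositional.Properties as ∈ᴸ
import Data.List.Properties as Listₚ
open import Data.List.Relation.Binary.Pointwise using (Pointwise; []; _∷_)
open import Data.List.Relation.Unary.All as All using (All; []; _∷_)
import Data.List.Relation.Unary.All.Properties as Allₚ
open import Data.List.Relation.Unary.Any using (here; there)
open import Data.Nat as ℕ using (ℕ; zero; suc; _+_; _*_; _∸_; _≤_; _<_; z≤n; s≤s; _!)
import Data.Nat.ListAction as ListSum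
import Data.Nat.ListAction.Properties as ListSumₚ
open import Data.Nat.Properties as ℕₚ using (_!≢0)
open import Data.Nat.Solver using () renaming (module +-*-Solver to ℕ-Solver)
open import Data.Product using (Σ; ∃; ∃₂; _×_; _,_; proj₁; proj₂)
open import Data.Rational as ℚ using (ℚ; 0ℚ; 1ℚ; _⊓_; _⊔_)
  renaming (_+_ to _⊕_; _*_ to _⊛_; _-_ to _⊖_; -_ to ⊝_; _≤_ to _≤ᵣ_; _<_ to _<ᵣ_)
import Data.Rational.Properties as ℚₚ
open import Data.Rational.Solver using () renaming (module +-*-Solver to ℚ-Solver)
open import Data.Rational.Unnormalised as ℚᵘ using (mkℚᵘ)
import Data.Rational.Unnormalised.Properties as ℚᵘₚ
open import Data.Sum using (_⊎_; inj₁; inj₂; [_,_]′)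
open import Data.Unit using (tt)
open import Data.Vec as Vec using (Vec; []; _∷_; lookup; _[_]≔_)
import Data.Vec.Functional as VecF
import Data.Vec.Functional.Properties as VecFₚ
import Data.Vec.Properties as Vecₚ
open import Function using (_∘_; id)
open import Relation.Binary.Definitions using (tri<; tri≈; tri>)
open import Relation.Binary.PropositionalEquality
open import Relation.Nullary using (¬_; Dec; yes; no; does; contradiction; ⌊_⌋)
open import Relation.Nullary.Decidable
  using (map′; ¬?; _×-dec_; _→-dec_; dec-true; dec-false; toWitness; fromWitness)

open MonoidSum ℚₚ.+-0-commutativeMonoid
  renaming (sum to ∑; sum-cong-≗ to ∑-cong)
  using (∑-distrib-+; ∑-comm; ∑-permute)
open MonoidSum ℕₚ.+-0-commutativeMonoid
  renaming (sum to ∑ℕ; sum-cong-≗ to ∑ℕ-cong; sum-remove to ∑ℕ-remove;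
            ∑-distrib-+ to ∑ℕ-distrib-+; ∑-comm to ∑ℕ-comm)
  using ()

-- Finite sums

-- The hulls agree because their generators agree: a vector is a column of the matrix iff it is the
-- Schubert expansion of some matroid. Both are compared with one normal form, `HasColumn`, in which
-- identity columns and 𝒱 columns alike are given by class counts `u` whose classes fit into the
-- nonloops. `IndVal` asks for a decision of hull membership, and `IsSchubExp` carries information
-- only where the symmetrized values exist. So membership must be decidable. The inequalities `Poly`
-- can be checked; that they imply membership is shown by explicit convex weights, taken from
-- systematic sampling. For independence, a point with exactly `ℓ` zero coordinates kills every
-- Schubert matroid with more than `ℓ` loops. Among those with `ℓ` loops the difficulty is that
-- symmetrization sums over all placements of the class. The test points are therefore even integers
-- over an even denominator: moving one unit between two heavy coordinates changes each class sum by
-- at most 1, and by parity only a class sum that was exactly tight can cross its bound. This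
-- singles out one class size, and membership changes in one direction only, so nothing cancels.

≤ᵣ-by : ∀ {a b c d} → a ≡ c → b ≡ d → c ≤ᵣ d → a ≤ᵣ b
≤ᵣ-by refl refl p = p

∑-mono : ∀ {n} {f g : Fin n → ℚ} → (∀ i → f i ≤ᵣ g i) → ∑ f ≤ᵣ ∑ g
∑-mono {zero}  p = ℚₚ.≤-refl
∑-mono {suc n} p = ℚₚ.+-mono-≤ (p Fin.zero) (∑-mono (p ∘ Fin.suc))

∑-zero : ∀ {n} {f : Fin n → ℚ} → (∀ i → f i ≡ 0ℚ) → ∑ f ≡ 0ℚ
∑-zero {zero}  p = refl
∑-zero {suc n} p = cong₂ _⊕_ (p Fin.zero) (∑-zero (p ∘ Fin.suc))

∑-*ˡ : ∀ {n} a (f : Fin n → ℚ) → ∑ (λ i → a ⊛ f i) ≡ a ⊛ ∑ f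
∑-*ˡ {zero}  a f = sym (ℚₚ.*-zeroʳ a)
∑-*ˡ {suc n} a f = trans
  (cong (a ⊛ f Fin.zero ⊕_) (∑-*ˡ a (f ∘ Fin.suc)))
  (sym (ℚₚ.*-distribˡ-+ a (f Fin.zero) (∑ (f ∘ Fin.suc))))

∑-⊖ : ∀ {n} (f g : Fin n → ℚ) → ∑ (λ i → f i ⊖ g i) ≡ ∑ f ⊖ ∑ g
∑-⊖ {zero}  f g = refl
∑-⊖ {suc n} f g = trans
  (cong ((f Fin.zero ⊖ g Fin.zero) ⊕_) (∑-⊖ (f ∘ Fin.suc) (g ∘ Fin.suc)))
  (solve 4 (λ a b c d → (a :- b) :+ (c :- d) := (a :+ c) :- (b :+ d)) refl
    (f Fin.zero) (g Fin.zero) (∑ (f ∘ Fin.suc)) (∑ (g ∘ Fin.suc)))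
  where open ℚ-Solver

∑-single : ∀ {n} {f : Fin n → ℚ} i → (∀ j → j ≢ i → f j ≡ 0ℚ) → ∑ f ≡ f i
∑-single {f = f} Fin.zero    p = trans
  (cong (f Fin.zero ⊕_) (∑-zero λ j → p (Fin.suc j) λ ())) (ℚₚ.+-identityʳ (f Fin.zero))
∑-single {f = f} (Fin.suc i) p = trans
  (cong₂ _⊕_ (p Fin.zero λ ())
    (∑-single {f = f ∘ Fin.suc} i λ j j≢i → p (Fin.suc j) λ { refl → j≢i refl }))
  (ℚₚ.+-identityˡ (f (Fin.suc i)))

Σℚ≡∑ : ∀ d (f : Fin d → ℚ) → Σℚ d f ≡ ∑ f
Σℚ≡∑ d f = go d id
  where
  go : ∀ m (h : Fin m → Fin d) → sumℚ (map f (List.tabulate h)) ≡ ∑ (f ∘ h)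
  go zero    h = refl
  go (suc m) h = cong (f (h Fin.zero) ⊕_) (go m (h ∘ Fin.suc))

0≤1 : 0ℚ ≤ᵣ 1ℚ
0≤1 = toWitness {a? = 0ℚ ℚₚ.≤? 1ℚ} tt

2ℚ : ℚ
2ℚ = 1ℚ ⊕ 1ℚ

unit-self : ∀ {n} (i : Fin n) → unit i i ≡ 1ℚ
unit-self i with i Fin.≟ i
... | yes _   = refl
... | no  i≢i = contradiction refl i≢i

unit-other : ∀ {n} {i k : Fin n} → k ≢ i → unit i k ≡ 0ℚ
unit-other {i = i} {k} k≢i with k Fin.≟ i
... | yes k≡i = contradiction k≡i k≢i
... | no  _   = refl

pairInd-unit : ∀ {n} {i j : Fin n} → i ≢ j → ∀ k → pairInd i j k ≡ unit i k ⊕ unit j k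
pairInd-unit {i = i} {j} i≢j k with k Fin.≟ i | k Fin.≟ j
... | yes refl | yes refl = contradiction refl i≢j
... | yes _    | no _     = refl
... | no _     | yes _    = refl
... | no _     | no _     = refl

-- Convex combinations

Point : ℕ → Set
Point n = Fin n → ℚ

-- The index s is the total weight; s = 1 gives InHull.
data Cone {d} (P : Point d → Set) : ℚ → Point d → Set where
  nil : ∀ {s x} → s ≡ 0ℚ → (∀ k → x k ≡ 0ℚ) → Cone P s x
  add : ∀ {a p s t x y} → 0ℚ ≤ᵣ a → P p → Cone P s x →
        t ≡ a ⊕ s → (∀ k → y k ≡ a ⊛ p k ⊕ x k) → Cone P t y

module _ {d} {P : Point d → Set} where

  cone⇒hull : ∀ {x} → Cone P 1ℚ x → InHull P x
  cone⇒hull = go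
    where
    go : ∀ {s x} → Cone P s x → Σ (List (Point d)) λ ps → All P ps × Σ (List ℚ) λ w →
         length w ≡ length ps × All (0ℚ ℚ.≤_) w × sumℚ w ≡ s ×
         (∀ i → x i ≡ sumℚ (zipWith (λ c p → c ⊛ p i) w ps))
    go (nil s≡ x≡) = [] , [] , [] , refl , [] , sym s≡ , x≡
    go (add {a = a} {p} 0≤a Pp C t≡ y≡) with go C
    ... | ps , Pps , w , l , w≥0 , Σw , x≡ =
      p ∷ ps , Pp ∷ Pps , a ∷ w , cong suc l , 0≤a ∷ w≥0 ,
      trans (cong (a ⊕_) Σw) (sym t≡) , λ i → trans (y≡ i) (cong (a ⊛ p i ⊕_) (x≡ i))

  hull⇒cone : ∀ {x} → InHull P x → Cone P 1ℚ x
  hull⇒cone (ps , Pps , w , l , w≥0 , Σw , x≡) = go ps Pps w l w≥0 Σw x≡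
    where
    go : ∀ {s x} ps → All P ps → ∀ w → length w ≡ length ps → All (0ℚ ℚ.≤_) w → sumℚ w ≡ s →
         (∀ i → x i ≡ sumℚ (zipWith (λ c p → c ⊛ p i) w ps)) → Cone P s x
    go []       []         []      l []           Σw x≡ = nil (sym Σw) x≡
    go (p ∷ ps) (Pp ∷ Pps) (a ∷ w) l (0≤a ∷ w≥0) Σw x≡ =
      add 0≤a Pp (go ps Pps w (ℕₚ.suc-injective l) w≥0 refl λ _ → refl) (sym Σw) x≡

  cone-cong : ∀ {s t x y} → s ≡ t → (∀ k → x k ≡ y k) → Cone P s x → Cone P t y
  cone-cong s≡t x≡y (nil s≡ x≡) = nil (trans (sym s≡t) s≡) λ k → trans (sym (x≡y k)) (x≡ k)
  cone-cong s≡t x≡y (add 0≤a Pp C s≡ x≡) =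
    add 0≤a Pp C (trans (sym s≡t) s≡) λ k → trans (sym (x≡y k)) (x≡ k)

  cone-⊕ : ∀ {s t x y} → Cone P s x → Cone P t y → Cone P (s ⊕ t) (λ k → x k ⊕ y k)
  cone-⊕ {t = t} {y = y} (nil s≡ x≡) D = cone-cong
    (trans (sym (ℚₚ.+-identityˡ t)) (cong (_⊕ t) (sym s≡)))
    (λ k → trans (sym (ℚₚ.+-identityˡ (y k))) (cong (_⊕ y k) (sym (x≡ k)))) D
  cone-⊕ {t = t} {y = y} (add {a} {p} {s} {x = x} 0≤a Pp C s≡ x≡) D = add 0≤a Pp (cone-⊕ C D)
    (trans (cong (_⊕ t) s≡) (ℚₚ.+-assoc a s t))
    λ k → trans (cong (_⊕ y k) (x≡ k)) (ℚₚ.+-assoc (a ⊛ p k) (x k) (y k))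

  cone-∑ : ∀ {m} {s : Fin m → ℚ} {x : Fin m → Point d} → (∀ i → Cone P (s i) (x i)) →
           Cone P (∑ s) (λ k → ∑ λ i → x i k)
  cone-∑ {zero}  C = nil refl λ _ → refl
  cone-∑ {suc m} C = cone-⊕ (C Fin.zero) (cone-∑ (C ∘ Fin.suc))

hull-cong : ∀ {d} {P : Point d → Set} {x y} → (∀ k → x k ≡ y k) → InHull P x → InHull P y
hull-cong x≡y h = cone⇒hull (cone-cong refl x≡y (hull⇒cone h))

hull-map : ∀ {m n} {P : Point m → Set} {P′ : Point n → Set} (f : Fin n → Fin m) →
           (∀ {y} → P y → P′ (y ∘ f)) → ∀ {x} → InHull P x → InHull P′ (x ∘ f)
hull-map {P = P} {P′} f imp h = cone⇒hull (go (hull⇒cone h))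
  where
  go : ∀ {s x} → Cone P s x → Cone P′ s (x ∘ f)
  go (nil s≡ x≡)         = nil s≡ (x≡ ∘ f)
  go (add 0≤a Pp C s≡ x≡) = add 0≤a (imp Pp) (go C) s≡ (x≡ ∘ f)

-- `axpy` has the shape of one `add` step of `Cone`, so bounds on generators pass to the hull by
-- induction on that type.
record Linear {n} (L : Point n → ℚ) : Set where
  field
    ext  : ∀ {x y} → (∀ k → x k ≡ y k) → L x ≡ L y
    zer  : L (λ _ → 0ℚ) ≡ 0ℚ
    axpy : ∀ a x y → L (λ k → a ⊛ x k ⊕ y k) ≡ a ⊛ L x ⊕ L y
open Linear public

neg-linear : ∀ {n} {L : Point n → ℚ} → Linear L → Linear (λ x → ⊝ L x)
neg-linear {L = L} lin = record
  { ext  = λ p → cong ⊝_ (ext lin p)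
  ; zer  = cong ⊝_ (zer lin)
  ; axpy = λ a x y → trans (cong ⊝_ (axpy lin a x y))
      (solve 3 (λ a b c → :- (a :* b :+ c) := a :* (:- b) :+ (:- c)) refl a (L x) (L y)) }
  where open ℚ-Solver

hull-≤ : ∀ {n} {P : Point n → Set} {L} → Linear L → ∀ {b} → (∀ {y} → P y → L y ≤ᵣ b) →
         ∀ {x} → InHull P x → L x ≤ᵣ b
hull-≤ {P = P} {L} lin {b} bound h = subst (_ ≤ᵣ_) (ℚₚ.*-identityˡ b) (go (hull⇒cone h))
  where
  go : ∀ {s x} → Cone P s x → L x ≤ᵣ s ⊛ b
  go (nil s≡ x≡) = ℚₚ.≤-reflexive
    (trans (trans (ext lin x≡) (zer lin)) (sym (trans (cong (_⊛ b) s≡) (ℚₚ.*-zeroˡ b))))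
  go (add {a = a} {p} {s} 0≤a Pp C s≡ x≡) =
    ≤ᵣ-by (trans (ext lin x≡) (axpy lin a p _))
          (trans (cong (_⊛ b) s≡) (ℚₚ.*-distribʳ-+ b a s))
          (ℚₚ.+-mono-≤ (ℚₚ.*-monoˡ-≤-nonNeg a {{ℚ.nonNegative 0≤a}} (bound Pp)) (go C))

hull-≥ : ∀ {n} {P : Point n → Set} {L} → Linear L → ∀ {b} → (∀ {y} → P y → b ≤ᵣ L y) →
         ∀ {x} → InHull P x → b ≤ᵣ L x
hull-≥ {L = L} lin {b} bound h = subst₂ _≤ᵣ_ (neg-neg b) (neg-neg (L _)) (ℚₚ.neg-antimono-≤
  (hull-≤ (neg-linear lin) (ℚₚ.neg-antimono-≤ ∘ bound) h))
  where
  neg-neg : ∀ q → ⊝ ⊝ q ≡ q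
  neg-neg = solve 1 (λ a → :- (:- a) := a) refl
    where open ℚ-Solver

coord-linear : ∀ {n} (i : Fin n) → Linear (λ x → x i)
coord-linear i = record { ext = λ p → p i ; zer = refl ; axpy = λ _ _ _ → refl }

mask : Bool → ℚ → ℚ
mask b q = if b then q else 0ℚ

masked-linear : ∀ {n} (b : Fin n → Bool) → Linear (λ x → ∑ λ k → mask (b k) (x k))
masked-linear b = record
  { ext  = λ p → ∑-cong λ k → cong (mask (b k)) (p k)
  ; zer  = ∑-zero λ k → mask-zero (b k)
  ; axpy = λ a x y → trans (∑-cong λ k → mask-axpy (b k) a (x k) (y k))
      (trans (∑-distrib-+ (λ k → a ⊛ mask (b k) (x k)) (λ k → mask (b k) (y k)))
             (cong (_⊕ ∑ (λ k → mask (b k) (y k))) (∑-*ˡ a (λ k → mask (b k) (x k))))) }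
  where
  mask-zero : ∀ b → mask b 0ℚ ≡ 0ℚ
  mask-zero true  = refl
  mask-zero false = refl
  mask-axpy : ∀ b a p q → mask b (a ⊛ p ⊕ q) ≡ a ⊛ mask b p ⊕ mask b q
  mask-axpy true  a p q = refl
  mask-axpy false a p q = sym (trans (ℚₚ.+-identityʳ (a ⊛ 0ℚ)) (ℚₚ.*-zeroʳ a))

∑-mask-unit : ∀ {n} (b : Fin n → Bool) i → ∑ (λ k → mask (b k) (unit i k)) ≡ mask (b i) 1ℚ
∑-mask-unit b i = trans
  (∑-single i λ j j≢i → trans (cong (mask (b j)) (unit-other j≢i)) (mask-0 (b j)))
  (cong (mask (b i)) (unit-self i))
  where
  mask-0 : ∀ b → mask b 0ℚ ≡ 0ℚ
  mask-0 true  = refl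
  mask-0 false = refl

-- Rank-2 matroids as colourings

-- A colouring encodes a rank-2 matroid: colour 0 marks loops, elements of colour 1 are
-- singleton parallel classes, and every other colour is one parallel class.
Colouring : ℕ → Set
Colouring n = Fin n → ℕ

Indep : ∀ {n} → Colouring n → Fin n → Fin n → Set
Indep c i j = i ≢ j × c i ≢ 0 × c j ≢ 0 × (c i ≡ c j → c i ≡ 1)

Vert : ∀ {n} → Colouring n → Point n → Set
Vert c y = ∃₂ λ i j → Indep c i j × (∀ k → y k ≡ pairInd i j k)

classSum : ∀ {n} → Colouring n → Point n → ℕ → ℚ
classSum c z t = ∑ λ k → mask (does (c k ℕ.≟ t)) (z k)

-- Classes are addressed through their elements, which leaves finitely many decidable conditions.
-- For an element of colour 1, `le1` is the inequality of its singleton class.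
record Poly {n} (c : Colouring n) (z : Point n) : Set where
  field
    nonneg : ∀ i → 0ℚ ≤ᵣ z i
    total  : ∑ z ≡ 2ℚ
    loops  : ∀ i → c i ≡ 0 → z i ≡ 0ℚ
    le1    : ∀ i → z i ≤ᵣ 1ℚ
    class  : ∀ i → 2 ≤ c i → classSum c z (c i) ≤ᵣ 1ℚ
open Poly public

-- Every condition bounds a linear functional, so it is enough to look at the vertices; an equation
-- is a pair of bounds.
hull⇒poly : ∀ {n} {c : Colouring n} {z} → InHull (Vert c) z → Poly c z
hull⇒poly {n} {c} {z} h = record
  { nonneg = λ i → hull-≥ (coord-linear i)
      (λ { (a , b , _ , y≡) → subst (0ℚ ≤ᵣ_) (sym (y≡ i)) (ind-≥0 _) }) h
  ; total  = ℚₚ.≤-antisym (hull-≤ sum-linear (λ v → ℚₚ.≤-reflexive (total-vert v)) h)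
                          (hull-≥ sum-linear (λ v → ℚₚ.≤-reflexive (sym (total-vert v))) h)
  ; loops  = λ i ci≡0 → ℚₚ.≤-antisym
      (hull-≤ (coord-linear i) (λ v → ℚₚ.≤-reflexive (loop-vert i ci≡0 v)) h)
      (hull-≥ (coord-linear i) (λ v → ℚₚ.≤-reflexive (sym (loop-vert i ci≡0 v))) h)
  ; le1    = λ i → hull-≤ (coord-linear i)
      (λ { (a , b , _ , y≡) → subst (_≤ᵣ 1ℚ) (sym (y≡ i)) (ind-≤1 _) }) h
  ; class  = λ i 2≤ → hull-≤ (masked-linear _) (class-vert 2≤) h
  }
  where
  ind-≥0 : ∀ b → 0ℚ ≤ᵣ (if b then 1ℚ else 0ℚ)
  ind-≥0 true  = 0≤1
  ind-≥0 false = ℚₚ.≤-refl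
  ind-≤1 : ∀ b → (if b then 1ℚ else 0ℚ) ≤ᵣ 1ℚ
  ind-≤1 true  = ℚₚ.≤-refl
  ind-≤1 false = 0≤1
  sum-linear : Linear ∑
  sum-linear = masked-linear (λ _ → true)
  masked-vert : ∀ b (y : Point n) i j → i ≢ j → (∀ k → y k ≡ pairInd i j k) →
    ∑ (λ k → mask (b k) (y k)) ≡ mask (b i) 1ℚ ⊕ mask (b j) 1ℚ
  masked-vert b y i j i≢j y≡ = trans (lin.ext λ k → trans (y≡ k)
      (trans (pairInd-unit i≢j k) (cong (_⊕ unit j k) (sym (ℚₚ.*-identityˡ (unit i k))))))
    (trans (lin.axpy 1ℚ (unit i) (unit j))
      (cong₂ _⊕_ (trans (ℚₚ.*-identityˡ (∑ λ k → mask (b k) (unit i k))) (∑-mask-unit b i)) (∑-mask-unit b j)))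
    where module lin = Linear (masked-linear b)
  total-vert : ∀ {y} → Vert c y → ∑ y ≡ 2ℚ
  total-vert {y} (i , j , (i≢j , _) , y≡) = masked-vert (λ _ → true) y i j i≢j y≡
  loop-vert : ∀ l → c l ≡ 0 → ∀ {y} → Vert c y → y l ≡ 0ℚ
  loop-vert l cl≡0 (i , j , (i≢j , ci≢0 , cj≢0 , _) , y≡) =
    trans (y≡ l) (trans (pairInd-unit i≢j l)
      (cong₂ _⊕_ (unit-other {i = i} {l} λ { refl → ci≢0 cl≡0 })
                 (unit-other {i = j} {l} λ { refl → cj≢0 cl≡0 })))
  class-vert : ∀ {t} → 2 ≤ t → ∀ {y} → Vert c y → classSum c y t ≤ᵣ 1ℚ
  class-vert {t} 2≤t {y} (i , j , (i≢j , _ , _ , sep) , y≡) =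
    subst (_≤ᵣ 1ℚ) (sym (masked-vert (λ k → does (c k ℕ.≟ t)) y i j i≢j y≡)) (bound (c i ℕ.≟ t) (c j ℕ.≟ t) λ p q →
      ℕₚ.<⇒≱ (s≤s (ℕₚ.≤-reflexive (trans (sym p) (sep (trans p (sym q)))))) 2≤t)
    where
    bound : ∀ {A B : Set} (a? : Dec A) (b? : Dec B) → (A → ¬ B) →
            mask (does a?) 1ℚ ⊕ mask (does b?) 1ℚ ≤ᵣ 1ℚ
    bound (yes a) (yes b) excl = contradiction b (excl a)
    bound (yes _) (no _)  _    = ℚₚ.≤-refl
    bound (no _)  (yes _) _    = ℚₚ.≤-refl
    bound (no _)  (no _)  _    = 0≤1

-- The inequality description of the base polytope

prefix : ∀ {n} → Point n → ℕ → ℚ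
prefix {zero}  z m       = 0ℚ
prefix {suc n} z zero    = 0ℚ
prefix {suc n} z (suc m) = z Fin.zero ⊕ prefix (z ∘ Fin.suc) m

prefix-zero : ∀ {n} (z : Point n) → prefix z 0 ≡ 0ℚ
prefix-zero {zero}  z = refl
prefix-zero {suc n} z = refl

prefix-suc : ∀ {n} (z : Point n) j → prefix z (suc (toℕ j)) ≡ prefix z (toℕ j) ⊕ z j
prefix-suc z Fin.zero = trans (cong (z Fin.zero ⊕_) (prefix-zero (z ∘ Fin.suc)))
  (ℚₚ.+-comm (z Fin.zero) 0ℚ)
prefix-suc z (Fin.suc j) = trans (cong (z Fin.zero ⊕_) (prefix-suc (z ∘ Fin.suc) j))
  (sym (ℚₚ.+-assoc (z Fin.zero) (prefix (z ∘ Fin.suc) (toℕ j)) (z (Fin.suc j))))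

prefix-all : ∀ {n} (z : Point n) → prefix z n ≡ ∑ z
prefix-all {zero}  z = refl
prefix-all {suc n} z = cong (z Fin.zero ⊕_) (prefix-all (z ∘ Fin.suc))

prefix-masked : ∀ {n} (z : Point n) m → prefix z m ≡ ∑ λ k → mask (does (toℕ k ℕ.<? m)) (z k)
prefix-masked {zero}  z m       = refl
prefix-masked {suc n} z zero    = sym (∑-zero {suc n} λ _ → refl)
prefix-masked {suc n} z (suc m) = cong (z Fin.zero ⊕_) (prefix-masked (z ∘ Fin.suc) m)

mask-≤ : ∀ {A : Set} (a? : Dec A) b {q} → 0ℚ ≤ᵣ q → (A → b ≡ true) → mask (does a?) q ≤ᵣ mask b q
mask-≤ (no _)  true  0≤q _ = 0≤q
mask-≤ (no _)  false 0≤q _ = ℚₚ.≤-refl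
mask-≤ (yes a) b {q} 0≤q f = ℚₚ.≤-reflexive (cong (λ b → mask b q) (sym (f a)))

prefix-mono : ∀ {n} {z : Point n} → (∀ i → 0ℚ ≤ᵣ z i) → ∀ {l m} → l ≤ m → prefix z l ≤ᵣ prefix z m
prefix-mono {z = z} z≥0 {l} {m} l≤m = subst₂ _≤ᵣ_ (sym (prefix-masked z l)) (sym (prefix-masked z m))
  (∑-mono λ k → mask-≤ (toℕ k ℕ.<? l) (does (toℕ k ℕ.<? m)) (z≥0 k)
    λ k<l → dec-true (toℕ k ℕ.<? m) (ℕₚ.<-≤-trans k<l l≤m))

telescope : ∀ {n} (G : ℕ → ℚ) → ∑ {n} (λ j → G (suc (toℕ j)) ⊖ G (toℕ j)) ≡ G n ⊖ G 0
telescope {zero}  G = sym (ℚₚ.+-inverseʳ (G 0))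
telescope {suc n} G = trans (cong ((G 1 ⊖ G 0) ⊕_) (telescope {n} (G ∘ suc)))
  (solve 3 (λ a b c → (a :- b) :+ (c :- a) := c :- b) refl (G 1) (G 0) (G (suc n)))
  where open ℚ-Solver

Monotone : ∀ {n} → Colouring n → Set
Monotone c = ∀ i j → toℕ i ≤ toℕ j → c i ≤ c j

⊖-≥0 : ∀ {p q} → p ≤ᵣ q → 0ℚ ≤ᵣ q ⊖ p
⊖-≥0 {p} {q} p≤q = subst (_≤ᵣ q ⊖ p) (ℚₚ.+-inverseʳ p) (ℚₚ.+-monoˡ-≤ (⊝ p) p≤q)

⊖-≤ : ∀ {p q r} → p ≤ᵣ q ⊕ r → p ⊖ r ≤ᵣ q
⊖-≤ {p} {q} {r} h = subst (p ⊖ r ≤ᵣ_)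
  (solve 2 (λ a b → (a :+ b) :- b := a) refl q r) (ℚₚ.+-monoˡ-≤ (⊝ r) h)
  where open ℚ-Solver

-- For `a ≤ b`, the length of the part of [a, b] lying below `t`. As a difference it telescopes over
-- consecutive intervals.
cover : ℚ → ℚ → ℚ → ℚ
cover a b t = (t ⊓ b) ⊖ (t ⊓ a)

-- In the clamped form `t` occurs once and positively, so monotonicity in `t` can be read off.
cover-clamp : ∀ {a b} t → a ≤ᵣ b → cover a b t ≡ (a ⊔ (t ⊓ b)) ⊖ a
cover-clamp {a} {b} t a≤b with ℚₚ.≤-total t a
... | inj₁ t≤a = begin
  (t ⊓ b) ⊖ (t ⊓ a)  ≡⟨ cong₂ _⊖_ t⊓b (ℚₚ.p≤q⇒p⊓q≡p t≤a) ⟩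
  t ⊖ t              ≡⟨ ℚₚ.+-inverseʳ t ⟩
  0ℚ                 ≡⟨ ℚₚ.+-inverseʳ a ⟨
  a ⊖ a              ≡⟨ cong (_⊖ a) (ℚₚ.p≥q⇒p⊔q≡p (subst (_≤ᵣ a) (sym t⊓b) t≤a)) ⟨
  (a ⊔ (t ⊓ b)) ⊖ a  ∎
  where
  open ≡-Reasoning
  t⊓b : t ⊓ b ≡ t
  t⊓b = ℚₚ.p≤q⇒p⊓q≡p (ℚₚ.≤-trans t≤a a≤b)
... | inj₂ a≤t = cong₂ _⊖_ (sym (ℚₚ.p≤q⇒p⊔q≡q (ℚₚ.⊓-glb a≤t a≤b))) (ℚₚ.p≥q⇒p⊓q≡q a≤t)

cover-mono : ∀ {a b s t} → a ≤ᵣ b → s ≤ᵣ t → cover a b s ≤ᵣ cover a b t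
cover-mono {a} {b} {s} {t} a≤b s≤t = subst₂ _≤ᵣ_ (sym (cover-clamp s a≤b)) (sym (cover-clamp t a≤b))
  (ℚₚ.+-monoˡ-≤ (⊝ a) (ℚₚ.⊔-monoʳ-≤ a (ℚₚ.⊓-monoˡ-≤ b s≤t)))

cover-below : ∀ {a b t} → a ≤ᵣ b → t ≤ᵣ a → cover a b t ≡ 0ℚ
cover-below {t = t} a≤b t≤a = trans
  (cong₂ _⊖_ (ℚₚ.p≤q⇒p⊓q≡p (ℚₚ.≤-trans t≤a a≤b)) (ℚₚ.p≤q⇒p⊓q≡p t≤a)) (ℚₚ.+-inverseʳ t)

indep? : ∀ {n} (c : Colouring n) i j → Dec (Indep c i j)
indep? c i j = ¬? (i Fin.≟ j) ×-dec ¬? (c i ℕ.≟ 0) ×-dec ¬? (c j ℕ.≟ 0)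
  ×-dec (c i ℕ.≟ c j →-dec c i ℕ.≟ 1)

-- Lay the coordinates of z end to end on [0, 2], element i occupying [A i, A (i + 1)].  A point
-- θ uniform on [0, 1] selects the pair of elements covering θ and θ + 1, which never lie in a
-- common class, as a class occupies an interval of length at most 1.  The pair (i, j) receives
-- the weight w i j = |[A i, A (i + 1)] ∩ [A j - 1, A (j + 1) - 1]|.
module Systematic {n} {c : Colouring n} {z : Point n} (mono : Monotone c) (Q : Poly c z) where

  A : ℕ → ℚ
  A = prefix z

  φ : Fin n → ℚ → ℚ
  φ i = cover (A (toℕ i)) (A (suc (toℕ i)))

  w : Fin n → Fin n → ℚ
  w i j = φ i (A (suc (toℕ j)) ⊖ 1ℚ) ⊖ φ i (A (toℕ j) ⊖ 1ℚ)

  A-step : ∀ (i : Fin n) → A (toℕ i) ≤ᵣ A (suc (toℕ i))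
  A-step i = prefix-mono (nonneg Q) (ℕₚ.n≤1+n (toℕ i))

  A≤2 : ∀ {m} → m ≤ n → A m ≤ᵣ 2ℚ
  A≤2 {m} m≤n = subst (A m ≤ᵣ_) (trans (prefix-all z) (total Q)) (prefix-mono (nonneg Q) m≤n)

  A≥0 : ∀ m → 0ℚ ≤ᵣ A m
  A≥0 m = subst (_≤ᵣ A m) (prefix-zero z) (prefix-mono (nonneg Q) z≤n)

  w-nonneg : ∀ i j → 0ℚ ≤ᵣ w i j
  w-nonneg i j = ⊖-≥0 (cover-mono (A-step i) (ℚₚ.+-monoˡ-≤ (⊝ 1ℚ) (A-step j)))

  A-empty : ∀ i → z i ≡ 0ℚ → A (suc (toℕ i)) ≡ A (toℕ i)
  A-empty i zi≡0 = trans (prefix-suc z i)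
    (trans (cong (A (toℕ i) ⊕_) zi≡0) (ℚₚ.+-identityʳ (A (toℕ i))))

  -- Moved down by 1, the interval of `j` ends no later than that of `i` begins, so the two do not
  -- overlap.
  w-near : ∀ i j → A (suc (toℕ j)) ≤ᵣ A (toℕ i) ⊕ 1ℚ → w i j ≡ 0ℚ
  w-near i j h = cong₂ _⊖_ (cover-below (A-step i) above)
    (cover-below (A-step i) (ℚₚ.≤-trans (ℚₚ.+-monoˡ-≤ (⊝ 1ℚ) (A-step j)) above))
    where
    above : A (suc (toℕ j)) ⊖ 1ℚ ≤ᵣ A (toℕ i)
    above = ⊖-≤ {r = 1ℚ} h

  ≤-⊕1 : ∀ p → p ≤ᵣ p ⊕ 1ℚ
  ≤-⊕1 p = subst (_≤ᵣ p ⊕ 1ℚ) (ℚₚ.+-identityʳ p) (ℚₚ.+-monoʳ-≤ p 0≤1)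

  -- By monotonicity every element from `i` to `j` has the colour of `i`, so the stretch from `A i`
  -- to `A (j + 1)` is part of the class sum.
  class-near : ∀ i j → toℕ i ≤ toℕ j → c i ≡ c j → 2 ≤ c i → A (suc (toℕ j)) ≤ᵣ A (toℕ i) ⊕ 1ℚ
  class-near i j i≤j ci≡cj 2≤ci = ℚₚ.≤-trans
    (≤ᵣ-by (prefix-masked z (suc (toℕ j)))
      (trans (cong (_⊕ classSum c z (c i)) (prefix-masked z (toℕ i)))
        (sym (∑-distrib-+ (λ k → mask (does (toℕ k ℕ.<? toℕ i)) (z k))
                          (λ k → mask (does (c k ℕ.≟ c i)) (z k)))))
      (∑-mono λ k → split (toℕ k ℕ.<? suc (toℕ j)) (toℕ k ℕ.<? toℕ i) (c k ℕ.≟ c i)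
        (nonneg Q k) λ k≤j i≤k → ℕₚ.≤-antisym
          (subst (c k ≤_) (sym ci≡cj) (mono k j (ℕₚ.≤-pred k≤j))) (mono i k (ℕₚ.≮⇒≥ i≤k))))
    (ℚₚ.+-monoʳ-≤ (A (toℕ i)) (class Q i 2≤ci))
    where
    split : ∀ {P R S : Set} (p? : Dec P) (r? : Dec R) (s? : Dec S) {q} → 0ℚ ≤ᵣ q → (P → ¬ R → S) →
            mask (does p?) q ≤ᵣ mask (does r?) q ⊕ mask (does s?) q
    split (no _)  (no _)  (no _)  0≤q f = ℚₚ.≤-refl
    split (no _)  (no _)  (yes _) {q} 0≤q f = ≤ᵣ-by refl (ℚₚ.+-identityˡ q) 0≤q
    split (no _)  (yes _) (no _)  {q} 0≤q f = ≤ᵣ-by refl (ℚₚ.+-identityʳ q) 0≤q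
    split (no _)  (yes _) (yes _) 0≤q f = ℚₚ.+-mono-≤ 0≤q 0≤q
    split (yes p) (no ¬r) (no ¬s) 0≤q f = contradiction (f p ¬r) ¬s
    split (yes _) (no _)  (yes _) {q} 0≤q f = ℚₚ.≤-reflexive (sym (ℚₚ.+-identityˡ q))
    split (yes _) (yes _) (no _)  {q} 0≤q f = ℚₚ.≤-reflexive (sym (ℚₚ.+-identityʳ q))
    split (yes _) (yes _) (yes _) {q} 0≤q f =
      subst (_≤ᵣ q ⊕ q) (ℚₚ.+-identityˡ q) (ℚₚ.+-monoˡ-≤ q 0≤q)

  w-dependent : ∀ i j → ¬ Indep c i j → w i j ≡ 0ℚ
  w-dependent i j dep with i Fin.≟ j | c i ℕ.≟ 0 | c j ℕ.≟ 0
  ... | yes refl | _ | _ = w-near i i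
    (≤ᵣ-by (prefix-suc z i) refl (ℚₚ.+-monoʳ-≤ (A (toℕ i)) (le1 Q i)))
  ... | _ | yes ci≡0 | _ = cong₂ _⊖_ (empty (A (suc (toℕ j)) ⊖ 1ℚ)) (empty (A (toℕ j) ⊖ 1ℚ))
    where
    empty : ∀ t → φ i t ≡ 0ℚ
    empty t = trans (cong (λ b → (t ⊓ b) ⊖ (t ⊓ A (toℕ i))) (A-empty i (loops Q i ci≡0)))
                    (ℚₚ.+-inverseʳ (t ⊓ A (toℕ i)))
  ... | _ | _ | yes cj≡0 = trans
    (cong (λ t → φ i (t ⊖ 1ℚ) ⊖ φ i (A (toℕ j) ⊖ 1ℚ)) (A-empty j (loops Q j cj≡0)))
    (ℚₚ.+-inverseʳ (φ i (A (toℕ j) ⊖ 1ℚ)))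
  ... | no i≢j | no ci≢0 | no cj≢0 with c i ℕ.≟ c j | c i ℕ.≟ 1
  ...   | no ci≢cj  | _ = contradiction (i≢j , ci≢0 , cj≢0 , λ e → contradiction e ci≢cj) dep
  ...   | yes _     | yes ci≡1 = contradiction (i≢j , ci≢0 , cj≢0 , λ _ → ci≡1) dep
  ...   | yes ci≡cj | no ci≢1 with ℕₚ.≤-total (toℕ i) (toℕ j)
  ...     | inj₁ i≤j = w-near i j (class-near i j i≤j ci≡cj
    (ℕₚ.≤∧≢⇒< (ℕₚ.n≢0⇒n>0 ci≢0) (ci≢1 ∘ sym)))
  -- In `w i j` it is `i` that covers θ and `j` that covers θ + 1, so an earlier `j` has no weight
  -- whatever its class.
  ...     | inj₂ j≤i = w-near i j (ℚₚ.≤-trans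
    (prefix-mono (nonneg Q) (ℕₚ.≤∧≢⇒< j≤i (i≢j ∘ sym ∘ Finₚ.toℕ-injective)))
    (≤-⊕1 (A (toℕ i))))

  -- Moved down by 1, the intervals of all `j` tile [-1, 1]; what they cover of interval `i` is its
  -- part below 1.
  row : ∀ i → ∑ (w i) ≡ (1ℚ ⊓ A (suc (toℕ i))) ⊖ (1ℚ ⊓ A (toℕ i))
  row i = begin
    ∑ (w i)                            ≡⟨ telescope {n} (λ m → φ i (A m ⊖ 1ℚ)) ⟩
    φ i (A n ⊖ 1ℚ) ⊖ φ i (A 0 ⊖ 1ℚ)    ≡⟨ cong₂ (λ s t → φ i (s ⊖ 1ℚ) ⊖ t)
                                            (trans (prefix-all z) (total Q)) low ⟩
    φ i 1ℚ ⊕ 0ℚ                        ≡⟨ ℚₚ.+-identityʳ (φ i 1ℚ) ⟩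
    φ i 1ℚ                             ∎
    where
    open ≡-Reasoning
    low : φ i (A 0 ⊖ 1ℚ) ≡ 0ℚ
    low = cover-below (A-step i) (⊖-≤ {r = 1ℚ} (subst (_≤ᵣ A (toℕ i) ⊕ 1ℚ) (sym (prefix-zero z))
      (ℚₚ.≤-trans (A≥0 (toℕ i)) (≤-⊕1 (A (toℕ i))))))

  -- The right side is the positive part of `A m ⊖ 1ℚ`; a column sum is thus the part of interval
  -- `j` above 1.
  column-part : ∀ {m} → m ≤ n → ∑ (λ i → φ i (A m ⊖ 1ℚ)) ≡ (A m ⊖ 1ℚ) ⊖ ((A m ⊖ 1ℚ) ⊓ 0ℚ)
  column-part {m} m≤n = trans (telescope {n} (λ l → (A m ⊖ 1ℚ) ⊓ A l))
    (cong₂ _⊖_ (trans (cong ((A m ⊖ 1ℚ) ⊓_) (trans (prefix-all z) (total Q))) (ℚₚ.p≤q⇒p⊓q≡p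
        (ℚₚ.≤-trans (⊖-≤ {A m} {1ℚ} {1ℚ} (A≤2 m≤n)) (≤-⊕1 1ℚ))))
      (cong ((A m ⊖ 1ℚ) ⊓_) (prefix-zero z)))

  column : ∀ j → ∑ (λ i → w i j) ≡
    ((A (suc (toℕ j)) ⊖ 1ℚ) ⊖ ((A (suc (toℕ j)) ⊖ 1ℚ) ⊓ 0ℚ)) ⊖ ((A (toℕ j) ⊖ 1ℚ) ⊖ ((A (toℕ j) ⊖ 1ℚ) ⊓ 0ℚ))
  column j = trans (∑-⊖ (λ i → φ i (A (suc (toℕ j)) ⊖ 1ℚ)) (λ i → φ i (A (toℕ j) ⊖ 1ℚ)))
    (cong₂ _⊖_ (column-part (Finₚ.toℕ<n j)) (column-part (ℕₚ.<⇒≤ (Finₚ.toℕ<n j))))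

  ⊓-shift : ∀ a → (a ⊖ 1ℚ) ⊓ 0ℚ ≡ (1ℚ ⊓ a) ⊖ 1ℚ
  ⊓-shift a with ℚₚ.≤-total a 1ℚ
  ... | inj₁ a≤1 = trans (ℚₚ.p≤q⇒p⊓q≡p (⊖-≤ {a} {0ℚ} {1ℚ} a≤1)) (cong (_⊖ 1ℚ) (sym (ℚₚ.p≥q⇒p⊓q≡q a≤1)))
  ... | inj₂ 1≤a = trans (ℚₚ.p≥q⇒p⊓q≡q (⊖-≥0 1≤a)) (cong (_⊖ 1ℚ) (sym (ℚₚ.p≤q⇒p⊓q≡p 1≤a)))

  -- The row gives the part of interval `k` below 1, the column the part above 1, and together they
  -- make up its length.
  marginal : ∀ k → ∑ (w k) ⊕ ∑ (λ i → w i k) ≡ z k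
  marginal k = begin
    ∑ (w k) ⊕ ∑ (λ i → w i k)
      ≡⟨ cong₂ _⊕_ (row k) (column k) ⟩
    ((1ℚ ⊓ b) ⊖ (1ℚ ⊓ a)) ⊕ (((b ⊖ 1ℚ) ⊖ ((b ⊖ 1ℚ) ⊓ 0ℚ)) ⊖ ((a ⊖ 1ℚ) ⊖ ((a ⊖ 1ℚ) ⊓ 0ℚ)))
      ≡⟨ cong₂ (λ s t → ((1ℚ ⊓ b) ⊖ (1ℚ ⊓ a)) ⊕ (((b ⊖ 1ℚ) ⊖ s) ⊖ ((a ⊖ 1ℚ) ⊖ t)))
           (⊓-shift b) (⊓-shift a) ⟩
    ((1ℚ ⊓ b) ⊖ (1ℚ ⊓ a)) ⊕ (((b ⊖ 1ℚ) ⊖ ((1ℚ ⊓ b) ⊖ 1ℚ)) ⊖ ((a ⊖ 1ℚ) ⊖ ((1ℚ ⊓ a) ⊖ 1ℚ)))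
      ≡⟨ solve 5 (λ a b s t o → (t :- s) :+ (((b :- o) :- (t :- o)) :- ((a :- o) :- (s :- o))) := b :- a)
           refl a b (1ℚ ⊓ a) (1ℚ ⊓ b) 1ℚ ⟩
    b ⊖ a
      ≡⟨ cong (_⊖ a) (prefix-suc z k) ⟩
    (a ⊕ z k) ⊖ a
      ≡⟨ solve 2 (λ a x → (a :+ x) :- a := x) refl a (z k) ⟩
    z k ∎
    where
    open ≡-Reasoning
    open ℚ-Solver
    a b : ℚ
    a = A (toℕ k)
    b = A (suc (toℕ k))

  w-total : ∑ (λ i → ∑ (w i)) ≡ 1ℚ
  w-total = begin
    ∑ (λ i → ∑ (w i))                    ≡⟨ ∑-cong row ⟩
    ∑ {n} (λ i → (1ℚ ⊓ A (suc (toℕ i))) ⊖ (1ℚ ⊓ A (toℕ i)))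
                                         ≡⟨ telescope {n} (λ m → 1ℚ ⊓ A m) ⟩
    (1ℚ ⊓ A n) ⊖ (1ℚ ⊓ A 0)              ≡⟨ cong₂ (λ s t → (1ℚ ⊓ s) ⊖ (1ℚ ⊓ t))
                                              (trans (prefix-all z) (total Q)) (prefix-zero z) ⟩
    1ℚ                                   ∎
    where open ≡-Reasoning

  -- `pairInd i i` is `unit i` and not twice it, so on the diagonal the identity rests on the weight
  -- being 0.
  w-pair : ∀ i j k → w i j ⊛ pairInd i j k ≡ w i j ⊛ unit i k ⊕ w i j ⊛ unit j k
  w-pair i j k with i Fin.≟ j
  ... | no i≢j = trans (cong (w i j ⊛_) (pairInd-unit i≢j k)) (ℚₚ.*-distribˡ-+ (w i j) (unit i k) (unit j k))
  ... | yes refl = begin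
    w i i ⊛ pairInd i i k              ≡⟨ cong (_⊛ pairInd i i k) wii ⟩
    0ℚ ⊛ pairInd i i k                 ≡⟨ ℚₚ.*-zeroˡ (pairInd i i k) ⟩
    0ℚ                                 ≡⟨ cong₂ _⊕_ (zero-term i) (zero-term i) ⟨
    w i i ⊛ unit i k ⊕ w i i ⊛ unit i k ∎
    where
    open ≡-Reasoning
    wii : w i i ≡ 0ℚ
    wii = w-dependent i i λ ind → proj₁ ind refl
    zero-term : ∀ l → w i i ⊛ unit l k ≡ 0ℚ
    zero-term l = trans (cong (_⊛ unit l k) wii) (ℚₚ.*-zeroˡ (unit l k))

  ∑-pick : (f : Fin n → ℚ) (k : Fin n) → ∑ (λ i → f i ⊛ unit i k) ≡ f k
  ∑-pick f k = trans
    (∑-single k λ j j≢k → trans (cong (f j ⊛_) (unit-other (j≢k ∘ sym))) (ℚₚ.*-zeroʳ (f j)))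
    (trans (cong (f k ⊛_) (unit-self k)) (ℚₚ.*-identityʳ (f k)))

  barycentre : ∀ k → ∑ (λ i → ∑ λ j → w i j ⊛ pairInd i j k) ≡ z k
  barycentre k = begin
    ∑ (λ i → ∑ λ j → w i j ⊛ pairInd i j k)
      ≡⟨ ∑-cong (λ i → trans (∑-cong λ j → w-pair i j k)
           (∑-distrib-+ (λ j → w i j ⊛ unit i k) (λ j → w i j ⊛ unit j k))) ⟩
    ∑ (λ i → ∑ (λ j → w i j ⊛ unit i k) ⊕ ∑ (λ j → w i j ⊛ unit j k))
      ≡⟨ ∑-distrib-+ (λ i → ∑ (λ j → w i j ⊛ unit i k)) (λ i → ∑ (λ j → w i j ⊛ unit j k)) ⟩
    ∑ (λ i → ∑ (λ j → w i j ⊛ unit i k)) ⊕ ∑ (λ i → ∑ (λ j → w i j ⊛ unit j k))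
      ≡⟨ cong₂ _⊕_ (∑-comm (λ i j → w i j ⊛ unit i k)) (∑-cong λ i → ∑-pick (w i) k) ⟩
    ∑ (λ j → ∑ (λ i → w i j ⊛ unit i k)) ⊕ ∑ (λ i → w i k)
      ≡⟨ cong (_⊕ ∑ (λ i → w i k)) (∑-cong λ j → ∑-pick (λ i → w i j) k) ⟩
    ∑ (w k) ⊕ ∑ (λ i → w i k)
      ≡⟨ marginal k ⟩
    z k ∎
    where open ≡-Reasoning

  term : ∀ i j → Cone (Vert c) (w i j) (λ k → w i j ⊛ pairInd i j k)
  term i j with indep? c i j
  ... | yes ind = add (w-nonneg i j) (i , j , ind , λ _ → refl) (nil refl λ _ → refl)
    (sym (ℚₚ.+-identityʳ (w i j))) λ k → sym (ℚₚ.+-identityʳ (w i j ⊛ pairInd i j k))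
  ... | no dep = nil (w-dependent i j dep) λ k →
    trans (cong (_⊛ pairInd i j k) (w-dependent i j dep)) (ℚₚ.*-zeroˡ (pairInd i j k))

  inHull : InHull (Vert c) z
  inHull = cone⇒hull (cone-cong w-total barycentre (cone-∑ λ i → cone-∑ (term i)))

-- Relabelling the ground set

Perm-injective : ∀ {n} (π : Permutation′ n) {i j} → π ⟨$⟩ʳ i ≡ π ⟨$⟩ʳ j → i ≡ j
Perm-injective π {i} {j} e = trans (sym (Perm.inverseˡ π)) (trans (cong (π ⟨$⟩ˡ_) e) (Perm.inverseˡ π))

unit-injective : ∀ {m n} (f : Fin m → Fin n) → (∀ {i j} → f i ≡ f j → i ≡ j) →
                 ∀ i k → unit (f i) (f k) ≡ unit i k
unit-injective f inj i k with k Fin.≟ i | f k Fin.≟ f i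
... | yes _    | yes _ = refl
... | yes refl | no ne = contradiction refl ne
... | no k≢i   | yes e = contradiction (inj e) k≢i
... | no _     | no _  = refl

vert-permute : ∀ {n} {c : Colouring n} (π : Permutation′ n) {y} →
               Vert (c ∘ (π ⟨$⟩ʳ_)) y → Vert c (y ∘ (π ⟨$⟩ˡ_))
vert-permute π (i , j , (i≢j , ci , cj , sep) , y≡) =
  π ⟨$⟩ʳ i , π ⟨$⟩ʳ j , (πi≢πj , ci , cj , sep) , λ k → begin
    _                                              ≡⟨ y≡ (π ⟨$⟩ˡ k) ⟩
    pairInd i j (π ⟨$⟩ˡ k)                         ≡⟨ pairInd-unit i≢j (π ⟨$⟩ˡ k) ⟩
    unit i (π ⟨$⟩ˡ k) ⊕ unit j (π ⟨$⟩ˡ k)          ≡⟨ cong₂ _⊕_ (move i k) (move j k) ⟩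
    unit (π ⟨$⟩ʳ i) k ⊕ unit (π ⟨$⟩ʳ j) k          ≡⟨ pairInd-unit πi≢πj k ⟨
    pairInd (π ⟨$⟩ʳ i) (π ⟨$⟩ʳ j) k                ∎
  where
  open ≡-Reasoning
  πi≢πj : π ⟨$⟩ʳ i ≢ π ⟨$⟩ʳ j
  πi≢πj = i≢j ∘ Perm-injective π
  move : ∀ i k → unit i (π ⟨$⟩ˡ k) ≡ unit (π ⟨$⟩ʳ i) k
  move i k = trans (sym (unit-injective (π ⟨$⟩ʳ_) (Perm-injective π) i (π ⟨$⟩ˡ k))) (cong (unit (π ⟨$⟩ʳ i)) (Perm.inverseʳ π))

poly-permute : ∀ {n} {c : Colouring n} {z} (π : Permutation′ n) → Poly c z →
               Poly (c ∘ (π ⟨$⟩ʳ_)) (z ∘ (π ⟨$⟩ʳ_))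
poly-permute {c = c} {z} π Q = record
  { nonneg = nonneg Q ∘ (π ⟨$⟩ʳ_)
  ; total  = trans (sym (∑-permute z π)) (total Q)
  ; loops  = loops Q ∘ (π ⟨$⟩ʳ_)
  ; le1    = le1 Q ∘ (π ⟨$⟩ʳ_)
  ; class  = λ i 2≤ → subst (_≤ᵣ 1ℚ) (∑-permute (λ k → mask (does (c k ℕ.≟ c (π ⟨$⟩ʳ i))) (z k)) π)
                            (class Q (π ⟨$⟩ʳ i) 2≤)
  }

argmin : ∀ {n} (c : Fin (suc n) → ℕ) → ∃ λ j → ∀ k → c j ≤ c k
argmin {zero}  c = Fin.zero , λ { Fin.zero → ℕₚ.≤-refl }
argmin {suc n} c with argmin (c ∘ Fin.suc)
... | j , min with ℕₚ.≤-total (c Fin.zero) (c (Fin.suc j))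
...   | inj₁ le = Fin.zero , λ { Fin.zero → ℕₚ.≤-refl ; (Fin.suc k) → ℕₚ.≤-trans le (min k) }
...   | inj₂ ge = Fin.suc j , λ { Fin.zero → ge ; (Fin.suc k) → min k }

-- `Systematic` needs classes to be intervals. Selection sort provides this: an element of least
-- colour goes to the front and the rest is sorted recursively.
sorting : ∀ {n} (c : Colouring n) → ∃ λ (π : Permutation′ n) → Monotone (c ∘ (π ⟨$⟩ʳ_))
sorting {zero}  c = Perm.id , λ ()
sorting {suc n} c with argmin c
... | j , min with sorting (c ∘ punchIn j)
...   | π , mono = Perm.insert Fin.zero j π , sorted
  where
  sorted : Monotone (c ∘ (Perm.insert Fin.zero j π ⟨$⟩ʳ_))
  sorted Fin.zero    k           _         = min _
  sorted (Fin.suc i) (Fin.suc k) (s≤s i≤k) = subst₂ _≤_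
    (cong c (sym (Perm.insert-punchIn Fin.zero j π i))) (cong c (sym (Perm.insert-punchIn Fin.zero j π k)))
    (mono i k i≤k)

poly⇒hull : ∀ {n} {c : Colouring n} {z} → Poly c z → InHull (Vert c) z
poly⇒hull {c = c} {z} Q with sorting c
... | π , mono = hull-cong (λ k → cong z (Perm.inverseʳ π))
  (hull-map (π ⟨$⟩ˡ_) (vert-permute π) (Systematic.inHull mono (poly-permute π Q)))

-- Decidable membership and 0/1 indicators

abstract
  -- Finitely many comparisons of rationals; through `hull⇒poly` and `poly⇒hull` this also decides
  -- membership in the hull.
  poly? : ∀ {n} (c : Colouring n) z → Dec (Poly c z)
  poly? c z = map′
    (λ { (a , b , d , e , f) → record { nonneg = a ; total = b ; loops = d ; le1 = e ; class = f } })
    (λ Q → nonneg Q , total Q , loops Q , le1 Q , class Q)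
    (Finₚ.all? (λ i → 0ℚ ℚₚ.≤? z i)
      ×-dec ∑ z ℚₚ.≟ 2ℚ
      ×-dec Finₚ.all? (λ i → c i ℕ.≟ 0 →-dec z i ℚₚ.≟ 0ℚ)
      ×-dec Finₚ.all? (λ i → z i ℚₚ.≤? 1ℚ)
      ×-dec Finₚ.all? (λ i → 2 ℕ.≤? c i →-dec classSum c z (c i) ℚₚ.≤? 1ℚ))

decInd : ∀ {A : Set} → Dec A → ℚ
decInd a? = if does a? then 1ℚ else 0ℚ

decInd-true : ∀ {A : Set} (a? : Dec A) → A → decInd a? ≡ 1ℚ
decInd-true a? a = cong (λ b → if b then 1ℚ else 0ℚ) (dec-true a? a)

decInd-false : ∀ {A : Set} (a? : Dec A) → ¬ A → decInd a? ≡ 0ℚ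
decInd-false a? ¬a = cong (λ b → if b then 1ℚ else 0ℚ) (dec-false a? ¬a)

decInd-cong : ∀ {A B : Set} (a? : Dec A) (b? : Dec B) → (A → B) → (B → A) → decInd a? ≡ decInd b?
decInd-cong (yes a) b? f g = sym (decInd-true b? (f a))
decInd-cong (no ¬a) b? f g = sym (decInd-false b? (¬a ∘ g))

indicator : ∀ {n} → Colouring n → Point n → ℚ
indicator c z = decInd (poly? c z)

indicator-true : ∀ {n} {c : Colouring n} {z} → Poly c z → indicator c z ≡ 1ℚ
indicator-true = decInd-true (poly? _ _)

indicator-false : ∀ {n} {c : Colouring n} {z} → ¬ Poly c z → indicator c z ≡ 0ℚ
indicator-false = decInd-false (poly? _ _)

indicator-cong : ∀ {m n} {c : Colouring m} {c′ : Colouring n} {z z′} →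
                 (Poly c z → Poly c′ z′) → (Poly c′ z′ → Poly c z) → indicator c z ≡ indicator c′ z′
indicator-cong = decInd-cong (poly? _ _) (poly? _ _)

poly-cong : ∀ {n} {c : Colouring n} {z z′} → (∀ i → z i ≡ z′ i) → Poly c z → Poly c z′
poly-cong z≡ Q = hull⇒poly (hull-cong z≡ (poly⇒hull Q))

-- The detour through the hull is short because `Indep` determines the vertices; the class
-- inequalities of two colourings need not be matched.
poly-indep : ∀ {n} {c c′ : Colouring n} → (∀ i j → Indep c i j → Indep c′ i j) →
             ∀ {z} → Poly c z → Poly c′ z
poly-indep imp Q = hull⇒poly (hull-map id (λ { (i , j , ind , y≡) → i , j , imp i j ind , y≡ }) (poly⇒hull Q))

indicator-indep : ∀ {n} {c c′ : Colouring n} → (∀ i j → Indep c i j → Indep c′ i j) →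
                  (∀ i j → Indep c′ i j → Indep c i j) → ∀ z → indicator c z ≡ indicator c′ z
indicator-indep f g z = indicator-cong (poly-indep f) (poly-indep g)

-- Expansion of a matroid polytope in polytopes with one nontrivial class

freeColour : ℕ → ℕ
freeColour zero    = 0
freeColour (suc _) = 1

onlyColour : ℕ → ℕ → ℕ
onlyColour t zero    = 0
onlyColour t (suc v) = if does (suc v ℕ.≟ t) then 2 else 1

-- On the polytope of c₁ = freeColour ∘ c, the sets {z : classSum c z t > 1} are pairwise
-- disjoint because ∑ z = 2, and they are what the class t cuts off.
module Expansion {n} (c : Colouring n) (K : ℕ) (bounded : ∀ i → c i < 2 + K) where

  c₁ : Colouring n
  c₁ = freeColour ∘ c

  cₜ : Fin K → Colouring n
  cₜ t = onlyColour (2 + toℕ t) ∘ c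

  S : Point n → Fin K → ℚ
  S z t = classSum c z (2 + toℕ t)

  free-≤1 : ∀ v → freeColour v ≤ 1
  free-≤1 zero    = z≤n
  free-≤1 (suc _) = s≤s z≤n

  free-0 : ∀ v → freeColour v ≡ 0 → v ≡ 0
  free-0 zero _ = refl

  only-0 : ∀ t v → onlyColour t v ≡ 0 → v ≡ 0
  only-0 t zero    _ = refl
  only-0 t (suc v) e with does (suc v ℕ.≟ t)
  only-0 t (suc v) () | true
  only-0 t (suc v) () | false

  only-2 : ∀ t v → 2 ≤ onlyColour t v → onlyColour t v ≡ 2
  only-2 t (suc v) le with does (suc v ℕ.≟ t)
  ... | true  = refl
  only-2 t (suc v) (s≤s ()) | false

  only-class : ∀ t v → does (onlyColour (2 + t) v ℕ.≟ 2) ≡ does (v ℕ.≟ 2 + t)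
  only-class t zero = refl
  only-class t (suc v) with does (suc v ℕ.≟ 2 + t)
  ... | true  = refl
  ... | false = refl

  module _ {z : Point n} where

    S-only : ∀ t → classSum (cₜ t) z 2 ≡ S z t
    S-only t = ∑-cong λ k → cong (λ b → mask b (z k)) (only-class (toℕ t) (c k))

    colour-index : ∀ i → 2 ≤ c i → ∃ λ (t : Fin K) → c i ≡ 2 + toℕ t
    colour-index i 2≤ with c i | 2≤ | bounded i
    ... | suc zero    | s≤s () | _
    ... | suc (suc v) | _ | s≤s (s≤s v<K) = fromℕ< v<K , cong (2 +_) (sym (Finₚ.toℕ-fromℕ< v<K))

    to-c : Poly c₁ z → (∀ t → S z t ≤ᵣ 1ℚ) → Poly c z
    to-c Q h = record
      { nonneg = nonneg Q ; total = total Q ; le1 = le1 Q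
      ; loops = λ i e → loops Q i (cong freeColour e)
      ; class = λ i 2≤ → let t , e = colour-index i 2≤ in
          subst (λ v → classSum c z v ≤ᵣ 1ℚ) (sym e) (h t) }

    to-cₜ : Poly c₁ z → ∀ t → S z t ≤ᵣ 1ℚ → Poly (cₜ t) z
    to-cₜ Q t h = record
      { nonneg = nonneg Q ; total = total Q ; le1 = le1 Q
      ; loops = λ i e → loops Q i (cong freeColour (only-0 (2 + toℕ t) (c i) e))
      ; class = λ i 2≤ → subst (λ v → classSum (cₜ t) z v ≤ᵣ 1ℚ)
          (sym (only-2 (2 + toℕ t) (c i) 2≤)) (subst (_≤ᵣ 1ℚ) (sym (S-only t)) h) }

    S-empty : ∀ t → (∀ k → c k ≢ 2 + toℕ t) → S z t ≡ 0ℚ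
    S-empty t none = ∑-zero λ k → cong (λ b → mask b (z k)) (dec-false (c k ℕ.≟ 2 + toℕ t) (none k))

    -- `class` speaks only of colours that occur; for any other `t` the class sum is empty and the
    -- bound trivial.
    from-c : Poly c z → Poly c₁ z × (∀ t → S z t ≤ᵣ 1ℚ)
    from-c Q = record
      { nonneg = nonneg Q ; total = total Q ; le1 = le1 Q
      ; loops = λ i e → loops Q i (free-0 (c i) e)
      ; class = λ i 2≤ → contradiction (free-≤1 (c i)) (ℕₚ.<⇒≱ 2≤) } , bound
      where
      bound : ∀ t → S z t ≤ᵣ 1ℚ
      bound t with Finₚ.any? (λ k → c k ℕ.≟ 2 + toℕ t)
      ... | yes (k , e) = subst (λ v → classSum c z v ≤ᵣ 1ℚ) e
        (class Q k (subst (2 ≤_) (sym e) (s≤s (s≤s z≤n))))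
      ... | no none = subst (_≤ᵣ 1ℚ) (sym (S-empty t λ k e → none (k , e))) 0≤1

    from-cₜ : ∀ t → Poly (cₜ t) z → Poly c₁ z × S z t ≤ᵣ 1ℚ
    from-cₜ t Q = record
      { nonneg = nonneg Q ; total = total Q ; le1 = le1 Q
      ; loops = λ i e → loops Q i (cong (onlyColour (2 + toℕ t)) (free-0 (c i) e))
      ; class = λ i 2≤ → contradiction (free-≤1 (c i)) (ℕₚ.<⇒≱ 2≤) } , bound
      where
      only-hit : ∀ {k} → c k ≡ 2 + toℕ t → cₜ t k ≡ 2
      only-hit e = trans (cong (onlyColour (2 + toℕ t)) e)
        (cong (λ b → if b then 2 else 1) (dec-true (2 + toℕ t ℕ.≟ 2 + toℕ t) refl))
      bound : S z t ≤ᵣ 1ℚ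
      bound with Finₚ.any? (λ k → c k ℕ.≟ 2 + toℕ t)
      ... | yes (k , e) = subst (_≤ᵣ 1ℚ) (S-only t) (subst (λ v → classSum (cₜ t) z v ≤ᵣ 1ℚ) (only-hit e)
        (class Q k (ℕₚ.≤-reflexive (sym (only-hit e)))))
      ... | no none = subst (_≤ᵣ 1ℚ) (sym (S-empty t λ k e → none (k , e))) 0≤1

    disjoint : Poly c₁ z → ∀ s t → s ≢ t → 1ℚ <ᵣ S z s → S z t ≤ᵣ 1ℚ
    disjoint Q s t s≢t 1<Ss = ℚₚ.<⇒≤ (ℚₚ.≰⇒> λ 1≤St → ℚₚ.<-irrefl refl
      (ℚₚ.<-≤-trans (ℚₚ.+-mono-<-≤ 1<Ss 1≤St) (subst (S z s ⊕ S z t ≤ᵣ_) (total Q)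
        (subst (_≤ᵣ ∑ z) (∑-distrib-+ (λ k → mask (does (c k ℕ.≟ 2 + toℕ s)) (z k))
                                       (λ k → mask (does (c k ℕ.≟ 2 + toℕ t)) (z k)))
          (∑-mono λ k → once (c k ℕ.≟ 2 + toℕ s) (c k ℕ.≟ 2 + toℕ t) (nonneg Q k) λ p q →
            s≢t (Finₚ.toℕ-injective (ℕₚ.suc-injective (ℕₚ.suc-injective (trans (sym p) q)))))))))
      where
      once : ∀ {A B : Set} (a? : Dec A) (b? : Dec B) {q} → 0ℚ ≤ᵣ q → (A → ¬ B) →
             mask (does a?) q ⊕ mask (does b?) q ≤ᵣ q
      once (yes a) (yes b) _ ex = contradiction b (ex a)
      once (yes _) (no _) {q} _ _ = ℚₚ.≤-reflexive (ℚₚ.+-identityʳ q)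
      once (no _) (yes _) {q} _ _ = ℚₚ.≤-reflexive (ℚₚ.+-identityˡ q)
      once (no _) (no _) 0≤q _ = 0≤q

  expansion : ∀ z → indicator c z ≡ indicator c₁ z ⊕ ∑ (λ t → indicator (cₜ t) z ⊖ indicator c₁ z)
  expansion z with poly? c₁ z
  ... | no ¬Q = trans (indicator-false (¬Q ∘ proj₁ ∘ from-c))
    (sym (trans (ℚₚ.+-identityˡ (∑ {K} λ t → indicator (cₜ t) z ⊖ 0ℚ))
      (∑-zero {K} λ t → cong (_⊖ 0ℚ) (indicator-false (¬Q ∘ proj₁ ∘ from-cₜ t)))))
  ... | yes Q with Finₚ.any? (λ t → ¬? (S z t ℚₚ.≤? 1ℚ))
  ...   | no all≤ = trans (indicator-true (to-c Q small)) (sym (cong (1ℚ ⊕_)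
    (∑-zero {K} λ t → cong (_⊖ 1ℚ) (indicator-true (to-cₜ Q t (small t))))))
    where
    small : ∀ t → S z t ≤ᵣ 1ℚ
    small t with S z t ℚₚ.≤? 1ℚ
    ... | yes p = p
    ... | no ¬p = contradiction (t , ¬p) all≤
  -- Only the class `s` is violated: its summand is -1 and cancels the leading 1, while all other
  -- summands are 0.
  ...   | yes (s , big) = trans (indicator-false (λ Qc → big (proj₂ (from-c Qc) s))) (sym (cong (1ℚ ⊕_)
    (trans (∑-single {K} s λ t t≢s → cong (_⊖ 1ℚ) (indicator-true
             (to-cₜ Q t (disjoint Q s t (t≢s ∘ sym) (ℚₚ.≰⇒> big)))))
           (cong (_⊖ 1ℚ) (indicator-false (big ∘ proj₂ ∘ from-cₜ s))))))

-- Symmetrization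

sumℚ-++ : ∀ xs ys → sumℚ (xs ++ ys) ≡ sumℚ xs ⊕ sumℚ ys
sumℚ-++ []       ys = sym (ℚₚ.+-identityˡ (sumℚ ys))
sumℚ-++ (x ∷ xs) ys = trans (cong (x ⊕_) (sumℚ-++ xs ys)) (sym (ℚₚ.+-assoc x (sumℚ xs) (sumℚ ys)))

sumOver : ∀ {A : Set} → List A → (A → ℚ) → ℚ
sumOver xs g = sumℚ (map g xs)

module _ {A : Set} where

  sumOver-cong : ∀ {g h : A → ℚ} → (∀ x → g x ≡ h x) → ∀ xs → sumOver xs g ≡ sumOver xs h
  sumOver-cong e xs = cong sumℚ (Listₚ.map-cong e xs)

  sumOver-⊕ : ∀ (g h : A → ℚ) xs → sumOver xs (λ x → g x ⊕ h x) ≡ sumOver xs g ⊕ sumOver xs h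
  sumOver-⊕ g h []       = refl
  sumOver-⊕ g h (x ∷ xs) = trans (cong ((g x ⊕ h x) ⊕_) (sumOver-⊕ g h xs))
    (solve 4 (λ a b c d → (a :+ b) :+ (c :+ d) := (a :+ c) :+ (b :+ d)) refl
      (g x) (h x) (sumOver xs g) (sumOver xs h))
    where open ℚ-Solver

  sumOver-⊖ : ∀ (g h : A → ℚ) xs → sumOver xs (λ x → g x ⊖ h x) ≡ sumOver xs g ⊖ sumOver xs h
  sumOver-⊖ g h []       = refl
  sumOver-⊖ g h (x ∷ xs) = trans (cong ((g x ⊖ h x) ⊕_) (sumOver-⊖ g h xs))
    (solve 4 (λ a b c d → (a :- b) :+ (c :- d) := (a :+ c) :- (b :+ d)) refl
      (g x) (h x) (sumOver xs g) (sumOver xs h))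
    where open ℚ-Solver

  sumOver-∑ : ∀ {n} (h : A → Fin n → ℚ) xs →
              sumOver xs (λ x → ∑ (h x)) ≡ ∑ (λ i → sumOver xs (λ x → h x i))
  sumOver-∑ {n} h []       = sym (∑-zero {n} λ _ → refl)
  sumOver-∑ {n} h (x ∷ xs) = trans (cong (∑ (h x) ⊕_) (sumOver-∑ h xs))
    (sym (∑-distrib-+ (h x) (λ i → sumOver xs (λ x → h x i))))

  sumOver-concatMap : ∀ {B : Set} (g : B → ℚ) (f : A → List B) xs →
                      sumOver (concatMap f xs) g ≡ sumOver xs (λ x → sumOver (f x) g)
  sumOver-concatMap g f []       = refl
  sumOver-concatMap g f (x ∷ xs) = trans (cong sumℚ (Listₚ.map-++ g (f x) (concatMap f xs)))
    (trans (sumℚ-++ (map g (f x)) (map g (concatMap f xs)))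
           (cong (sumOver (f x) g ⊕_) (sumOver-concatMap g f xs)))

  sumOver-ins : ∀ {m} (g : Vec A (suc m) → ℚ) a v →
                sumOver (ins a v) g ≡ ∑ (λ i → g (Vec.insertAt v i a))
  sumOver-ins g a []       = refl
  sumOver-ins g a (b ∷ bs) = cong (g (a ∷ b ∷ bs) ⊕_)
    (trans (cong sumℚ (sym (Listₚ.map-∘ (ins a bs)))) (sumOver-ins (g ∘ (b ∷_)) a bs))

  All-ins : ∀ {m} {P : Vec A (suc m) → Set} a v → (∀ i → P (Vec.insertAt v i a)) → All P (ins a v)
  All-ins a []       p = p Fin.zero ∷ []
  All-ins a (b ∷ bs) p = p Fin.zero ∷ Allₚ.map⁺ (All-ins a bs (p ∘ Fin.suc))

permSum : ∀ n → ((Fin n → Fin n) → ℚ) → ℚ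
permSum n g = sumOver (perms n) (g ∘ lookup)

-- Reindexed permutations agree with the listed ones only pointwise, so a summand has to respect
-- pointwise equality.
Extensional : ∀ {A B : Set} → ((A → B) → ℚ) → Set
Extensional g = ∀ {f f′} → (∀ k → f k ≡ f′ k) → g f ≡ g f′

insertZero : ∀ {n} → Fin (suc n) → (Fin n → Fin n) → Fin (suc n) → Fin (suc n)
insertZero i f = VecF.insertAt (Fin.suc ∘ f) i Fin.zero

lookup-insertAt : ∀ {n} {A : Set} (v : Vec A n) i a k →
                  lookup (Vec.insertAt v i a) k ≡ VecF.insertAt (lookup v) i a k
lookup-insertAt v       Fin.zero    a Fin.zero    = refl
lookup-insertAt v       Fin.zero    a (Fin.suc k) = refl
lookup-insertAt (b ∷ v) (Fin.suc i) a Fin.zero    = refl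
lookup-insertAt (b ∷ v) (Fin.suc i) a (Fin.suc k) = lookup-insertAt v i a k

insertAt-cong : ∀ {n} {A : Set} {f f′ : Fin n → A} i a → (∀ k → f k ≡ f′ k) →
                ∀ k → VecF.insertAt f i a k ≡ VecF.insertAt f′ i a k
insertAt-cong             Fin.zero    a e Fin.zero    = refl
insertAt-cong             Fin.zero    a e (Fin.suc k) = e k
insertAt-cong {n = suc n} (Fin.suc i) a e Fin.zero    = e Fin.zero
insertAt-cong {n = suc n} (Fin.suc i) a e (Fin.suc k) = insertAt-cong i a (e ∘ Fin.suc) k

permSum-suc : ∀ {n} g → Extensional g → permSum (suc n) g ≡ ∑ λ i → permSum n (λ f → g (insertZero i f))
permSum-suc {n} g ext = begin
  sumOver (perms (suc n)) (g ∘ lookup)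
    ≡⟨ sumOver-concatMap (g ∘ lookup) (λ σ → ins Fin.zero (Vec.map Fin.suc σ)) (perms n) ⟩
  sumOver (perms n) (λ σ → sumOver (ins Fin.zero (Vec.map Fin.suc σ)) (g ∘ lookup))
    ≡⟨ sumOver-cong (λ σ → trans (sumOver-ins (g ∘ lookup) Fin.zero (Vec.map Fin.suc σ))
         (∑-cong λ i → ext λ k → trans (lookup-insertAt (Vec.map Fin.suc σ) i Fin.zero k)
           (insertAt-cong i Fin.zero (λ l → Vecₚ.lookup-map l Fin.suc σ) k))) (perms n) ⟩
  sumOver (perms n) (λ σ → ∑ λ i → g (insertZero i (lookup σ)))
    ≡⟨ sumOver-∑ (λ σ i → g (insertZero i (lookup σ))) (perms n) ⟩
  ∑ (λ i → permSum n (λ f → g (insertZero i f))) ∎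
  where open ≡-Reasoning

insertZero-permute : ∀ {n} (π : Permutation′ (suc n)) i f k →
  insertZero i f (π ⟨$⟩ʳ k) ≡ insertZero (π ⟨$⟩ˡ i) (f ∘ (Perm.remove (π ⟨$⟩ˡ i) π ⟨$⟩ʳ_)) k
insertZero-permute π i f k with π ⟨$⟩ˡ i Fin.≟ k
... | yes refl = begin
  insertZero i f (π ⟨$⟩ʳ (π ⟨$⟩ˡ i))      ≡⟨ cong (insertZero i f) (Perm.inverseʳ π) ⟩
  insertZero i f i                          ≡⟨ VecFₚ.insertAt-lookup (Fin.suc ∘ f) i Fin.zero ⟩
  Fin.zero                                  ≡⟨ VecFₚ.insertAt-lookup _ (π ⟨$⟩ˡ i) Fin.zero ⟨
  insertZero (π ⟨$⟩ˡ i) _ (π ⟨$⟩ˡ i)        ∎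
  where open ≡-Reasoning
... | no j≢k = subst (λ k → insertZero i f (π ⟨$⟩ʳ k) ≡ insertZero j f′ k) (Finₚ.punchIn-punchOut j≢k) (begin
  insertZero i f (π ⟨$⟩ʳ punchIn j k′)        ≡⟨ cong (insertZero i f) (Perm.punchIn-permute π j k′) ⟩
  insertZero i f (punchIn (π ⟨$⟩ʳ j) (ρ k′))  ≡⟨ cong (λ l → insertZero i f (punchIn l (ρ k′))) (Perm.inverseʳ π) ⟩
  insertZero i f (punchIn i (ρ k′))           ≡⟨ VecFₚ.insertAt-punchIn (Fin.suc ∘ f) i Fin.zero (ρ k′) ⟩
  Fin.suc (f (ρ k′))                          ≡⟨ VecFₚ.insertAt-punchIn (Fin.suc ∘ f′) j Fin.zero k′ ⟨
  insertZero j f′ (punchIn j k′)              ∎)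
  where
  open ≡-Reasoning
  j  = π ⟨$⟩ˡ i
  k′ = punchOut j≢k
  ρ  = Perm.remove j π ⟨$⟩ʳ_
  f′ = f ∘ ρ

-- Induction on n, grouping the permutations by the position i of 0: composition with π moves it to
-- π⁻¹ i and permutes the remaining entries.
permSum-permute : ∀ {n} (g : (Fin n → Fin n) → ℚ) → Extensional g → (π : Permutation′ n) →
                  permSum n (λ f → g (f ∘ (π ⟨$⟩ʳ_))) ≡ permSum n g
permSum-permute {zero}  g ext π = cong (_⊕ 0ℚ) (ext λ ())
permSum-permute {suc n} g ext π = begin
  permSum (suc n) (λ f → g (f ∘ (π ⟨$⟩ʳ_)))
    ≡⟨ permSum-suc (λ f → g (f ∘ (π ⟨$⟩ʳ_))) (λ e → ext (e ∘ (π ⟨$⟩ʳ_))) ⟩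
  ∑ (λ i → permSum n (λ f → g (insertZero i f ∘ (π ⟨$⟩ʳ_))))
    ≡⟨ ∑-cong (λ i → sumOver-cong (λ σ → ext (insertZero-permute π i (lookup σ))) (perms n)) ⟩
  ∑ (λ i → permSum n (λ f → g (insertZero (π ⟨$⟩ˡ i) (f ∘ (Perm.remove (π ⟨$⟩ˡ i) π ⟨$⟩ʳ_)))))
    ≡⟨ ∑-cong (λ i → permSum-permute (λ f → g (insertZero (π ⟨$⟩ˡ i) f))
         (λ e → ext (insertAt-cong (π ⟨$⟩ˡ i) Fin.zero (cong Fin.suc ∘ e))) (Perm.remove (π ⟨$⟩ˡ i) π)) ⟩
  ∑ (λ i → permSum n (λ f → g (insertZero (π ⟨$⟩ˡ i) f)))
    ≡⟨ ∑-permute (λ i → permSum n (λ f → g (insertZero i f))) (Perm.flip π) ⟨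
  ∑ (λ i → permSum n (λ f → g (insertZero i f)))
    ≡⟨ permSum-suc g ext ⟨
  permSum (suc n) g ∎
  where open ≡-Reasoning

-- Invariance of sums is the form in which the bijectivity of a listed `σ` enters the evaluation of
-- the test points.
perms-∑ℕ : ∀ n → All (λ σ → ∀ (f : Fin n → ℕ) → ∑ℕ (f ∘ lookup σ) ≡ ∑ℕ f) (perms n)
perms-∑ℕ zero    = (λ f → refl) ∷ []
perms-∑ℕ (suc n) = Allₚ.concat⁺ (Allₚ.map⁺ (All.map
  (λ {σ} ih → All-ins Fin.zero (Vec.map Fin.suc σ) λ i f → trans (insert-sum f (Vec.map Fin.suc σ) i)
    (cong (f Fin.zero +_) (trans (∑ℕ-cong λ k → cong f (Vecₚ.lookup-map k Fin.suc σ)) (ih (f ∘ Fin.suc)))))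
  (perms-∑ℕ n)))
  where
  insert-sum : ∀ {m} {A : Set} {a} (f : A → ℕ) (v : Vec A m) i →
               ∑ℕ (f ∘ lookup (Vec.insertAt v i a)) ≡ f a + ∑ℕ (f ∘ lookup v)
  insert-sum         f v       Fin.zero    = refl
  insert-sum {a = a} f (b ∷ v) (Fin.suc i) = trans (cong (f b +_) (insert-sum f v i))
    (solve 3 (λ x y s → x :+ (y :+ s) := y :+ (x :+ s)) refl (f b) (f a) (∑ℕ (f ∘ lookup v)))
    where open ℕ-Solver

-- The identity is the one term evaluated exactly at the test points; it makes inequalities between
-- symmetrized sums strict.
perms-id : ∀ n → ∃ λ σ → σ ∈ᴸ perms n × (∀ k → lookup σ k ≡ k)
perms-id zero    = [] , here refl , λ ()
perms-id (suc n) with perms-id n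
... | σ , σ∈ , σ≡ = Fin.zero ∷ Vec.map Fin.suc σ ,
  ∈ᴸ.∈-concat⁺′ (first (Vec.map Fin.suc σ)) (∈ᴸ.∈-map⁺ (λ σ → ins Fin.zero (Vec.map Fin.suc σ)) σ∈) ,
  λ { Fin.zero → refl ; (Fin.suc k) → trans (Vecₚ.lookup-map k Fin.suc σ) (cong Fin.suc (σ≡ k)) }
  where
  first : ∀ {m} {A : Set} {a : A} (v : Vec A m) → (a ∷ v) ∈ᴸ ins a v
  first []      = here refl
  first (_ ∷ _) = here refl

symInd : ∀ {n} → Colouring n → Point n → ℚ
symInd {n} c x = permSum n (λ f → indicator c (x ∘ f))

symInd-indep : ∀ {n} {c c′ : Colouring n} → (∀ i j → Indep c i j → Indep c′ i j) →
               (∀ i j → Indep c′ i j → Indep c i j) → ∀ x → symInd c x ≡ symInd c′ x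
symInd-indep {n} to from x = sumOver-cong (λ σ → indicator-indep to from (x ∘ lookup σ)) (perms n)

symInd-cong : ∀ {n} {c c′ : Colouring n} → (∀ i → c i ≡ c′ i) → ∀ x → symInd c x ≡ symInd c′ x
symInd-cong e = symInd-indep (λ i j → transport e i j) (λ i j → transport (sym ∘ e) i j)
  where
  transport : ∀ {n} {c c′ : Colouring n} → (∀ i → c i ≡ c′ i) → ∀ i j → Indep c i j → Indep c′ i j
  transport e i j ind rewrite e i | e j = ind

-- Relabelling colouring and point together changes nothing, and a relabelling of the point alone is
-- absorbed by the sum over all permutations.
symInd-permute : ∀ {n} (c : Colouring n) (π : Permutation′ n) x → symInd (c ∘ (π ⟨$⟩ʳ_)) x ≡ symInd c x
symInd-permute {n} c π x = trans
  (sym (permSum-permute (λ f → indicator (c ∘ (π ⟨$⟩ʳ_)) (x ∘ f))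
    (λ e → indicator-cong (poly-cong (cong x ∘ e)) (poly-cong (sym ∘ cong x ∘ e))) π))
  (sumOver-cong (λ σ → indicator-cong back (poly-permute π)) (perms n))
  where
  back : ∀ {z} → Poly (c ∘ (π ⟨$⟩ʳ_)) (z ∘ (π ⟨$⟩ʳ_)) → Poly c z
  back {z} Q = hull⇒poly (hull-cong (λ k → cong z (Perm.inverseʳ π))
    (hull-map (π ⟨$⟩ˡ_) (vert-permute π) (poly⇒hull Q)))

-- Colour counts determine the symmetrized indicator

hit : ∀ {A : Set} → Dec A → ℕ
hit a? = if does a? then 1 else 0

count : ∀ {n} → Colouring n → ℕ → ℕ
count c v = ∑ℕ λ k → hit (c k ℕ.≟ v)

count-attained : ∀ {n} (c : Colouring n) v → 0 < count c v → ∃ λ k → c k ≡ v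
count-attained {suc n} c v p with c Fin.zero ℕ.≟ v
... | yes e = Fin.zero , e
... | no ne with count-attained (c ∘ Fin.suc) v (subst (λ b → 0 < (if b then 1 else 0) + count (c ∘ Fin.suc) v) (dec-false (c Fin.zero ℕ.≟ v) ne) p)
...   | k , e = Fin.suc k , e

-- Greedy matching: the colour of the first element occurs in `c′` since the counts agree; match the
-- two, remove them and recurse.
counts⇒permutation : ∀ {n} (c c′ : Colouring n) → (∀ v → count c v ≡ count c′ v) →
                     ∃ λ (π : Permutation′ n) → ∀ i → c i ≡ c′ (π ⟨$⟩ʳ i)
counts⇒permutation {zero}  c c′ same = Perm.id , λ ()
counts⇒permutation {suc n} c c′ same with count-attained c′ (c Fin.zero) (subst (0 <_) (same (c Fin.zero))
  (subst (λ b → 0 < (if b then 1 else 0) + count (c ∘ Fin.suc) (c Fin.zero)) (sym (dec-true (c Fin.zero ℕ.≟ c Fin.zero) refl)) (s≤s z≤n)))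
... | j , c′j≡ with counts⇒permutation (c ∘ Fin.suc) (c′ ∘ punchIn j) (λ v → ℕₚ.+-cancelˡ-≡ (hit (c Fin.zero ℕ.≟ v)) _ _
      (trans (same v) (trans (∑ℕ-remove {i = j} (λ k → hit (c′ k ℕ.≟ v)))
        (cong (λ u → hit (u ℕ.≟ v) + count (c′ ∘ punchIn j) v) c′j≡))))
...   | π , e = Perm.insert Fin.zero j π , λ
  { Fin.zero → sym c′j≡
  ; (Fin.suc i) → trans (e i) (cong c′ (sym (Perm.insert-punchIn Fin.zero j π i))) }

symInd-counts : ∀ {n} (c c′ : Colouring n) → (∀ v → count c v ≡ count c′ v) → ∀ x → symInd c x ≡ symInd c′ x
symInd-counts c c′ same x with counts⇒permutation c c′ same
... | π , e = trans (symInd-cong e x) (symInd-permute c′ π x)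

-- Schubert matroids

-- block (a - 1) (b - 1) is the Schubert matroid S(a, b).
block : ∀ {n} → ℕ → ℕ → Colouring n
block ℓ e k = if does (toℕ k ℕ.<? ℓ) then 0 else if does (toℕ k ℕ.<? e) then 2 else 1

data BlockView {n} (ℓ e : ℕ) (k : Fin n) : ℕ → Set where
  loop    : toℕ k < ℓ → BlockView ℓ e k 0
  inClass : ℓ ≤ toℕ k → toℕ k < e → BlockView ℓ e k 2
  single  : ℓ ≤ toℕ k → e ≤ toℕ k → BlockView ℓ e k 1

blockView : ∀ {n} ℓ e (k : Fin n) → BlockView ℓ e k (block ℓ e k)
blockView ℓ e k with toℕ k ℕ.<? ℓ
... | yes k<ℓ = subst (BlockView ℓ e k) (cong (λ b → if b then 0 else if does (toℕ k ℕ.<? e) then 2 else 1)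
  (sym (dec-true (toℕ k ℕ.<? ℓ) k<ℓ))) (loop k<ℓ)
... | no k≮ℓ = subst (BlockView ℓ e k) (cong (λ b → if b then 0 else if does (toℕ k ℕ.<? e) then 2 else 1)
  (sym (dec-false (toℕ k ℕ.<? ℓ) k≮ℓ))) inner
  where
  inner : BlockView ℓ e k (if does (toℕ k ℕ.<? e) then 2 else 1)
  inner with toℕ k ℕ.<? e
  ... | yes k<e = subst (BlockView ℓ e k) (cong (λ b → if b then 2 else 1) (sym (dec-true (toℕ k ℕ.<? e) k<e)))
    (inClass (ℕₚ.≮⇒≥ k≮ℓ) k<e)
  ... | no k≮e = subst (BlockView ℓ e k) (cong (λ b → if b then 2 else 1) (sym (dec-false (toℕ k ℕ.<? e) k≮e)))
    (single (ℕₚ.≮⇒≥ k≮ℓ) (ℕₚ.≮⇒≥ k≮e))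

block-≤2 : ∀ {n} ℓ e (k : Fin n) → block ℓ e k ≤ 2
block-≤2 ℓ e k with block ℓ e k | blockView ℓ e k
... | _ | loop _     = z≤n
... | _ | inClass _ _  = ℕₚ.≤-refl
... | _ | single _ _ = s≤s z≤n

pairInd-comm : ∀ {n} (i j k : Fin n) → pairInd i j k ≡ pairInd j i k
pairInd-comm i j k with k Fin.≟ i | k Fin.≟ j
... | yes _ | yes _ = refl
... | yes _ | no _  = refl
... | no _  | yes _ = refl
... | no _  | no _  = refl

pred≤ : ∀ {a m} → a ≤ suc m → a ∸ 1 ≤ m
pred≤ {zero}  _       = z≤n
pred≤ {suc a} (s≤s h) = h

pred≤⁻¹ : ∀ {a m} → a ∸ 1 ≤ m → a ≤ suc m
pred≤⁻¹ {zero}  _ = z≤n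
pred≤⁻¹ {suc a} h = s≤s h

-- The class of a `block` is an initial segment of its nonloops, so a pair is not contained in it
-- exactly when the larger element lies beyond it, which is the condition on b₂.
schub⇒vert : ∀ n a b {y} → SchubVert n a b y → Vert (block (a ∸ 1) (b ∸ 1)) y
schub⇒vert n a b {y} (i , j , i<j , a≤i , b≤j , y≡) = i , j , ind , y≡
  where
  ind : Indep (block (a ∸ 1) (b ∸ 1)) i j
  ind with block (a ∸ 1) (b ∸ 1) i | blockView (a ∸ 1) (b ∸ 1) i
         | block (a ∸ 1) (b ∸ 1) j | blockView (a ∸ 1) (b ∸ 1) j
  ... | _ | loop i< | _ | _ = contradiction (pred≤ a≤i) (ℕₚ.<⇒≱ i<)
  ... | _ | _ | _ | loop j< = contradiction (ℕₚ.≤-trans (pred≤ a≤i) (ℕₚ.<⇒≤ i<j)) (ℕₚ.<⇒≱ j<)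
  ... | _ | _ | _ | inClass _ j< = contradiction (pred≤ b≤j) (ℕₚ.<⇒≱ j<)
  ... | _ | inClass _ _ | _ | single _ _ =
    (λ { refl → ℕₚ.<-irrefl refl i<j }) , (λ ()) , (λ ()) , λ ()
  ... | _ | single _ _ | _ | single _ _ =
    (λ { refl → ℕₚ.<-irrefl refl i<j }) , (λ ()) , (λ ()) , λ _ → refl

indep-bounds : ∀ {n} a b {i j : Fin n} → Indep (block (a ∸ 1) (b ∸ 1)) i j → toℕ i < toℕ j →
               a ≤ suc (toℕ i) × b ≤ suc (toℕ j)
indep-bounds a b {i} {j} (_ , ci , cj , sep) i<j
  with block (a ∸ 1) (b ∸ 1) i | blockView (a ∸ 1) (b ∸ 1) i
     | block (a ∸ 1) (b ∸ 1) j | blockView (a ∸ 1) (b ∸ 1) j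
... | _ | loop _ | _ | _ = contradiction refl ci
... | _ | _ | _ | loop _ = contradiction refl cj
... | _ | inClass ≤i _ | _ | single _ ≤j = pred≤⁻¹ ≤i , pred≤⁻¹ ≤j
... | _ | single ≤i ≤i′ | _ | _ = pred≤⁻¹ ≤i , pred≤⁻¹ (ℕₚ.≤-trans ≤i′ (ℕₚ.<⇒≤ i<j))
... | _ | inClass _ _ | _ | inClass _ _ = contradiction (sep refl) λ ()

vert⇒schub : ∀ n a b {y} → Vert (block (a ∸ 1) (b ∸ 1)) y → SchubVert n a b y
vert⇒schub n a b (i , j , ind@(i≢j , ci , cj , sep) , y≡) with ℕₚ.<-cmp (toℕ i) (toℕ j)
... | tri< i<j _ _ = let a≤ , b≤ = indep-bounds a b ind i<j in i , j , i<j , a≤ , b≤ , y≡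
... | tri≈ _ e _ = contradiction (Finₚ.toℕ-injective e) i≢j
... | tri> _ _ j<i =
  let a≤ , b≤ = indep-bounds a b (i≢j ∘ sym , cj , ci , λ e → trans e (sep (sym e))) j<i in
  j , i , j<i , a≤ , b≤ , λ k → trans (y≡ k) (pairInd-comm i j k)

∑ℕ-mono : ∀ {n} {f g : Fin n → ℕ} → (∀ i → f i ≤ g i) → ∑ℕ f ≤ ∑ℕ g
∑ℕ-mono {zero}  h = z≤n
∑ℕ-mono {suc n} h = ℕₚ.+-mono-≤ (h Fin.zero) (∑ℕ-mono (h ∘ Fin.suc))

∑ℕ-ones : ∀ n → ∑ℕ {n} (λ _ → 1) ≡ n
∑ℕ-ones zero    = refl
∑ℕ-ones (suc n) = cong suc (∑ℕ-ones n)

∑ℕ-zero : ∀ {n} {f : Fin n → ℕ} → (∀ i → f i ≡ 0) → ∑ℕ f ≡ 0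
∑ℕ-zero {zero}  h = refl
∑ℕ-zero {suc n} h = cong₂ _+_ (h Fin.zero) (∑ℕ-zero (h ∘ Fin.suc))

hit-true : ∀ {A : Set} (a? : Dec A) → A → hit a? ≡ 1
hit-true a? a = cong (λ b → if b then 1 else 0) (dec-true a? a)

hit-false : ∀ {A : Set} (a? : Dec A) → ¬ A → hit a? ≡ 0
hit-false a? ¬a = cong (λ b → if b then 1 else 0) (dec-false a? ¬a)

hit-+-≤1 : ∀ {A B : Set} (a? : Dec A) (b? : Dec B) → (A → ¬ B) → hit a? + hit b? ≤ 1
hit-+-≤1 (yes a) (yes b) ex = contradiction b (ex a)
hit-+-≤1 (yes _) (no _)  _  = ℕₚ.≤-refl
hit-+-≤1 (no _)  (yes _) _  = ℕₚ.≤-refl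
hit-+-≤1 (no _)  (no _)  _  = z≤n

count-+-≤ : ∀ {n} (c : Colouring n) {u v} → u ≢ v → count c u + count c v ≤ n
count-+-≤ {n} c {u} {v} u≢v = subst₂ _≤_
  (∑ℕ-distrib-+ (λ k → hit (c k ℕ.≟ u)) (λ k → hit (c k ℕ.≟ v))) (∑ℕ-ones n)
  (∑ℕ-mono λ k → hit-+-≤1 (c k ℕ.≟ u) (c k ℕ.≟ v) λ p q → u≢v (trans (sym p) q))

count-kinds : ∀ {n} (c : Colouring n) → (∀ k → c k ≤ 2) → count c 0 + count c 1 + count c 2 ≡ n
count-kinds {n} c c≤2 = begin
  count c 0 + count c 1 + count c 2
    ≡⟨ cong (_+ count c 2) (∑ℕ-distrib-+ (λ k → hit (c k ℕ.≟ 0)) (λ k → hit (c k ℕ.≟ 1))) ⟨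
  ∑ℕ (λ k → hit (c k ℕ.≟ 0) + hit (c k ℕ.≟ 1)) + count c 2
    ≡⟨ ∑ℕ-distrib-+ (λ k → hit (c k ℕ.≟ 0) + hit (c k ℕ.≟ 1)) (λ k → hit (c k ℕ.≟ 2)) ⟨
  ∑ℕ (λ k → hit (c k ℕ.≟ 0) + hit (c k ℕ.≟ 1) + hit (c k ℕ.≟ 2))
    ≡⟨ ∑ℕ-cong (λ k → one (c≤2 k)) ⟩
  ∑ℕ {n} (λ _ → 1)
    ≡⟨ ∑ℕ-ones n ⟩
  n ∎
  where
  open ≡-Reasoning
  one : ∀ {v} → v ≤ 2 → hit (v ℕ.≟ 0) + hit (v ℕ.≟ 1) + hit (v ℕ.≟ 2) ≡ 1
  one z≤n             = refl
  one (s≤s z≤n)       = refl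
  one (s≤s (s≤s z≤n)) = refl

-- The three counts add up to `n`, which settles colour 1.
same-kinds : ∀ {n} (c c′ : Colouring n) → (∀ k → c k ≤ 2) → (∀ k → c′ k ≤ 2) →
             count c 0 ≡ count c′ 0 → count c 2 ≡ count c′ 2 → ∀ v → count c v ≡ count c′ v
same-kinds c c′ c≤ c′≤ e₀ e₂ 0 = e₀
same-kinds c c′ c≤ c′≤ e₀ e₂ 1 = ℕₚ.+-cancelˡ-≡ (count c 0) _ _ (ℕₚ.+-cancelʳ-≡ (count c 2) _ _
  (trans (count-kinds c c≤) (trans (sym (count-kinds c′ c′≤))
    (cong₂ (λ a b → a + count c′ 1 + b) (sym e₀) (sym e₂)))))
same-kinds c c′ c≤ c′≤ e₀ e₂ 2 = e₂
same-kinds c c′ c≤ c′≤ e₀ e₂ (suc (suc (suc v))) = trans (absent c c≤) (sym (absent c′ c′≤))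
  where
  absent : ∀ c → (∀ k → c k ≤ 2) → count c (3 + v) ≡ 0
  absent c c≤ = ∑ℕ-zero λ k → hit-false (c k ℕ.≟ 3 + v) λ e →
    contradiction (subst (_≤ 2) e (c≤ k)) λ { (s≤s (s≤s ())) }

count-block-0 : ∀ n ℓ p → ℓ ≤ n → count {n} (block ℓ (ℓ + p)) 0 ≡ ℓ
count-block-0 zero    zero    p       _       = refl
count-block-0 (suc n) zero    zero    _       = count-block-0 n zero zero z≤n
count-block-0 (suc n) zero    (suc p) _       = count-block-0 n zero p z≤n
count-block-0 (suc n) (suc ℓ) p       (s≤s h) = cong suc (count-block-0 n ℓ p h)

count-block-2 : ∀ n ℓ p → ℓ + p ≤ n → count {n} (block ℓ (ℓ + p)) 2 ≡ p
count-block-2 zero    zero    zero    _       = refl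
count-block-2 (suc n) zero    zero    _       = count-block-2 n zero zero z≤n
count-block-2 (suc n) zero    (suc p) (s≤s h) = cong suc (count-block-2 n zero p h)
count-block-2 (suc n) (suc ℓ) p       (s≤s h) = count-block-2 n ℓ p h

symInd-block : ∀ {n} (c : Colouring n) ℓ p → (∀ k → c k ≤ 2) → count c 0 ≡ ℓ → count c 2 ≡ p → ℓ + p ≤ n →
               ∀ x → symInd c x ≡ symInd (block ℓ (ℓ + p)) x
symInd-block {n} c ℓ p c≤ e₀ e₂ h = symInd-counts c (block ℓ (ℓ + p))
  (same-kinds c (block ℓ (ℓ + p)) c≤ (block-≤2 ℓ (ℓ + p))
    (trans e₀ (sym (count-block-0 n ℓ p (ℕₚ.≤-trans (ℕₚ.m≤m+n ℓ p) h))))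
    (trans e₂ (sym (count-block-2 n ℓ p h))))

-- A one-element class contains no pair and excludes nothing. The size 0 would be S(ℓ + 1, ℓ + 1),
-- which is absent from `sigma`, so S(ℓ + 1, ℓ + 2) takes its place.
symInd-uniform : ∀ {n} ℓ x → symInd {n} (block ℓ (ℓ + 0)) x ≡ symInd (block ℓ (ℓ + 1)) x
symInd-uniform {n} ℓ = symInd-indep to from
  where
  to : ∀ (i j : Fin n) → Indep (block ℓ (ℓ + 0)) i j → Indep (block ℓ (ℓ + 1)) i j
  to i j (i≢j , ci , cj , sep) with block ℓ (ℓ + 0) i | blockView ℓ (ℓ + 0) i | block ℓ (ℓ + 0) j | blockView ℓ (ℓ + 0) j
                            | block ℓ (ℓ + 1) i | blockView ℓ (ℓ + 1) i | block ℓ (ℓ + 1) j | blockView ℓ (ℓ + 1) j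
  ... | _ | loop _ | _ | _ | _ | _ | _ | _ = contradiction refl ci
  ... | _ | _ | _ | loop _ | _ | _ | _ | _ = contradiction refl cj
  ... | _ | inClass _ _ | _ | inClass _ _ | _ | _ | _ | _ = contradiction (sep refl) λ ()
  ... | _ | inClass p _ | _ | single _ _ | _ | loop q | _ | _ = contradiction p (ℕₚ.<⇒≱ q)
  ... | _ | single p _ | _ | _ | _ | loop q | _ | _ = contradiction p (ℕₚ.<⇒≱ q)
  ... | _ | _ | _ | inClass p _ | _ | _ | _ | loop q = contradiction p (ℕₚ.<⇒≱ q)
  ... | _ | _ | _ | single p _ | _ | _ | _ | loop q = contradiction p (ℕₚ.<⇒≱ q)
  ... | _ | _ | _ | _ | _ | single _ _ | _ | single _ _ = i≢j , (λ ()) , (λ ()) , λ _ → refl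
  ... | _ | _ | _ | _ | _ | single _ _ | _ | inClass _ _  = i≢j , (λ ()) , (λ ()) , λ ()
  ... | _ | _ | _ | _ | _ | inClass _ _  | _ | single _ _ = i≢j , (λ ()) , (λ ()) , λ ()
  ... | _ | _ | _ | _ | _ | inClass ℓ≤i i< | _ | inClass ℓ≤j j< = contradiction (Finₚ.toℕ-injective
    (trans (pin ℓ≤i i<) (sym (pin ℓ≤j j<)))) i≢j
    where
    pin : ∀ {m} → ℓ ≤ m → m < ℓ + 1 → m ≡ ℓ
    pin {m} p q = ℕₚ.≤-antisym (ℕₚ.≤-pred (subst (m <_) (ℕₚ.+-comm ℓ 1) q)) p
  from : ∀ (i j : Fin n) → Indep (block ℓ (ℓ + 1)) i j → Indep (block ℓ (ℓ + 0)) i j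
  from i j (i≢j , ci , cj , sep) with block ℓ (ℓ + 1) i | blockView ℓ (ℓ + 1) i | block ℓ (ℓ + 1) j | blockView ℓ (ℓ + 1) j
                            | block ℓ (ℓ + 0) i | blockView ℓ (ℓ + 0) i | block ℓ (ℓ + 0) j | blockView ℓ (ℓ + 0) j
  ... | _ | loop _ | _ | _ | _ | _ | _ | _ = contradiction refl ci
  ... | _ | _ | _ | loop _ | _ | _ | _ | _ = contradiction refl cj
  ... | _ | inClass p _ | _ | _ | _ | loop q | _ | _ = contradiction p (ℕₚ.<⇒≱ q)
  ... | _ | single p _ | _ | _ | _ | loop q | _ | _ = contradiction p (ℕₚ.<⇒≱ q)
  ... | _ | _ | _ | inClass p _ | _ | _ | _ | loop q = contradiction p (ℕₚ.<⇒≱ q)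
  ... | _ | _ | _ | single p _ | _ | _ | _ | loop q = contradiction p (ℕₚ.<⇒≱ q)
  ... | _ | _ | _ | _ | _ | single _ _ | _ | single _ _ = i≢j , (λ ()) , (λ ()) , λ _ → refl
  ... | _ | _ | _ | _ | _ | inClass p q | _ | _  = contradiction p (ℕₚ.<⇒≱ (subst (_ <_) (ℕₚ.+-identityʳ ℓ) q))
  ... | _ | _ | _ | _ | _ | _ | _ | inClass p q  = contradiction p (ℕₚ.<⇒≱ (subst (_ <_) (ℕₚ.+-identityʳ ℓ) q))

module _ {n} (c : Colouring n) (K : ℕ) (bounded : ∀ i → c i < 2 + K) (ℓ<n : count c 0 < n) (x : Point n) where

  open Expansion c K bounded using (c₁; cₜ; expansion)

  private
    ℓ : ℕ
    ℓ = count c 0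
    -- The index is the class size minus 1: `G q` belongs to S(ℓ + 1, ℓ + 2 + q), and `G 0` is the
    -- value of Δ.
    G : ℕ → ℚ
    G q = symInd {n} (block ℓ (ℓ + suc q)) x

  symInd-expand : symInd c x ≡ symInd c₁ x ⊕ ∑ (λ t → symInd (cₜ t) x ⊖ symInd c₁ x)
  symInd-expand = begin
    symInd c x
      ≡⟨ sumOver-cong (λ σ → expansion (x ∘ lookup σ)) (perms n) ⟩
    sumOver (perms n) (λ σ → i₁ σ ⊕ ∑ (λ t → iₜ t σ ⊖ i₁ σ))
      ≡⟨ sumOver-⊕ i₁ (λ σ → ∑ (λ t → iₜ t σ ⊖ i₁ σ)) (perms n) ⟩
    symInd c₁ x ⊕ sumOver (perms n) (λ σ → ∑ (λ t → iₜ t σ ⊖ i₁ σ))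
      ≡⟨ cong (symInd c₁ x ⊕_) (trans (sumOver-∑ (λ σ t → iₜ t σ ⊖ i₁ σ) (perms n))
           (∑-cong λ t → sumOver-⊖ (iₜ t) i₁ (perms n))) ⟩
    symInd c₁ x ⊕ ∑ (λ t → symInd (cₜ t) x ⊖ symInd c₁ x) ∎
    where
    open ≡-Reasoning
    i₁ : Vec (Fin n) n → ℚ
    i₁ σ = indicator c₁ (x ∘ lookup σ)
    iₜ : Fin K → Vec (Fin n) n → ℚ
    iₜ t σ = indicator (cₜ t) (x ∘ lookup σ)

  symInd-free : symInd c₁ x ≡ G 0
  symInd-free = trans (symInd-block c₁ ℓ 0 (λ k → ℕₚ.≤-trans (Expansion.free-≤1 c K bounded (c k)) (s≤s z≤n))
      (∑ℕ-cong λ k → free-zero (c k)) (∑ℕ-zero λ k → free-two (c k))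
      (subst (_≤ n) (sym (ℕₚ.+-identityʳ ℓ)) (ℕₚ.<⇒≤ ℓ<n)) x)
    (symInd-uniform ℓ x)
    where
    free-zero : ∀ v → hit (freeColour v ℕ.≟ 0) ≡ hit (v ℕ.≟ 0)
    free-zero zero    = refl
    free-zero (suc v) = refl
    free-two : ∀ v → hit (freeColour v ℕ.≟ 2) ≡ 0
    free-two zero    = refl
    free-two (suc v) = refl

  symInd-only : ∀ t → symInd (cₜ t) x ≡ G (count c (2 + toℕ t) ∸ 1)
  symInd-only t = trans
    (symInd-block (cₜ t) ℓ p (λ k → only-≤2 (2 + toℕ t) (c k))
      (∑ℕ-cong λ k → only-zero (2 + toℕ t) (c k))
      (∑ℕ-cong λ k → cong (λ b → if b then 1 else 0) (Expansion.only-class c K bounded (toℕ t) (c k)))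
      (count-+-≤ c λ ()) x)
    (shape p)
    where
    p : ℕ
    p = count c (2 + toℕ t)
    shape : ∀ p → symInd {n} (block ℓ (ℓ + p)) x ≡ G (p ∸ 1)
    shape zero    = symInd-uniform ℓ x
    shape (suc p) = refl
    only-≤2 : ∀ t v → onlyColour t v ≤ 2
    only-≤2 t zero = z≤n
    only-≤2 t (suc v) with does (suc v ℕ.≟ t)
    ... | true  = ℕₚ.≤-refl
    ... | false = s≤s z≤n
    only-zero : ∀ t v → hit (onlyColour t v ℕ.≟ 0) ≡ hit (v ℕ.≟ 0)
    only-zero t zero = refl
    only-zero t (suc v) with does (suc v ℕ.≟ t)
    ... | true  = refl
    ... | false = refl

  -- Classes of size 0 and 1 impose no condition, hence the truncated count ∸ 1.
  symInd-expansion : symInd c x ≡ G 0 ⊕ ∑ (λ (t : Fin K) → G (count c (2 + toℕ t) ∸ 1) ⊖ G 0)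
  symInd-expansion = trans symInd-expand
    (cong₂ _⊕_ symInd-free (∑-cong λ t → cong₂ _⊖_ (symInd-only t) symInd-free))

-- The columns of the matrix

ℕtoℚ-+ : ∀ a b → ℕtoℚ (a + b) ≡ ℕtoℚ a ⊕ ℕtoℚ b
ℕtoℚ-+ a b = ℚₚ.toℚᵘ-injective (begin
  ℚ.toℚᵘ (ℕtoℚ (a + b))                      ≈⟨ ℚₚ.toℚᵘ-fromℚᵘ (mkℚᵘ (ℤ.+ (a + b)) 0) ⟩
  mkℚᵘ (ℤ.+ (a + b)) 0                        ≈⟨ ℚᵘ.*≡* (cong (ℤ._* ℤ.1ℤ) (sym (cong₂ ℤ._+_ (ℤₚ.*-identityʳ (ℤ.+ a)) (ℤₚ.*-identityʳ (ℤ.+ b))))) ⟩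
  mkℚᵘ (ℤ.+ a) 0 ℚᵘ.+ mkℚᵘ (ℤ.+ b) 0          ≈⟨ ℚᵘₚ.+-cong (ℚₚ.toℚᵘ-fromℚᵘ (mkℚᵘ (ℤ.+ a) 0)) (ℚₚ.toℚᵘ-fromℚᵘ (mkℚᵘ (ℤ.+ b) 0)) ⟨
  ℚ.toℚᵘ (ℕtoℚ a) ℚᵘ.+ ℚ.toℚᵘ (ℕtoℚ b)        ≈⟨ ℚₚ.toℚᵘ-homo-+ (ℕtoℚ a) (ℕtoℚ b) ⟨
  ℚ.toℚᵘ (ℕtoℚ a ⊕ ℕtoℚ b)                    ∎)
  where open ℚᵘₚ.≃-Reasoning

-- Entry `i` counts classes of size `suc r ∸ toℕ i`, from r + 1 down to 2, so this is the number of
-- elements in classes of size at least 2. For r = n - 2 it is the row vector that defines 𝒰(n).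
weight : ∀ r → Vec ℕ r → ℕ
weight r u = Vec.sum (Vec.zipWith _*_ (Vec.tabulate (λ i → suc r ∸ toℕ i)) u)

-- The last block of a column: u stacked over 1 - (s + 1ᵀu).
tailColumn : ∀ {r} → ℕ → Vec ℕ r → Point (suc r)
tailColumn s []       Fin.zero    = 1ℚ ⊖ ℕtoℚ s
tailColumn s (u ∷ us) Fin.zero    = ℕtoℚ u
tailColumn s (u ∷ us) (Fin.suc i) = tailColumn (s + u) us i

tailColumn-init : ∀ {r} s (u : Vec ℕ r) i → tailColumn s u (inject₁ i) ≡ ℕtoℚ (lookup u i)
tailColumn-init s (u ∷ us) Fin.zero    = refl
tailColumn-init s (u ∷ us) (Fin.suc i) = tailColumn-init (s + u) us i

tailColumn-last : ∀ {r} s (u : Vec ℕ r) → tailColumn s u (fromℕ r) ≡ 1ℚ ⊖ ℕtoℚ (s + Vec.sum u)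
tailColumn-last s []       = cong (λ t → 1ℚ ⊖ ℕtoℚ t) (sym (ℕₚ.+-identityʳ s))
tailColumn-last s (u ∷ us) = trans (tailColumn-last (s + u) us)
  (cong (λ t → 1ℚ ⊖ ℕtoℚ t) (ℕₚ.+-assoc s u (Vec.sum us)))

tailColumn-unique : ∀ {r} {z : Point (suc r)} s (u : Vec ℕ r) → (∀ i → z (inject₁ i) ≡ ℕtoℚ (lookup u i)) →
                    z (fromℕ r) ≡ 1ℚ ⊖ ℕtoℚ (s + Vec.sum u) → ∀ i → z i ≡ tailColumn s u i
tailColumn-unique s []       h l Fin.zero    = trans l (cong (λ t → 1ℚ ⊖ ℕtoℚ t) (ℕₚ.+-identityʳ s))
tailColumn-unique s (u ∷ us) h l Fin.zero    = h Fin.zero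
tailColumn-unique s (u ∷ us) h l (Fin.suc i) = tailColumn-unique (s + u) us (h ∘ Fin.suc)
  (trans l (cong (λ t → 1ℚ ⊖ ℕtoℚ t) (sym (ℕₚ.+-assoc s u (Vec.sum us))))) i

-- There are `2 + r` nonloops. Equality in the bound is the condition of 𝒰; strict inequality leaves
-- the identity block and the columns inherited from smaller 𝒱.
IsTail : ∀ r → Point (suc r) → Set
IsTail r z = ∃ λ u → weight r u ≤ 2 + r × (∀ i → z i ≡ tailColumn 0 u i)

weight-zeros : ∀ r → weight r (Vec.replicate r 0) ≡ 0
weight-zeros zero    = refl
weight-zeros (suc r) = cong₂ _+_ (ℕₚ.*-zeroʳ (2 + r)) (weight-zeros r)

tailColumn-zeros : ∀ r i → tailColumn 1 (Vec.replicate r 0) i ≡ 0ℚ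
tailColumn-zeros zero    Fin.zero    = refl
tailColumn-zeros (suc r) Fin.zero    = refl
tailColumn-zeros (suc r) (Fin.suc i) = tailColumn-zeros r i

weight-0 : ∀ {r} (u : Vec ℕ r) → weight r u ≡ 0 → u ≡ Vec.replicate r 0
weight-0 []                   _ = refl
weight-0 {suc r} (zero ∷ us)  e = cong (0 ∷_) (weight-0 us
  (trans (sym (cong (_+ weight r us) (ℕₚ.*-zeroʳ (2 + r)))) e))

unit-suc : ∀ {n} (i k : Fin n) → unit (Fin.suc i) (Fin.suc k) ≡ unit i k
unit-suc = unit-injective Fin.suc Finₚ.suc-injective

head-zero : ∀ {r b} (us : Vec ℕ r) → weight (suc r) (0 ∷ us) ≤ b → weight r us ≤ b
head-zero {r} {b} us = subst (_≤ b) (cong (_+ weight r us) (ℕₚ.*-zeroʳ (2 + r)))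

head-zero⁻¹ : ∀ {r b} (us : Vec ℕ r) → weight r us ≤ b → weight (suc r) (0 ∷ us) ≤ b
head-zero⁻¹ {r} {b} us = subst (_≤ b) (sym (cong (_+ weight r us) (ℕₚ.*-zeroʳ (2 + r))))

cons-zero : ∀ {r} {z : Point (2 + r)} → z Fin.zero ≡ 0ℚ → IsTail r (z ∘ Fin.suc) → IsTail (suc r) z
cons-zero {r} z₀ (us , w≤ , z≡) = 0 ∷ us ,
  head-zero⁻¹ us (ℕₚ.≤-trans w≤ (ℕₚ.n≤1+n (2 + r))) ,
  λ { Fin.zero → z₀ ; (Fin.suc i) → z≡ i }

-- The last unit vector comes from u = 0, whose final place is 1 - 0; any other has a single entry 1
-- in `u`, which makes the final place 0.
unit⇒tail : ∀ {r} {z : Point (suc r)} i → (∀ k → z k ≡ unit i k) → IsTail r z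
unit⇒tail {zero}  Fin.zero    z≡ = [] , z≤n , λ { Fin.zero → z≡ Fin.zero }
unit⇒tail {suc r} Fin.zero    z≡ = 1 ∷ Vec.replicate r 0 ,
  subst (_≤ 3 + r) (sym (cong₂ _+_ (ℕₚ.*-identityʳ (2 + r)) (weight-zeros r)))
    (subst (_≤ 3 + r) (sym (ℕₚ.+-identityʳ (2 + r))) (ℕₚ.n≤1+n (2 + r))) ,
  λ { Fin.zero → z≡ Fin.zero
    ; (Fin.suc k) → trans (z≡ (Fin.suc k)) (sym (tailColumn-zeros r k)) }
unit⇒tail {suc r} (Fin.suc i) z≡ = cons-zero (z≡ Fin.zero)
  (unit⇒tail i λ k → trans (z≡ (Fin.suc k)) (unit-suc i k))

colV⇒tail : ∀ k {z} → ColV k z → IsTail (2 + k) z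
colV⇒tail zero (z₀ , z₁ , z₂) = 0 ∷ 2 ∷ [] , ℕₚ.≤-refl ,
  λ { Fin.zero → z₀ ; (Fin.suc Fin.zero) → z₁ ; (Fin.suc (Fin.suc Fin.zero)) → z₂ }
colV⇒tail (suc k) (inj₁ (z₀ , V)) = cons-zero z₀ (colV⇒tail k V)
colV⇒tail (suc k) (inj₂ (u , w≡ , init , last)) = u , ℕₚ.≤-reflexive w≡ , tailColumn-unique 0 u init last

-- The bound is one less than in `IsTail (suc r)`, so a single class of the largest size `2 + r`
-- exhausts it and the rest of `u` vanishes.
head-suc⇒unit : ∀ {r} {z : Point (2 + r)} m (us : Vec ℕ r) → weight (suc r) (suc m ∷ us) ≤ 2 + r →
                (∀ i → z i ≡ tailColumn 0 (suc m ∷ us) i) → ∀ k → z k ≡ unit Fin.zero k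
head-suc⇒unit {r} {z} m us w≤ z≡ with m≡0 | us≡0
  where
  rest≤0 : (2 + r) * m + weight r us ≤ 0
  rest≤0 = ℕₚ.+-cancelˡ-≤ (2 + r) _ _ (subst₂ _≤_
    (trans (cong (_+ weight r us) (ℕₚ.*-suc (2 + r) m)) (ℕₚ.+-assoc (2 + r) ((2 + r) * m) (weight r us)))
    (sym (ℕₚ.+-identityʳ (2 + r))) w≤)
  m≡0 : m ≡ 0
  m≡0 = ℕₚ.n≤0⇒n≡0 (ℕₚ.≤-trans (ℕₚ.m≤m+n m ((1 + r) * m)) (ℕₚ.≤-trans (ℕₚ.m≤m+n _ (weight r us)) rest≤0))
  us≡0 : us ≡ Vec.replicate r 0
  us≡0 = weight-0 us (ℕₚ.n≤0⇒n≡0 (ℕₚ.≤-trans (ℕₚ.m≤n+m (weight r us) ((2 + r) * m)) rest≤0))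
... | refl | refl = λ { Fin.zero → z≡ Fin.zero ; (Fin.suc k) → trans (z≡ (Fin.suc k)) (tailColumn-zeros r k) }

UnitOr : ∀ {r} → Set → Point (suc r) → Set
UnitOr A z = (∃ λ i → ∀ k → z k ≡ unit i k) ⊎ A

tail-0 : ∀ {z} → IsTail 0 z → UnitOr ⊥ z
tail-0 ([] , _ , z≡) = inj₁ (Fin.zero , λ { Fin.zero → z≡ Fin.zero })

tail-1 : ∀ {z} → IsTail 1 z → UnitOr ⊥ z
tail-1 (0 ∷ [] , _ , z≡) = inj₁ (Fin.suc Fin.zero , λ { Fin.zero → z≡ Fin.zero ; (Fin.suc Fin.zero) → z≡ (Fin.suc Fin.zero) })
tail-1 (1 ∷ [] , _ , z≡) = inj₁ (Fin.zero , λ { Fin.zero → z≡ Fin.zero ; (Fin.suc Fin.zero) → z≡ (Fin.suc Fin.zero) })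
tail-1 (suc (suc a) ∷ [] , w≤ , z≡) = contradiction
  (ℕₚ.≤-trans (ℕₚ.*-monoʳ-≤ 2 (s≤s (s≤s (z≤n {a})))) (subst (_≤ 3) (ℕₚ.+-identityʳ (2 * (2 + a))) w≤))
  λ { (s≤s (s≤s (s≤s ()))) }

-- Full weight means a column of 𝒰. Otherwise a nonzero head forces a unit vector, and a zero head
-- leaves a tail that meets the bound of the next smaller 𝒱.
tail⇒colV : ∀ k {z} → IsTail (2 + k) z → UnitOr (ColV k z) z
tail⇒colV zero {z} (a ∷ b ∷ [] , w≤ , z≡) = cases a b
  -- From `3a + 2b ≤ 4` follow the crude bounds `a ≤ 2` and `b ≤ 2`. Of the pairs left, (0,0), (0,1)
  -- and (1,0) give unit vectors and (0,2) gives 𝒱(4).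
  (ℕₚ.*-cancelˡ-≤ 3 (ℕₚ.≤-trans (ℕₚ.m≤m+n (3 * a) _) (ℕₚ.≤-trans w≤ (ℕₚ.m≤m+n 4 2))))
  (ℕₚ.*-cancelˡ-≤ 2 (ℕₚ.≤-trans (subst (_≤ 3 * a + (2 * b + 0)) (ℕₚ.+-identityʳ (2 * b))
    (ℕₚ.m≤n+m (2 * b + 0) (3 * a))) w≤)) w≤ z≡
  where
  cases : ∀ a b → a ≤ 2 → b ≤ 2 → weight 2 (a ∷ b ∷ []) ≤ 4 → (∀ i → z i ≡ tailColumn 0 (a ∷ b ∷ []) i) →
          UnitOr (ColV 0 z) z
  cases 0 0 _ _ _ z≡ = inj₁ (Fin.suc (Fin.suc Fin.zero) , λ
    { Fin.zero → z≡ Fin.zero ; (Fin.suc Fin.zero) → z≡ (Fin.suc Fin.zero)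
    ; (Fin.suc (Fin.suc Fin.zero)) → z≡ (Fin.suc (Fin.suc Fin.zero)) })
  cases 0 1 _ _ _ z≡ = inj₁ (Fin.suc Fin.zero , λ
    { Fin.zero → z≡ Fin.zero ; (Fin.suc Fin.zero) → z≡ (Fin.suc Fin.zero)
    ; (Fin.suc (Fin.suc Fin.zero)) → z≡ (Fin.suc (Fin.suc Fin.zero)) })
  cases 0 2 _ _ _ z≡ = inj₂ (z≡ Fin.zero , z≡ (Fin.suc Fin.zero) , z≡ (Fin.suc (Fin.suc Fin.zero)))
  cases 1 0 _ _ _ z≡ = inj₁ (Fin.zero , λ
    { Fin.zero → z≡ Fin.zero ; (Fin.suc Fin.zero) → z≡ (Fin.suc Fin.zero)
    ; (Fin.suc (Fin.suc Fin.zero)) → z≡ (Fin.suc (Fin.suc Fin.zero)) })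
  cases 1 1 _ _ (s≤s (s≤s (s≤s (s≤s ())))) _
  cases 1 2 _ _ (s≤s (s≤s (s≤s (s≤s ())))) _
  cases 2 _ _ _ (s≤s (s≤s (s≤s (s≤s ())))) _
  cases _ (suc (suc (suc _))) _ (s≤s (s≤s ())) _ _
  cases (suc (suc (suc _))) _ (s≤s (s≤s ())) _ _ _
tail⇒colV (suc k) {z} (u ∷ us , w≤ , z≡) with weight (3 + k) (u ∷ us) ℕ.≟ 5 + k
... | yes w≡ = inj₂ (inj₂ (u ∷ us , w≡ , (λ i → trans (z≡ (inject₁ i)) (tailColumn-init 0 (u ∷ us) i)) ,
  trans (z≡ (fromℕ (3 + k))) (tailColumn-last 0 (u ∷ us))))
... | no w≢ with u | z≡ | ℕₚ.≤-pred (ℕₚ.≤∧≢⇒< w≤ w≢)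
...   | suc m | z≡′ | w≤′ = inj₁ (Fin.zero , head-suc⇒unit {z = z} m us w≤′ z≡′)
...   | zero  | z≡′ | w≤′ with tail⇒colV k {z ∘ Fin.suc} (us , head-zero us w≤′ , z≡′ ∘ Fin.suc)
...     | inj₁ (i , unit≡) = inj₁ (Fin.suc i , λ
  { Fin.zero → z≡′ Fin.zero ; (Fin.suc l) → trans (unit≡ l) (sym (unit-suc i l)) })
...     | inj₂ V = inj₂ (inj₁ (z≡′ Fin.zero , V))

-- Column u n ℓ y: y vanishes except on the block of the S(ℓ + 1, -), where it is
-- tailColumn 0 u.  Thus ℓ counts loops and u i counts parallel classes of size r + 1 - i.
data Column {r} (u : Vec ℕ r) : ∀ n → ℕ → Point (tri n) → Set where
  base : ∀ {y} → (∀ k → y (k ↑ˡ suc r) ≡ 0ℚ) → (∀ k → y (tri (suc r) ↑ʳ k) ≡ tailColumn 0 u k) →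
         Column u (2 + r) 0 y
  step : ∀ {n ℓ y} → Column u n ℓ (λ k → y (k ↑ˡ n)) → (∀ k → y (tri n ↑ʳ k) ≡ 0ℚ) →
         Column u (suc n) (suc ℓ) y

-- The common normal form of the matrix columns and of the Schubert expansions.
HasColumn : ∀ n → Point (tri n) → Set
HasColumn n y = ∃ λ r → ∃₂ λ (u : Vec ℕ r) ℓ → weight r u ≤ 2 + r × Column u n ℓ y

column-size : ∀ {r} {u : Vec ℕ r} {n ℓ y} → Column u n ℓ y → ℓ + (2 + r) ≡ n
column-size (base _ _) = refl
column-size (step C _) = cong suc (column-size C)

column-cong : ∀ {r} {u : Vec ℕ r} {n ℓ y y′} → (∀ k → y k ≡ y′ k) → Column u n ℓ y → Column u n ℓ y′
column-cong {r} e (base t b)     = base (λ k → trans (sym (e (k ↑ˡ suc r))) (t k))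
                                        (λ k → trans (sym (e (tri (suc r) ↑ʳ k))) (b k))
column-cong     e (step {n} C b) = step (column-cong (λ k → e (k ↑ˡ n)) C)
                                        (λ k → trans (sym (e (tri n ↑ʳ k))) (b k))

column-exists : ∀ {r} (u : Vec ℕ r) ℓ → ∃ λ y → Column u (ℓ + (2 + r)) ℓ y
column-exists {r} u zero = (λ k → [ (λ _ → 0ℚ) , tailColumn 0 u ]′ (Fin.splitAt (tri (suc r)) k)) ,
  base (λ k → cong [ (λ _ → 0ℚ) , tailColumn 0 u ]′ (Finₚ.splitAt-↑ˡ (tri (suc r)) k (suc r)))
       (λ k → cong [ (λ _ → 0ℚ) , tailColumn 0 u ]′ (Finₚ.splitAt-↑ʳ (tri (suc r)) (suc r) k))
column-exists {r} u (suc ℓ) with column-exists u ℓ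
... | y , C = (λ k → [ y , (λ _ → 0ℚ) ]′ (Fin.splitAt (tri n) k)) ,
  step (column-cong (λ k → sym (cong [ y , (λ _ → 0ℚ) ]′ (Finₚ.splitAt-↑ˡ (tri n) k n))) C)
       (λ k → cong [ y , (λ _ → 0ℚ) ]′ (Finₚ.splitAt-↑ʳ (tri n) n k))
  where
  n = ℓ + (2 + r)

by-split : ∀ m {n} {P : Fin (m + n) → Set} → (∀ i → P (i ↑ˡ n)) → (∀ j → P (m ↑ʳ j)) → ∀ k → P k
by-split m {n} {P} l r k with Fin.splitAt m k in eq
... | inj₁ i = subst P (Finₚ.splitAt⁻¹-↑ˡ eq) (l i)
... | inj₂ j = subst P (Finₚ.splitAt⁻¹-↑ʳ eq) (r j)

↑ˡ≢↑ʳ : ∀ {m n} (i : Fin m) (j : Fin n) → i ↑ˡ n ≢ m ↑ʳ j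
↑ˡ≢↑ʳ {m} {n} i j e with trans (sym (Finₚ.splitAt-↑ˡ m i n)) (trans (cong (Fin.splitAt m) e) (Finₚ.splitAt-↑ʳ m n j))
... | ()

unit-↑ˡ : ∀ m {n} (i : Fin m) {y : Point (m + n)} → (∀ k → y (k ↑ˡ n) ≡ unit i k) → (∀ k → y (m ↑ʳ k) ≡ 0ℚ) →
          ∀ k → y k ≡ unit (i ↑ˡ n) k
unit-↑ˡ m {n} i t b = by-split m
  (λ k → trans (t k) (sym (unit-injective (_↑ˡ n) (Finₚ.↑ˡ-injective n _ _) i k)))
  (λ k → trans (b k) (sym (unit-other (↑ˡ≢↑ʳ i k ∘ sym))))

unit-↑ʳ : ∀ m {n} (j : Fin n) {y : Point (m + n)} → (∀ k → y (k ↑ˡ n) ≡ 0ℚ) → (∀ k → y (m ↑ʳ k) ≡ unit j k) →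
          ∀ k → y k ≡ unit (m ↑ʳ j) k
unit-↑ʳ m {n} j t b = by-split m
  (λ k → trans (t k) (sym (unit-other (↑ˡ≢↑ʳ k j))))
  (λ k → trans (b k) (sym (unit-injective (m ↑ʳ_) (Finₚ.↑ʳ-injective m _ _) j k)))

unit⇒column : ∀ n {y : Point (tri n)} i → (∀ k → y k ≡ unit i k) → HasColumn n y
unit⇒column (suc n) i y≡ with Fin.splitAt (tri n) i in eq
... | inj₁ i′ with unit⇒column n {λ k → _} i′ (λ k → trans (y≡ (k ↑ˡ n))
        (trans (cong (λ i → unit i (k ↑ˡ n)) (sym (Finₚ.splitAt⁻¹-↑ˡ eq)))
          (unit-injective (_↑ˡ n) (Finₚ.↑ˡ-injective n _ _) i′ k)))
...   | r , u , ℓ , w≤ , C = r , u , suc ℓ , w≤ , step C λ k → trans (y≡ (tri n ↑ʳ k))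
        (trans (cong (λ i → unit i (tri n ↑ʳ k)) (sym (Finₚ.splitAt⁻¹-↑ˡ eq))) (unit-other (↑ˡ≢↑ʳ i′ k ∘ sym)))
unit⇒column (suc (suc r)) i y≡ | inj₂ j with unit⇒tail {r} {λ k → _} j (λ k → trans (y≡ (tri (suc r) ↑ʳ k))
        (trans (cong (λ i → unit i (tri (suc r) ↑ʳ k)) (sym (Finₚ.splitAt⁻¹-↑ʳ eq)))
          (unit-injective (tri (suc r) ↑ʳ_) (Finₚ.↑ʳ-injective (tri (suc r)) _ _) j k)))
...   | u , w≤ , z≡ = r , u , 0 , w≤ , base (λ k → trans (y≡ (k ↑ˡ suc r))
        (trans (cong (λ i → unit i (k ↑ˡ suc r)) (sym (Finₚ.splitAt⁻¹-↑ʳ eq))) (unit-other (↑ˡ≢↑ʳ k j)))) z≡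

tail⇒column : ∀ {r y} → (∀ k → y (k ↑ˡ suc r) ≡ 0ℚ) → IsTail r (λ k → y (tri (suc r) ↑ʳ k)) → HasColumn (2 + r) y
tail⇒column {r} t (u , w≤ , b) = r , u , 0 , w≤ , base t b

colO⇒column : ∀ m {y} → ColO m y → HasColumn (4 + m) y
colO⇒column zero (inj₁ (i , y≡)) = unit⇒column 4 i y≡
colO⇒column zero (inj₂ y≡) = tail⇒column
  (λ { Fin.zero → y≡ Fin.zero ; (Fin.suc Fin.zero) → y≡ (Fin.suc Fin.zero)
     ; (Fin.suc (Fin.suc Fin.zero)) → y≡ (Fin.suc (Fin.suc Fin.zero)) })
  (colV⇒tail 0 (y≡ (3 ↑ʳ Fin.zero) , y≡ (3 ↑ʳ Fin.suc Fin.zero) , y≡ (3 ↑ʳ Fin.suc (Fin.suc Fin.zero))))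
colO⇒column (suc m) (inj₁ (C , b)) with colO⇒column m C
... | r , u , ℓ , w≤ , C′ = r , u , suc ℓ , w≤ , step C′ b
colO⇒column (suc m) (inj₂ (inj₁ (t , i , b))) = tail⇒column t (unit⇒tail i b)
colO⇒column (suc m) (inj₂ (inj₂ (t , V)))     = tail⇒column t (colV⇒tail (suc m) V)

-- Two classes of size at least 2 need four nonloops, so for n at most 3 only identity columns
-- arise; this is why 𝒪 at n = 4 needs just one extra column.
column⇒unit : ∀ {n y} → n ≤ 3 → HasColumn n y → ∃ λ i → ∀ k → y k ≡ unit i k
column⇒unit n≤3 (0 , u , _ , w≤ , base t b) with tail-0 (u , w≤ , b)
... | inj₁ (i , e) = tri 1 ↑ʳ i , unit-↑ʳ (tri 1) i t e
column⇒unit n≤3 (1 , u , _ , w≤ , base t b) with tail-1 (u , w≤ , b)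
... | inj₁ (i , e) = tri 2 ↑ʳ i , unit-↑ʳ (tri 2) i t e
column⇒unit (s≤s (s≤s (s≤s ()))) (suc (suc r) , _ , _ , _ , base _ _)
column⇒unit n≤3 (r , u , _ , w≤ , step {n} {ℓ} C b) with column⇒unit (ℕₚ.<⇒≤ n≤3) (r , u , ℓ , w≤ , C)
... | i , e = i ↑ˡ n , unit-↑ˡ (tri n) i e b

column⇒colO : ∀ m {y} → HasColumn (4 + m) y → ColO m y
column⇒colO zero (_ , u , _ , w≤ , base t b) with tail⇒colV 0 (u , w≤ , b)
... | inj₁ (i , e) = inj₁ (tri 3 ↑ʳ i , unit-↑ʳ (tri 3) i t e)
... | inj₂ (z₀ , z₁ , z₂) = inj₂ λ
  { Fin.zero → t Fin.zero ; (Fin.suc Fin.zero) → t (Fin.suc Fin.zero)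
  ; (Fin.suc (Fin.suc Fin.zero)) → t (Fin.suc (Fin.suc Fin.zero))
  ; (Fin.suc (Fin.suc (Fin.suc Fin.zero))) → z₀
  ; (Fin.suc (Fin.suc (Fin.suc (Fin.suc Fin.zero)))) → z₁
  ; (Fin.suc (Fin.suc (Fin.suc (Fin.suc (Fin.suc Fin.zero))))) → z₂ }
column⇒colO zero (r , u , _ , w≤ , step {ℓ = ℓ} C b) with column⇒unit ℕₚ.≤-refl (r , u , ℓ , w≤ , C)
... | i , e = inj₁ (i ↑ˡ 3 , unit-↑ˡ (tri 3) i e b)
column⇒colO (suc m) (_ , u , _ , w≤ , base t b) with tail⇒colV (suc m) (u , w≤ , b)
... | inj₁ (i , e) = inj₂ (inj₁ (t , i , e))
... | inj₂ V       = inj₂ (inj₂ (t , V))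
column⇒colO (suc m) (r , u , _ , w≤ , step {ℓ = ℓ} C b) = inj₁ (column⇒colO m (r , u , ℓ , w≤ , C) , b)

-- Evaluating a column on the Schubert values

-- The correction sum of the expansion with classes grouped by size, where `G q` stands for the size
-- q + 1.
excess : ∀ {r} → Vec ℕ r → (ℕ → ℚ) → ℚ
excess         []       G = 0ℚ
excess {suc r} (u ∷ us) G = ℕtoℚ u ⊛ (G (suc r) ⊖ G 0) ⊕ excess us G

excess-cong : ∀ {r} (u : Vec ℕ r) {G H} → (∀ q → G q ≡ H q) → excess u G ≡ excess u H
excess-cong         []       e = refl
excess-cong {suc r} (u ∷ us) e = cong₂ (λ a b → ℕtoℚ u ⊛ a ⊕ b) (cong₂ _⊖_ (e (suc r)) (e 0)) (excess-cong us e)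

∑-split : ∀ m {n} (f : Fin (m + n) → ℚ) → ∑ f ≡ ∑ (λ k → f (k ↑ˡ n)) ⊕ ∑ (λ k → f (m ↑ʳ k))
∑-split zero    f = sym (ℚₚ.+-identityˡ (∑ f))
∑-split (suc m) {n} f = trans (cong (f Fin.zero ⊕_) (∑-split m (f ∘ Fin.suc)))
  (sym (ℚₚ.+-assoc (f Fin.zero) (∑ (λ k → f (Fin.suc (k ↑ˡ n)))) (∑ (λ k → f (Fin.suc (m ↑ʳ k))))))

-- The final place 1 - (s + 1ᵀu) supplies the term `- g (1 , 2)` of every class; `s` accumulates the
-- entries already passed.
tail-sum : ∀ {r} s (u : Vec ℕ r) (g : ℕ × ℕ → ℚ) →
  ∑ (λ k → tailColumn s u k ⊛ g (lookup (tailPairs (suc r)) k)) ≡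
  (1ℚ ⊖ ℕtoℚ s) ⊛ g (1 , 2) ⊕ excess u (λ q → g (1 , q + 2))
tail-sum s [] g = refl
tail-sum {suc r} s (u ∷ us) g = begin
  ℕtoℚ u ⊛ g (1 , suc (suc r) + 1) ⊕ ∑ (λ k → tailColumn (s + u) us k ⊛ g (lookup (tailPairs (suc r)) k))
    ≡⟨ cong₂ _⊕_ (cong (λ b → ℕtoℚ u ⊛ g (1 , suc b)) (sym (ℕₚ.+-suc r 1))) (tail-sum (s + u) us g) ⟩
  ℕtoℚ u ⊛ g (1 , suc r + 2) ⊕ ((1ℚ ⊖ ℕtoℚ (s + u)) ⊛ g (1 , 2) ⊕ rest)
    ≡⟨ cong (λ t → ℕtoℚ u ⊛ g (1 , suc r + 2) ⊕ ((1ℚ ⊖ t) ⊛ g (1 , 2) ⊕ rest)) (ℕtoℚ-+ s u) ⟩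
  ℕtoℚ u ⊛ g (1 , suc r + 2) ⊕ ((1ℚ ⊖ (ℕtoℚ s ⊕ ℕtoℚ u)) ⊛ g (1 , 2) ⊕ rest)
    ≡⟨ solve 6 (λ u s o a b d → u :* a :+ ((o :- (s :+ u)) :* b :+ d) := (o :- s) :* b :+ (u :* (a :- b) :+ d))
         refl (ℕtoℚ u) (ℕtoℚ s) 1ℚ (g (1 , suc r + 2)) (g (1 , 2)) rest ⟩
  (1ℚ ⊖ ℕtoℚ s) ⊛ g (1 , 2) ⊕ (ℕtoℚ u ⊛ (g (1 , suc r + 2) ⊖ g (1 , 2)) ⊕ rest) ∎
  where
  open ≡-Reasoning
  open ℚ-Solver
  rest : ℚ
  rest = excess us (λ q → g (1 , q + 2))

shiftPair : ℕ × ℕ → ℕ × ℕ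
shiftPair p = suc (proj₁ p) , suc (proj₂ p)

sigma-↑ˡ : ∀ n k → lookup (sigma (suc n)) (k ↑ˡ n) ≡ shiftPair (lookup (sigma n) k)
sigma-↑ˡ n k = trans (Vecₚ.lookup-++ˡ (Vec.map shiftPair (sigma n)) (tailPairs n) k)
  (Vecₚ.lookup-map k shiftPair (sigma n))

sigma-↑ʳ : ∀ n k → lookup (sigma (suc n)) (tri n ↑ʳ k) ≡ lookup (tailPairs n) k
sigma-↑ʳ n k = Vecₚ.lookup-++ʳ (Vec.map shiftPair (sigma n)) (tailPairs n) k

sigma-sum : ∀ n (y : Point (tri (suc n))) (g : ℕ × ℕ → ℚ) →
  ∑ (λ k → y k ⊛ g (lookup (sigma (suc n)) k)) ≡
  ∑ (λ k → y (k ↑ˡ n) ⊛ g (shiftPair (lookup (sigma n) k))) ⊕ ∑ (λ k → y (tri n ↑ʳ k) ⊛ g (lookup (tailPairs n) k))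
sigma-sum n y g = trans (∑-split (tri n) (λ k → y k ⊛ g (lookup (sigma (suc n)) k)))
  (cong₂ _⊕_ (∑-cong λ k → cong (λ p → y (k ↑ˡ n) ⊛ g p) (sigma-↑ˡ n k))
             (∑-cong λ k → cong (λ p → y (tri n ↑ʳ k) ⊛ g p) (sigma-↑ʳ n k)))

-- Each `step` adds a zero block and shifts both entries of a pair, so ℓ steps carry (1, 2) to (1 +
-- ℓ, 2 + ℓ).
column-sum : ∀ {r} {u : Vec ℕ r} {n ℓ y} → Column u n ℓ y → (g : ℕ × ℕ → ℚ) →
  ∑ (λ k → y k ⊛ g (lookup (sigma n) k)) ≡ g (1 + ℓ , 2 + ℓ) ⊕ excess u (λ q → g (1 + ℓ , q + (2 + ℓ)))
column-sum {r} {u} (base {y} t b) g = begin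
  ∑ (λ k → y k ⊛ g (lookup (sigma (2 + r)) k))
    ≡⟨ sigma-sum (suc r) y g ⟩
  ∑ (λ k → y (k ↑ˡ suc r) ⊛ g (shiftPair (lookup (sigma (suc r)) k))) ⊕
  ∑ (λ k → y (tri (suc r) ↑ʳ k) ⊛ g (lookup (tailPairs (suc r)) k))
    ≡⟨ cong₂ _⊕_
         (∑-zero λ k → trans (cong (_⊛ g (shiftPair (lookup (sigma (suc r)) k))) (t k))
           (ℚₚ.*-zeroˡ (g (shiftPair (lookup (sigma (suc r)) k)))))
         (∑-cong λ k → cong (_⊛ g (lookup (tailPairs (suc r)) k)) (b k)) ⟩
  0ℚ ⊕ ∑ (λ k → tailColumn 0 u k ⊛ g (lookup (tailPairs (suc r)) k))
    ≡⟨ ℚₚ.+-identityˡ (∑ (λ k → tailColumn 0 u k ⊛ g (lookup (tailPairs (suc r)) k))) ⟩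
  ∑ (λ k → tailColumn 0 u k ⊛ g (lookup (tailPairs (suc r)) k))
    ≡⟨ tail-sum 0 u g ⟩
  (1ℚ ⊖ ℕtoℚ 0) ⊛ g (1 , 2) ⊕ excess u (λ q → g (1 , q + 2))
    ≡⟨ cong (_⊕ excess u (λ q → g (1 , q + 2))) (ℚₚ.*-identityˡ (g (1 , 2))) ⟩
  g (1 , 2) ⊕ excess u (λ q → g (1 , q + 2)) ∎
  where open ≡-Reasoning
column-sum {r} {u} (step {n} {ℓ} {y} C b) g = begin
  ∑ (λ k → y k ⊛ g (lookup (sigma (suc n)) k))
    ≡⟨ sigma-sum n y g ⟩
  ∑ (λ k → y (k ↑ˡ n) ⊛ g (shiftPair (lookup (sigma n) k))) ⊕ ∑ (λ k → y (tri n ↑ʳ k) ⊛ g (lookup (tailPairs n) k))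
    ≡⟨ cong₂ _⊕_ (column-sum C (g ∘ shiftPair))
         (∑-zero λ k → trans (cong (_⊛ g (lookup (tailPairs n) k)) (b k)) (ℚₚ.*-zeroˡ (g (lookup (tailPairs n) k)))) ⟩
  (g (2 + ℓ , 3 + ℓ) ⊕ excess u (λ q → g (2 + ℓ , suc (q + (2 + ℓ))))) ⊕ 0ℚ
    ≡⟨ ℚₚ.+-identityʳ (g (2 + ℓ , 3 + ℓ) ⊕ excess u (λ q → g (2 + ℓ , suc (q + (2 + ℓ))))) ⟩
  g (2 + ℓ , 3 + ℓ) ⊕ excess u (λ q → g (2 + ℓ , suc (q + (2 + ℓ))))
    ≡⟨ cong (g (2 + ℓ , 3 + ℓ) ⊕_) (excess-cong u λ q → cong (λ b → g (2 + ℓ , b)) (sym (ℕₚ.+-suc q (2 + ℓ)))) ⟩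
  g (2 + ℓ , 3 + ℓ) ⊕ excess u (λ q → g (2 + ℓ , q + (3 + ℓ))) ∎
  where open ≡-Reasoning

-- Class sizes

-- Records one more class of size q + 1. No entry belongs to q = 0, so trivial classes leave no
-- trace.
inc : ∀ {r} → ℕ → Vec ℕ r → Vec ℕ r
inc         q []       = []
inc {suc r} q (u ∷ us) = if does (q ℕ.≟ suc r) then suc u ∷ us else u ∷ inc q us

inc-0 : ∀ {r} (u : Vec ℕ r) → inc 0 u ≡ u
inc-0 []       = refl
inc-0 (u ∷ us) = cong (u ∷_) (inc-0 us)

-- Equality can fail because a class that is not recorded still counts on the right.
weight-inc : ∀ {r} q (u : Vec ℕ r) → weight r (inc q u) ≤ suc q + weight r u
weight-inc q [] = z≤n
weight-inc {suc r} q (u ∷ us) = go (q ℕ.≟ suc r)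
  where
  go : ∀ d → weight (suc r) (if does (d) then suc u ∷ us else u ∷ inc q us) ≤ suc q + weight (suc r) (u ∷ us)
  go (yes refl) = ℕₚ.≤-reflexive (trans (cong (_+ weight r us) (ℕₚ.*-suc (2 + r) u))
    (ℕₚ.+-assoc (2 + r) ((2 + r) * u) (weight r us)))
  go (no _) = ℕₚ.≤-trans (ℕₚ.+-monoʳ-≤ ((2 + r) * u) (weight-inc q us))
    (ℕₚ.≤-reflexive (solve 3 (λ a b c → a :+ (b :+ c) := b :+ (a :+ c)) refl ((2 + r) * u) (suc q) (weight r us)))
    where open ℕ-Solver

weight-inc-size : ∀ {r} p (u : Vec ℕ r) → weight r (inc (p ∸ 1) u) ≤ p + weight r u
weight-inc-size zero    u = ℕₚ.≤-reflexive (cong (weight _) (inc-0 u))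
weight-inc-size (suc q) u = weight-inc q u

ℕtoℚ-suc : ∀ a → ℕtoℚ (suc a) ≡ 1ℚ ⊕ ℕtoℚ a
ℕtoℚ-suc = ℕtoℚ-+ 1

excess-inc : ∀ {r} q (u : Vec ℕ r) G → q ≤ r → excess (inc q u) G ≡ (G q ⊖ G 0) ⊕ excess u G
excess-inc zero [] G _ = sym (trans (ℚₚ.+-identityʳ (G 0 ⊖ G 0)) (ℚₚ.+-inverseʳ (G 0)))
excess-inc {suc r} q (u ∷ us) G q≤ = go (q ℕ.≟ suc r)
  where
  open ℚ-Solver
  go : ∀ d → excess (if does d then suc u ∷ us else u ∷ inc q us) G ≡ (G q ⊖ G 0) ⊕ excess (u ∷ us) G
  go (yes refl) = trans (cong (λ a → a ⊛ (G (suc r) ⊖ G 0) ⊕ excess us G) (ℕtoℚ-suc u))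
    (trans (cong (_⊕ excess us G) (trans (ℚₚ.*-distribʳ-+ (G (suc r) ⊖ G 0) 1ℚ (ℕtoℚ u))
        (cong (_⊕ ℕtoℚ u ⊛ (G (suc r) ⊖ G 0)) (ℚₚ.*-identityˡ (G (suc r) ⊖ G 0)))))
      (ℚₚ.+-assoc (G (suc r) ⊖ G 0) (ℕtoℚ u ⊛ (G (suc r) ⊖ G 0)) (excess us G)))
  go (no q≢) = trans (cong (ℕtoℚ u ⊛ (G (suc r) ⊖ G 0) ⊕_) (excess-inc q us G (ℕₚ.≤-pred (ℕₚ.≤∧≢⇒< q≤ q≢))))
    (solve 3 (λ a b c → a :+ (b :+ c) := b :+ (a :+ c)) refl
      (ℕtoℚ u ⊛ (G (suc r) ⊖ G 0)) (G q ⊖ G 0) (excess us G))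

-- The bound on `p` gives every class of size at least 2 its entry; sizes 0 and 1 contribute
-- `G 0 ⊖ G 0`.
collect : ∀ r K (p : Fin K → ℕ) → (∀ t → p t ≤ suc r) → ∃ λ (u : Vec ℕ r) →
  weight r u ≤ ∑ℕ p × (∀ G → ∑ (λ t → G (p t ∸ 1) ⊖ G 0) ≡ excess u G)
collect r zero    p p≤ = Vec.replicate r 0 , ℕₚ.≤-reflexive (weight-zeros r) , λ G → sym (excess-zeros r G)
  where
  excess-zeros : ∀ r G → excess (Vec.replicate r 0) G ≡ 0ℚ
  excess-zeros zero    G = refl
  excess-zeros (suc r) G = trans (cong₂ _⊕_ (ℚₚ.*-zeroˡ (G (suc r) ⊖ G 0)) (excess-zeros r G)) refl
collect r (suc K) p p≤ with collect r K (p ∘ Fin.suc) (p≤ ∘ Fin.suc)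
... | u , w≤ , e = inc (p Fin.zero ∸ 1) u ,
  ℕₚ.≤-trans (weight-inc-size (p Fin.zero) u) (ℕₚ.+-monoʳ-≤ (p Fin.zero) w≤) ,
  λ G → trans (cong ((G (p Fin.zero ∸ 1) ⊖ G 0) ⊕_) (e G)) (sym (excess-inc (p Fin.zero ∸ 1) u G (pred≤ (p≤ Fin.zero))))

count-triple : ∀ {n} (c : Colouring n) {A B : Fin n → Set} (a? : ∀ k → Dec (A k)) (b? : ∀ k → Dec (B k)) →
  (∀ k → c k ≡ 0 → ¬ A k) → (∀ k → c k ≡ 0 → ¬ B k) → (∀ k → A k → ¬ B k) →
  count c 0 + (∑ℕ (λ k → hit (a? k)) + ∑ℕ (λ k → hit (b? k))) ≤ n
count-triple {n} c a? b? ca cb ab = subst₂ _≤_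
  (trans (∑ℕ-distrib-+ (λ k → hit (c k ℕ.≟ 0)) (λ k → hit (a? k) + hit (b? k)))
    (cong (count c 0 +_) (∑ℕ-distrib-+ (λ k → hit (a? k)) (λ k → hit (b? k)))))
  (∑ℕ-ones n) (∑ℕ-mono λ k → three (c k ℕ.≟ 0) (a? k) (b? k) (ca k) (cb k) (ab k))
  where
  three : ∀ {A B C : Set} (c? : Dec C) (a? : Dec A) (b? : Dec B) → (C → ¬ A) → (C → ¬ B) → (A → ¬ B) →
          hit c? + (hit a? + hit b?) ≤ 1
  three (no _)  a?      b?     _  _  ab = hit-+-≤1 a? b? ab
  three (yes c) (yes a) _      ca _  _  = contradiction a (ca c)
  three (yes c) (no _) (yes b) _  cb _  = contradiction b (cb c)
  three (yes _) (no _) (no _)  _  _  _  = ℕₚ.≤-refl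

∑ℕ-point : ∀ {n} (i : Fin n) → ∑ℕ (λ k → hit (k Fin.≟ i)) ≡ 1
∑ℕ-point {suc n} Fin.zero    = cong suc (∑ℕ-zero {n} λ _ → refl)
∑ℕ-point {suc n} (Fin.suc i) = ∑ℕ-point i

-- The independent pair gives two nonloops, so `n` minus the loops has the form `2 + r`. Each class
-- misses `i` or `j`, hence has at most r + 1 elements, the largest size recorded in `u`.
classSizes : ∀ {n} (c : Colouring n) K {i j} → Indep c i j → ∃ λ r → ∃ λ (u : Vec ℕ r) →
  count c 0 + (2 + r) ≡ n × weight r u ≤ 2 + r ×
  (∀ G → ∑ (λ (t : Fin K) → G (count c (2 + toℕ t) ∸ 1) ⊖ G 0) ≡ excess u G)
classSizes {n} c K {i} {j} (i≢j , ci≢0 , cj≢0 , sep) =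
  let u , w≤ , e = collect r K (λ t → count c (2 + toℕ t)) size≤ in
  r , u , size , ℕₚ.≤-trans w≤ total≤ , e
  where
  two : count c 0 + 2 ≤ n
  two = subst (λ m → count c 0 + m ≤ n) (cong₂ _+_ (∑ℕ-point i) (∑ℕ-point j))
    (count-triple c (Fin._≟ i) (Fin._≟ j) (λ { k e refl → ci≢0 e }) (λ { k e refl → cj≢0 e })
      λ { k refl refl → i≢j refl })
  r : ℕ
  r = n ∸ (count c 0 + 2)
  size : count c 0 + (2 + r) ≡ n
  size = trans (sym (ℕₚ.+-assoc (count c 0) 2 r)) (ℕₚ.m+[n∸m]≡n two)
  room : ∀ {m} → count c 0 + m ≤ n → m ≤ 2 + r
  room {m} h = ℕₚ.+-cancelˡ-≤ (count c 0) m (2 + r) (subst (count c 0 + m ≤_) (sym size) h)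
  outsider : ∀ v k → 2 ≤ v → c k ≢ 0 → c k ≢ v → count c v ≤ suc r
  outsider v k 2≤v ck≢0 ck≢v = ℕₚ.+-cancelʳ-≤ 1 (count c v) (suc r)
    (subst₂ _≤_ (cong (count c v +_) (∑ℕ-point k)) (ℕₚ.+-comm 1 (suc r))
      (room (count-triple c (λ l → c l ℕ.≟ v) (Fin._≟ k)
        (λ l e e′ → contradiction (subst (2 ≤_) (trans (sym e′) e) 2≤v) λ ())
        (λ { l e refl → ck≢0 e }) λ { l e refl → ck≢v e })))
  size≤ : ∀ (t : Fin K) → count c (2 + toℕ t) ≤ suc r
  size≤ t with c i ℕ.≟ 2 + toℕ t
  ... | no  ci≢ = outsider (2 + toℕ t) i (s≤s (s≤s z≤n)) ci≢0 ci≢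
  ... | yes ci≡ = outsider (2 + toℕ t) j (s≤s (s≤s z≤n)) cj≢0 λ cj≡ →
    contradiction (trans (sym (sep (trans ci≡ (sym cj≡)))) ci≡) λ ()
  at-most-one : ∀ v → hit (v ℕ.≟ 0) + ∑ℕ (λ (t : Fin K) → hit (v ℕ.≟ 2 + toℕ t)) ≤ 1
  at-most-one zero          = s≤s (ℕₚ.≤-reflexive (∑ℕ-zero {K} λ _ → refl))
  at-most-one (suc zero)    = ℕₚ.≤-trans (ℕₚ.≤-reflexive (∑ℕ-zero {K} λ _ → refl)) z≤n
  at-most-one (suc (suc v)) = go K v
    where
    go : ∀ K v → ∑ℕ (λ (t : Fin K) → hit (v ℕ.≟ toℕ t)) ≤ 1
    go zero    v       = z≤n
    go (suc K) zero    = s≤s (ℕₚ.≤-reflexive (∑ℕ-zero {K} λ _ → refl))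
    go (suc K) (suc v) = go K v
  total≤ : ∑ℕ (λ (t : Fin K) → count c (2 + toℕ t)) ≤ 2 + r
  total≤ = room (subst₂ _≤_
    (trans (∑ℕ-distrib-+ (λ k → hit (c k ℕ.≟ 0)) (λ k → ∑ℕ λ (t : Fin K) → hit (c k ℕ.≟ 2 + toℕ t)))
      (cong (count c 0 +_) (∑ℕ-comm (λ k (t : Fin K) → hit (c k ℕ.≟ 2 + toℕ t)))))
    (∑ℕ-ones n) (∑ℕ-mono λ k → at-most-one (c k)))

-- Realizing prescribed class sizes

sizes : ∀ {r} → Vec ℕ r → List ℕ
sizes         []       = []
sizes {suc r} (u ∷ us) = List.replicate u (2 + r) ++ sizes us

sum-sizes : ∀ {r} (u : Vec ℕ r) → ListSum.sum (sizes u) ≡ weight r u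
sum-sizes         []       = refl
sum-sizes {suc r} (u ∷ us) = trans (ListSumₚ.sum-++ (List.replicate u (2 + r)) (sizes us))
  (cong₂ _+_ (sum-replicate u) (sum-sizes us))
  where
  sum-replicate : ∀ u → ListSum.sum (List.replicate u (2 + r)) ≡ (2 + r) * u
  sum-replicate zero    = sym (ℕₚ.*-zeroʳ (2 + r))
  sum-replicate (suc u) = trans (cong (2 + r +_) (sum-replicate u)) (sym (ℕₚ.*-suc (2 + r) u))

sizes-≤ : ∀ {r} (u : Vec ℕ r) → All (_≤ suc r) (sizes u)
sizes-≤         []       = []
sizes-≤ {suc r} (u ∷ us) = Allₚ.++⁺ (Allₚ.replicate⁺ u ℕₚ.≤-refl)
  (All.map (λ h → ℕₚ.≤-trans h (ℕₚ.n≤1+n (suc r))) (sizes-≤ us))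

sizes-excess : ∀ {r} (u : Vec ℕ r) G → sumOver (sizes u) (λ p → G (p ∸ 1) ⊖ G 0) ≡ excess u G
sizes-excess         []       G = refl
sizes-excess {suc r} (u ∷ us) G = begin
  sumOver (List.replicate u (2 + r) ++ sizes us) h
    ≡⟨ cong sumℚ (Listₚ.map-++ h (List.replicate u (2 + r)) (sizes us)) ⟩
  sumℚ (map h (List.replicate u (2 + r)) ++ map h (sizes us))
    ≡⟨ sumℚ-++ (map h (List.replicate u (2 + r))) (map h (sizes us)) ⟩
  sumOver (List.replicate u (2 + r)) h ⊕ sumOver (sizes us) h
    ≡⟨ cong₂ _⊕_ (multiple u) (sizes-excess us G) ⟩
  excess (u ∷ us) G ∎
  where
  open ≡-Reasoning
  h : ℕ → ℚ
  h p = G (p ∸ 1) ⊖ G 0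
  multiple : ∀ u → sumOver (List.replicate u (2 + r)) h ≡ ℕtoℚ u ⊛ h (2 + r)
  multiple zero    = sym (ℚₚ.*-zeroˡ (h (2 + r)))
  multiple (suc u) = trans (cong (h (2 + r) ⊕_) (multiple u)) (sym (trans
    (cong (_⊛ h (2 + r)) (ℕtoℚ-suc u)) (trans (ℚₚ.*-distribʳ-+ (h (2 + r)) 1ℚ (ℕtoℚ u))
      (cong (_⊕ ℕtoℚ u ⊛ h (2 + r)) (ℚₚ.*-identityˡ (h (2 + r)))))))

occ : ℕ → List ℕ → ℕ
occ v []       = 0
occ v (x ∷ xs) = hit (x ℕ.≟ v) + occ v xs

occ-++ : ∀ v xs ys → occ v (xs ++ ys) ≡ occ v xs + occ v ys
occ-++ v []       ys = refl
occ-++ v (x ∷ xs) ys = trans (cong (hit (x ℕ.≟ v) +_) (occ-++ v xs ys))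
  (sym (ℕₚ.+-assoc (hit (x ℕ.≟ v)) (occ v xs) (occ v ys)))

occ-same : ∀ v p → occ v (List.replicate p v) ≡ p
occ-same v zero    = refl
occ-same v (suc p) = cong₂ _+_ (hit-true (v ℕ.≟ v) refl) (occ-same v p)

occ-other : ∀ {v x} p → x ≢ v → occ v (List.replicate p x) ≡ 0
occ-other         zero    x≢v = refl
occ-other {v} {x} (suc p) x≢v = cong₂ _+_ (hit-false (x ℕ.≟ v) x≢v) (occ-other p x≢v)

classes : ℕ → List ℕ → List ℕ
classes t []       = []
classes t (p ∷ ps) = List.replicate p t ++ classes (suc t) ps

occ-before : ∀ {v t} ps → v < t → occ v (classes t ps) ≡ 0
occ-before         []       v<t = refl
occ-before {v} {t} (p ∷ ps) v<t = trans (occ-++ v (List.replicate p t) (classes (suc t) ps))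
  (cong₂ _+_ (occ-other p (ℕₚ.<⇒≢ v<t ∘ sym)) (occ-before ps (ℕₚ.<-trans v<t (ℕₚ.n<1+n t))))

occ-classes : ∀ t ps i → occ (t + toℕ i) (classes t ps) ≡ List.lookup ps i
occ-classes t (p ∷ ps) Fin.zero = trans (cong (λ v → occ v (classes t (p ∷ ps))) (ℕₚ.+-identityʳ t))
  (trans (occ-++ t (List.replicate p t) (classes (suc t) ps))
    (trans (cong₂ _+_ (occ-same t p) (occ-before ps (ℕₚ.n<1+n t))) (ℕₚ.+-identityʳ p)))
occ-classes t (p ∷ ps) (Fin.suc i) = trans (cong (λ v → occ v (classes t (p ∷ ps))) (ℕₚ.+-suc t (toℕ i)))
  (trans (occ-++ (suc t + toℕ i) (List.replicate p t) (classes (suc t) ps))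
    (cong₂ _+_ (occ-other p (ℕₚ.<⇒≢ (s≤s (ℕₚ.m≤m+n t (toℕ i))))) (occ-classes (suc t) ps i)))

occ-classes-≤ : ∀ {v b} t ps → All (_≤ b) ps → occ v (classes t ps) ≤ b
occ-classes-≤         t []       _        = z≤n
occ-classes-≤ {v} {b} t (p ∷ ps) (p≤ ∷ ≤s) = subst (_≤ b) (sym (occ-++ v (List.replicate p t) (classes (suc t) ps)))
  (go (t ℕ.≟ v))
  where
  go : Dec (t ≡ v) → occ v (List.replicate p t) + occ v (classes (suc t) ps) ≤ b
  go (yes refl) = subst (_≤ b) (sym (trans (cong₂ _+_ (occ-same t p) (occ-before ps (ℕₚ.n<1+n t))) (ℕₚ.+-identityʳ p))) p≤
  go (no t≢v) = subst (_≤ b) (sym (cong (_+ occ v (classes (suc t) ps)) (occ-other p t≢v))) (occ-classes-≤ (suc t) ps ≤s)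

length-classes : ∀ t ps → length (classes t ps) ≡ ListSum.sum ps
length-classes t []       = refl
length-classes t (p ∷ ps) = trans (Listₚ.length-++ (List.replicate p t))
  (cong₂ _+_ (Listₚ.length-replicate p) (length-classes (suc t) ps))

classes-< : ∀ t ps → All (_< t + length ps) (classes t ps)
classes-< t []       = []
classes-< t (p ∷ ps) = Allₚ.++⁺ (Allₚ.replicate⁺ p (ℕₚ.m<m+n t (s≤s z≤n)))
  (subst (λ m → All (_< m) (classes (suc t) ps)) (sym (ℕₚ.+-suc t (length ps))) (classes-< (suc t) ps))

-- Positions beyond the list are singleton classes.
fromList : ∀ {n} → List ℕ → Colouring n
fromList []       _           = 1
fromList (x ∷ xs) Fin.zero    = x
fromList (x ∷ xs) (Fin.suc k) = fromList xs k

fromList-count : ∀ {n} xs {v} → v ≢ 1 → length xs ≤ n → count {n} (fromList xs) v ≡ occ v xs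
fromList-count {n}     []       {v} v≢1 _       = ∑ℕ-zero {n} λ _ → hit-false (1 ℕ.≟ v) (v≢1 ∘ sym)
fromList-count {suc n} (x ∷ xs) {v} v≢1 (s≤s h) = cong (hit (x ℕ.≟ v) +_) (fromList-count xs v≢1 h)

fromList-< : ∀ {n b} xs → 1 < b → All (_< b) xs → ∀ (k : Fin n) → fromList xs k < b
fromList-< []       1<b _          k           = 1<b
fromList-< (x ∷ xs) 1<b (x< ∷ xs<) Fin.zero    = x<
fromList-< (x ∷ xs) 1<b (x< ∷ xs<) (Fin.suc k) = fromList-< xs 1<b xs< k

pigeonhole : ∀ {n} {A B : Fin n → Set} (a? : ∀ k → Dec (A k)) (b? : ∀ k → Dec (B k)) →
  ∑ℕ (λ k → hit (a? k)) + ∑ℕ (λ k → hit (b? k)) < n → ∃ λ k → ¬ A k × ¬ B k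
pigeonhole {n} a? b? few with Finₚ.any? (λ k → ¬? (a? k) ×-dec ¬? (b? k))
... | yes found = found
... | no none = contradiction few (ℕₚ.≤⇒≯ (subst₂ _≤_ (∑ℕ-ones n)
  (∑ℕ-distrib-+ (λ k → hit (a? k)) (λ k → hit (b? k))) (∑ℕ-mono λ k → covered (a? k) (b? k) λ ¬a ¬b → none (k , ¬a , ¬b))))
  where
  covered : ∀ {A B : Set} (a? : Dec A) (b? : Dec B) → (¬ A → ¬ ¬ B) → 1 ≤ hit a? + hit b?
  covered (yes _) _       _ = s≤s z≤n
  covered (no _)  (yes _) _ = s≤s z≤n
  covered (no ¬a) (no ¬b) f = contradiction ¬b (f ¬a)

-- Start from any nonloop. If it is a singleton class, any second nonloop will do; otherwise its
-- class has at most r + 1 of the `2 + r` nonloops and leaves one outside.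
find-indep : ∀ {n} (c : Colouring n) r → count c 0 + (2 + r) ≡ n → (∀ v → 2 ≤ v → count c v ≤ suc r) →
             ∃ λ i → ∃ λ j → Indep c i j
-- The second predicate is contradictory on purpose: only loops are to be avoided here.
find-indep {n} c r size≡ small with pigeonhole (λ k → c k ℕ.≟ 0) (λ k → c k ℕ.≟ 0 ×-dec ¬? (c k ℕ.≟ 0))
  (subst₂ _<_ (sym (trans (cong (count c 0 +_) (∑ℕ-zero λ k → hit-false (c k ℕ.≟ 0 ×-dec ¬? (c k ℕ.≟ 0))
      λ { (p , q) → q p })) (ℕₚ.+-identityʳ (count c 0)))) size≡ (ℕₚ.m<m+n (count c 0) (s≤s z≤n)))
... | i , ci≢0 , _ with c i ℕ.≟ 1
...   | yes ci≡1 with pigeonhole (λ k → c k ℕ.≟ 0) (Fin._≟ i)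
        (subst₂ _<_ (cong (count c 0 +_) (sym (∑ℕ-point i))) size≡ (ℕₚ.+-monoʳ-< (count c 0) (s≤s (s≤s z≤n))))
...     | j , cj≢0 , j≢i = i , j , j≢i ∘ sym , ci≢0 , cj≢0 , λ _ → ci≡1
find-indep {n} c r size≡ small | i , ci≢0 , _ | no ci≢1 with pigeonhole (λ k → c k ℕ.≟ 0) (λ k → c k ℕ.≟ c i)
        (subst (count c 0 + count c (c i) <_) size≡ (ℕₚ.+-monoʳ-< (count c 0)
          (s≤s (small (c i) (ℕₚ.≤∧≢⇒< (ℕₚ.n≢0⇒n>0 ci≢0) (ci≢1 ∘ sym))))))
...     | j , cj≢0 , cj≢ci = i , j , (λ { refl → cj≢ci refl }) , ci≢0 , cj≢0 , λ e → contradiction (sym e) cj≢ci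

-- The list has ℓ loops followed by the classes, each with a colour of its own; the weight bound
-- makes it fit, and the remaining places become singletons.
colouring-exists : ∀ {r} (u : Vec ℕ r) ℓ → weight r u ≤ 2 + r → ∃ λ (c : Colouring (ℓ + (2 + r))) → ∃ λ K →
  (∀ i → c i < 2 + K) × count c 0 ≡ ℓ ×
  (∀ G → ∑ (λ (t : Fin K) → G (count c (2 + toℕ t) ∸ 1) ⊖ G 0) ≡ excess u G) × ∃ λ i → ∃ λ j → Indep c i j
colouring-exists {r} u ℓ w≤ = c , K , fromList-< xs (s≤s (s≤s z≤n)) xs< , loops≡ , sum≡ ,
  find-indep c r (cong (_+ (2 + r)) loops≡) λ v 2≤v →
    subst (_≤ suc r) (sym (class≡ v 2≤v)) (occ-classes-≤ 2 (sizes u) (sizes-≤ u))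
  where
  K : ℕ
  K = length (sizes u)
  xs : List ℕ
  xs = List.replicate ℓ 0 ++ classes 2 (sizes u)
  c : Colouring (ℓ + (2 + r))
  c = fromList xs
  xs< : All (_< 2 + K) xs
  xs< = Allₚ.++⁺ (Allₚ.replicate⁺ ℓ (s≤s z≤n)) (classes-< 2 (sizes u))
  short : length xs ≤ ℓ + (2 + r)
  short = subst (_≤ ℓ + (2 + r)) (sym (trans (Listₚ.length-++ (List.replicate ℓ 0))
    (cong₂ _+_ (Listₚ.length-replicate ℓ) (trans (length-classes 2 (sizes u)) (sum-sizes u)))))
    (ℕₚ.+-monoʳ-≤ ℓ w≤)
  loops≡ : count c 0 ≡ ℓ
  loops≡ = trans (fromList-count xs (λ ()) short) (trans (occ-++ 0 (List.replicate ℓ 0) (classes 2 (sizes u)))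
    (trans (cong₂ _+_ (occ-same 0 ℓ) (occ-before (sizes u) (s≤s z≤n))) (ℕₚ.+-identityʳ ℓ)))
  class≡ : ∀ v → 2 ≤ v → count c v ≡ occ v (classes 2 (sizes u))
  class≡ v 2≤v = trans (fromList-count xs (λ { refl → contradiction 2≤v (ℕₚ.<⇒≱ ℕₚ.≤-refl) }) short)
    (trans (occ-++ v (List.replicate ℓ 0) (classes 2 (sizes u)))
      (cong (_+ occ v (classes 2 (sizes u))) (occ-other ℓ λ { refl → contradiction 2≤v λ () })))
  sum≡ : ∀ G → ∑ (λ (t : Fin K) → G (count c (2 + toℕ t) ∸ 1) ⊖ G 0) ≡ excess u G
  sum≡ G = trans (∑-cong λ t → cong (λ p → G (p ∸ 1) ⊖ G 0)
      (trans (class≡ (2 + toℕ t) (s≤s (s≤s z≤n))) (occ-classes 2 (sizes u) t)))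
    (trans (∑-lookup (λ p → G (p ∸ 1) ⊖ G 0) (sizes u)) (sizes-excess u G))
    where
    ∑-lookup : ∀ (h : ℕ → ℚ) ps → ∑ (λ t → h (List.lookup ps t)) ≡ sumOver ps h
    ∑-lookup h []       = refl
    ∑-lookup h (p ∷ ps) = cong (h p ⊕_) (∑-lookup h ps)

-- Linear independence of the symmetrized Schubert indicators

ℕtoℚ-≥0 : ∀ a → 0ℚ ≤ᵣ ℕtoℚ a
ℕtoℚ-≥0 zero    = ℚₚ.≤-refl
ℕtoℚ-≥0 (suc a) = subst (0ℚ ≤ᵣ_) (sym (ℕtoℚ-suc a)) (ℚₚ.+-mono-≤ 0≤1 (ℕtoℚ-≥0 a))

ℕtoℚ-mono : ∀ {a b} → a ≤ b → ℕtoℚ a ≤ᵣ ℕtoℚ b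
ℕtoℚ-mono {b = b} z≤n = ℕtoℚ-≥0 b
ℕtoℚ-mono {suc a} {suc b} (s≤s h) = ≤ᵣ-by (ℕtoℚ-suc a) (ℕtoℚ-suc b) (ℚₚ.+-monoʳ-≤ 1ℚ (ℕtoℚ-mono h))

0<1 : 0ℚ <ᵣ 1ℚ
0<1 = toWitness {a? = 0ℚ ℚₚ.<? 1ℚ} tt

ℕtoℚ-mono-< : ∀ {a b} → a < b → ℕtoℚ a <ᵣ ℕtoℚ b
ℕtoℚ-mono-< {a} {suc b} (s≤s h) = subst₂ _<ᵣ_ (ℚₚ.+-identityˡ (ℕtoℚ a)) (sym (ℕtoℚ-suc b))
  (ℚₚ.+-mono-<-≤ 0<1 (ℕtoℚ-mono h))

product-zero : ∀ {p q} → p ⊛ q ≡ 0ℚ → q ≢ 0ℚ → p ≡ 0ℚ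
product-zero {p} {q} pq≡0 q≢0 = begin
  p                   ≡⟨ ℚₚ.*-identityʳ p ⟨
  p ⊛ 1ℚ              ≡⟨ cong (p ⊛_) (ℚₚ.*-inverseʳ q) ⟨
  p ⊛ (q ⊛ ℚ.1/ q)    ≡⟨ ℚₚ.*-assoc p q (ℚ.1/ q) ⟨
  p ⊛ q ⊛ ℚ.1/ q      ≡⟨ cong (_⊛ ℚ.1/ q) pq≡0 ⟩
  0ℚ ⊛ ℚ.1/ q         ≡⟨ ℚₚ.*-zeroˡ (ℚ.1/ q) ⟩
  0ℚ                  ∎
  where
  open ≡-Reasoning
  instance
    nz : ℚ.NonZero q
    nz = ℚ.≢-nonZero q≢0

module _ {A : Set} where

  sumOver-congᴬ : ∀ {f g : A → ℚ} {xs} → All (λ x → f x ≡ g x) xs → sumOver xs f ≡ sumOver xs g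
  sumOver-congᴬ []       = refl
  sumOver-congᴬ (e ∷ es) = cong₂ _⊕_ e (sumOver-congᴬ es)

  sumOver-zero : ∀ {f : A → ℚ} {xs} → All (λ x → f x ≡ 0ℚ) xs → sumOver xs f ≡ 0ℚ
  sumOver-zero []       = refl
  sumOver-zero (e ∷ es) = cong₂ _⊕_ e (sumOver-zero es)

  sumOver-mono : ∀ {f g : A → ℚ} {xs} → All (λ x → f x ≤ᵣ g x) xs → sumOver xs f ≤ᵣ sumOver xs g
  sumOver-mono []       = ℚₚ.≤-refl
  sumOver-mono (e ∷ es) = ℚₚ.+-mono-≤ e (sumOver-mono es)

  sumOver-< : ∀ {f g : A → ℚ} {xs x} → All (λ x → f x ≤ᵣ g x) xs → x ∈ᴸ xs → f x <ᵣ g x → sumOver xs f <ᵣ sumOver xs g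
  sumOver-< (e ∷ es) (here refl) lt = ℚₚ.+-mono-<-≤ lt (sumOver-mono es)
  sumOver-< (e ∷ es) (there x∈)  lt = ℚₚ.+-mono-≤-< e (sumOver-< es x∈ lt)

indicator-≥0 : ∀ {n} (c : Colouring n) z → 0ℚ ≤ᵣ indicator c z
indicator-≥0 c z with poly? c z
... | yes _ = 0≤1
... | no _  = ℚₚ.≤-refl

indicator-mono : ∀ {n} {c : Colouring n} {z z′} → (Poly c z → Poly c z′) → indicator c z ≤ᵣ indicator c z′
indicator-mono {c = c} {z} {z′} imp with poly? c z
... | yes Q = ℚₚ.≤-reflexive (sym (indicator-true (imp Q)))
... | no _  = indicator-≥0 c z′

-- Test points with a common denominator

maskℕ : Bool → ℕ → ℕ
maskℕ b m = if b then m else 0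

classSumℕ : ∀ {n} → Colouring n → (Fin n → ℕ) → ℕ → ℕ
classSumℕ c X t = ∑ℕ λ k → maskℕ (does (c k ℕ.≟ t)) (X k)

-- The conditions of `Poly` on X / D with denominators cleared, so that parity becomes available.
record Polyℕ {n} (c : Colouring n) (D : ℕ) (X : Fin n → ℕ) : Set where
  field
    totalℕ : ∑ℕ X ≡ D + D
    loopsℕ : ∀ i → c i ≡ 0 → X i ≡ 0
    leℕ    : ∀ i → X i ≤ D
    classℕ : ∀ i → 2 ≤ c i → classSumℕ c X (c i) ≤ D
open Polyℕ public

module Scaled (D : ℕ) .{{D≢0 : ℕ.NonZero D}} where

  private instance
    D-pos : ℚ.Positive (ℕtoℚ D)
    D-pos = ℚ.positive (ℕtoℚ-mono-< (ℕₚ.n≢0⇒n>0 (ℕ.≢-nonZero⁻¹ D)))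
    D-nonZero : ℚ.NonZero (ℕtoℚ D)
    D-nonZero = ℚₚ.pos⇒nonZero (ℕtoℚ D)

  abstract
    ρ : ℚ
    ρ = ℚ.1/ ℕtoℚ D

    ρ-inverse : ρ ⊛ ℕtoℚ D ≡ 1ℚ
    ρ-inverse = ℚₚ.*-inverseˡ (ℕtoℚ D)

    ρ-pos : ℚ.Positive ρ
    ρ-pos = ℚₚ.1/pos⇒pos (ℕtoℚ D)

  private instance
    ρ-positive : ℚ.Positive ρ
    ρ-positive = ρ-pos
    ρ-nonNegative : ℚ.NonNegative ρ
    ρ-nonNegative = ℚₚ.pos⇒nonNeg ρ

  scale : ∀ {n} → (Fin n → ℕ) → Point n
  scale X k = ρ ⊛ ℕtoℚ (X k)

  scale-≤ : ∀ {m} → m ≤ D → ρ ⊛ ℕtoℚ m ≤ᵣ 1ℚ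
  scale-≤ {m} h = subst (ρ ⊛ ℕtoℚ m ≤ᵣ_) ρ-inverse (ℚₚ.*-monoˡ-≤-nonNeg ρ (ℕtoℚ-mono h))

  scale-≤⁻¹ : ∀ {m} → ρ ⊛ ℕtoℚ m ≤ᵣ 1ℚ → m ≤ D
  scale-≤⁻¹ {m} h = ℕₚ.≮⇒≥ λ D<m → ℚₚ.<-irrefl refl (ℚₚ.<-≤-trans
    (subst (_<ᵣ ρ ⊛ ℕtoℚ m) ρ-inverse (ℚₚ.*-monoʳ-<-pos ρ (ℕtoℚ-mono-< D<m))) h)

  scale-0⁻¹ : ∀ m → ρ ⊛ ℕtoℚ m ≡ 0ℚ → m ≡ 0
  scale-0⁻¹ zero    _ = refl
  scale-0⁻¹ (suc m) e = contradiction (subst (_<ᵣ ρ ⊛ ℕtoℚ (suc m)) (ℚₚ.*-zeroʳ ρ)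
    (ℚₚ.*-monoʳ-<-pos ρ (ℕtoℚ-mono-< {0} {suc m} (s≤s z≤n)))) (ℚₚ.<-irrefl (sym e))

  scale-∑ : ∀ {n} (b : Fin n → Bool) X → ∑ (λ k → mask (b k) (scale X k)) ≡ ρ ⊛ ℕtoℚ (∑ℕ λ k → maskℕ (b k) (X k))
  scale-∑ {zero}  b X = sym (ℚₚ.*-zeroʳ ρ)
  scale-∑ {suc n} b X = trans (cong₂ _⊕_ (head (b Fin.zero)) (scale-∑ (b ∘ Fin.suc) (X ∘ Fin.suc)))
    (trans (sym (ℚₚ.*-distribˡ-+ ρ (ℕtoℚ h) (ℕtoℚ t))) (cong (ρ ⊛_) (sym (ℕtoℚ-+ h t))))
    where
    h t : ℕ
    h = maskℕ (b Fin.zero) (X Fin.zero)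
    t = ∑ℕ λ k → maskℕ (b (Fin.suc k)) (X (Fin.suc k))
    head : ∀ b → mask b (scale X Fin.zero) ≡ ρ ⊛ ℕtoℚ (maskℕ b (X Fin.zero))
    head true  = refl
    head false = sym (ℚₚ.*-zeroʳ ρ)

  polyℕ⇒poly : ∀ {n} {c : Colouring n} {X} → Polyℕ c D X → Poly c (scale X)
  polyℕ⇒poly {c = c} {X} Q = record
    { nonneg = λ i → subst (_≤ᵣ ρ ⊛ ℕtoℚ (X i)) (ℚₚ.*-zeroʳ ρ) (ℚₚ.*-monoˡ-≤-nonNeg ρ (ℕtoℚ-≥0 (X i)))
    ; total  = trans (scale-∑ (λ _ → true) X) (trans (cong (λ m → ρ ⊛ ℕtoℚ m) (totalℕ Q))
        (trans (cong (ρ ⊛_) (ℕtoℚ-+ D D)) (trans (ℚₚ.*-distribˡ-+ ρ (ℕtoℚ D) (ℕtoℚ D)) (cong₂ _⊕_ ρ-inverse ρ-inverse))))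
    ; loops  = λ i e → trans (cong (λ m → ρ ⊛ ℕtoℚ m) (loopsℕ Q i e)) (ℚₚ.*-zeroʳ ρ)
    ; le1    = λ i → scale-≤ (leℕ Q i)
    ; class  = λ i 2≤ → subst (_≤ᵣ 1ℚ) (sym (scale-∑ (λ k → does (c k ℕ.≟ c i)) X)) (scale-≤ (classℕ Q i 2≤))
    }

  poly⇒loopsℕ : ∀ {n} {c : Colouring n} {X} → Poly c (scale X) → ∀ i → c i ≡ 0 → X i ≡ 0
  poly⇒loopsℕ {X = X} Q i e = scale-0⁻¹ (X i) (loops Q i e)

  poly⇒classℕ : ∀ {n} {c : Colouring n} {X} → Poly c (scale X) → ∀ i → 2 ≤ c i → classSumℕ c X (c i) ≤ D
  poly⇒classℕ {c = c} {X} Q i 2≤ = scale-≤⁻¹ (subst (_≤ᵣ 1ℚ) (scale-∑ (λ k → does (c k ℕ.≟ c i)) X) (class Q i 2≤))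

∑ℕ-*ˡ : ∀ {n} a (f : Fin n → ℕ) → ∑ℕ (λ k → a * f k) ≡ a * ∑ℕ f
∑ℕ-*ˡ {zero}  a f = sym (ℕₚ.*-zeroʳ a)
∑ℕ-*ˡ {suc n} a f = trans (cong (a * f Fin.zero +_) (∑ℕ-*ˡ a (f ∘ Fin.suc))) (sym (ℕₚ.*-distribˡ-+ a (f Fin.zero) (∑ℕ (f ∘ Fin.suc))))

-- No term can have slack. Applied to indicators, this turns an inclusion between sets of equal size
-- into equality.
∑ℕ-tight : ∀ {n} {f g : Fin n → ℕ} → (∀ k → f k ≤ g k) → ∑ℕ g ≤ ∑ℕ f → ∀ k → g k ≤ f k
∑ℕ-tight {suc n} {f} {g} f≤g h Fin.zero = ℕₚ.+-cancelʳ-≤ (∑ℕ (g ∘ Fin.suc)) (g Fin.zero) (f Fin.zero)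
  (ℕₚ.≤-trans h (ℕₚ.+-monoʳ-≤ (f Fin.zero) (∑ℕ-mono (f≤g ∘ Fin.suc))))
∑ℕ-tight {suc n} {f} {g} f≤g h (Fin.suc k) = ∑ℕ-tight (f≤g ∘ Fin.suc)
  (ℕₚ.+-cancelˡ-≤ (g Fin.zero) _ _ (ℕₚ.≤-trans h (ℕₚ.+-monoˡ-≤ (∑ℕ (f ∘ Fin.suc)) (f≤g Fin.zero)))) k

-- Test points with ℓ zero coordinates: two heavy coordinates 2 + α and 2 + β, all other
-- coordinates 2, divided by D = 2m + 2.  A class of size q + 1 containing only the first heavy
-- coordinate is tight exactly when α = 2 (m - q).
module TestPoint (ℓ m : ℕ) where

  n D : ℕ
  n = ℓ + (2 + m)
  -- Half of the coordinate sum 2(2 + m) + 2m, as the scaled coordinates must add up to 2.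
  D = 2 * m + 2

  private instance
    D-nonZero : ℕ.NonZero D
    D-nonZero = ℕ.>-nonZero (ℕₚ.≤-trans (s≤s z≤n) (ℕₚ.m≤n+m 2 (2 * m)))

  open Scaled D {{D-nonZero}} public

  -- The first and the last nonzero coordinate: for `q ≤ m` the class of `block ℓ (ℓ + suc q)`
  -- contains `a` and misses `b`.
  a b : Fin n
  a = ℓ ↑ʳ Fin.zero
  b = ℓ ↑ʳ fromℕ (suc m)

  toℕ-a : toℕ a ≡ ℓ
  toℕ-a = trans (Finₚ.toℕ-↑ʳ ℓ (Fin.zero {suc m})) (ℕₚ.+-identityʳ ℓ)

  toℕ-b : toℕ b ≡ ℓ + suc m
  toℕ-b = trans (Finₚ.toℕ-↑ʳ ℓ (fromℕ (suc m))) (cong (ℓ +_) (Finₚ.toℕ-fromℕ (suc m)))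

  floor : Fin n → ℕ
  floor k = if does (toℕ k ℕ.<? ℓ) then 0 else 2

  X : ℕ → ℕ → Fin n → ℕ
  X α β k = floor k + (α * hit (k Fin.≟ a) + β * hit (k Fin.≟ b))

  floor-sum : ∑ℕ floor ≡ 2 * (2 + m)
  floor-sum = go ℓ
    where
    twos : ∀ j → ∑ℕ {j} (λ _ → 2) ≡ 2 * j
    twos zero    = refl
    twos (suc j) = trans (cong (2 +_) (twos j)) (sym (ℕₚ.*-suc 2 j))
    go : ∀ ℓ → ∑ℕ {ℓ + (2 + m)} (λ k → if does (toℕ k ℕ.<? ℓ) then 0 else 2) ≡ 2 * (2 + m)
    go zero    = twos (2 + m)
    go (suc ℓ) = go ℓ

  floor-high : ∀ {k} → ℓ ≤ toℕ k → floor k ≡ 2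
  floor-high {k} h = cong (λ b → if b then 0 else 2) (dec-false (toℕ k ℕ.<? ℓ) (ℕₚ.≤⇒≯ h))

  zero-coords : ∑ℕ {n} (λ k → hit (toℕ k ℕ.<? ℓ)) ≡ ℓ
  zero-coords = go ℓ
    where
    go : ∀ ℓ → ∑ℕ {ℓ + (2 + m)} (λ k → hit (toℕ k ℕ.<? ℓ)) ≡ ℓ
    go zero    = ∑ℕ-zero {2 + m} λ _ → refl
    go (suc ℓ) = cong suc (go ℓ)

  module Heavy {α β} (α+β : α + β ≡ 2 * m) where

    X-total : ∑ℕ (X α β) ≡ D + D
    X-total = begin
      ∑ℕ (X α β)
        ≡⟨ ∑ℕ-distrib-+ floor (λ k → α * hit (k Fin.≟ a) + β * hit (k Fin.≟ b)) ⟩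
      ∑ℕ floor + ∑ℕ (λ k → α * hit (k Fin.≟ a) + β * hit (k Fin.≟ b))
        ≡⟨ cong₂ _+_ floor-sum (trans (∑ℕ-distrib-+ (λ k → α * hit (k Fin.≟ a)) (λ k → β * hit (k Fin.≟ b)))
             (cong₂ _+_ (weighted α a) (weighted β b))) ⟩
      2 * (2 + m) + (α + β)
        ≡⟨ cong (2 * (2 + m) +_) α+β ⟩
      2 * (2 + m) + 2 * m
        ≡⟨ solve 1 (λ m → con 2 :* (con 2 :+ m) :+ con 2 :* m := (con 2 :* m :+ con 2) :+ (con 2 :* m :+ con 2)) refl m ⟩
      D + D ∎
      where
      open ≡-Reasoning
      open ℕ-Solver
      weighted : ∀ w i → ∑ℕ (λ k → w * hit (k Fin.≟ i)) ≡ w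
      weighted w i = trans (∑ℕ-*ˡ w (λ k → hit (k Fin.≟ i))) (trans (cong (w *_) (∑ℕ-point i)) (ℕₚ.*-identityʳ w))

    X-≤ : ∀ k → X α β k ≤ D
    X-≤ k = subst (X α β k ≤_) (ℕₚ.+-comm 2 (2 * m)) (ℕₚ.+-mono-≤ (floor≤2 (does (toℕ k ℕ.<? ℓ)))
      (subst (α * hit (k Fin.≟ a) + β * hit (k Fin.≟ b) ≤_) α+β (ℕₚ.+-mono-≤ (part α (k Fin.≟ a)) (part β (k Fin.≟ b)))))
      where
      floor≤2 : ∀ b → (if b then 0 else 2) ≤ 2
      floor≤2 true  = z≤n
      floor≤2 false = ℕₚ.≤-refl
      part : ∀ {A : Set} w (a? : Dec A) → w * hit a? ≤ w
      part w (yes _) = ℕₚ.≤-reflexive (ℕₚ.*-identityʳ w)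
      part w (no _)  = ℕₚ.≤-trans (ℕₚ.≤-reflexive (ℕₚ.*-zeroʳ w)) z≤n

    X-low : ∀ k → toℕ k < ℓ → X α β k ≡ 0
    X-low k k<ℓ = cong₂ _+_ (cong (λ b → if b then 0 else 2) (dec-true (toℕ k ℕ.<? ℓ) k<ℓ))
      (cong₂ _+_ (vanish α a (ℕₚ.≤-reflexive (sym toℕ-a)))
                 (vanish β b (subst (ℓ ≤_) (sym toℕ-b) (ℕₚ.m≤m+n ℓ (suc m)))))
      where
      vanish : ∀ w i → ℓ ≤ toℕ i → w * hit (k Fin.≟ i) ≡ 0
      vanish w i ℓ≤i = trans (cong (w *_) (hit-false (k Fin.≟ i) λ { refl → ℕₚ.<⇒≱ k<ℓ ℓ≤i })) (ℕₚ.*-zeroʳ w)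

    X-zero⁻¹ : ∀ k → X α β k ≡ 0 → toℕ k < ℓ
    X-zero⁻¹ k e with toℕ k ℕ.<? ℓ
    ... | yes p = p
    ... | no ¬p = contradiction (trans (sym (cong (_+ (α * hit (k Fin.≟ a) + β * hit (k Fin.≟ b))) (floor-high (ℕₚ.≮⇒≥ ¬p)))) e) λ ()

    zero-hits : ∀ k → hit (X α β k ℕ.≟ 0) ≡ hit (toℕ k ℕ.<? ℓ)
    zero-hits k = same (X α β k ℕ.≟ 0) (toℕ k ℕ.<? ℓ) (X-zero⁻¹ k) (X-low k)
      where
      same : ∀ {A B : Set} (a? : Dec A) (b? : Dec B) → (A → B) → (B → A) → hit a? ≡ hit b?
      same (yes a) b? f g = sym (hit-true b? (f a))
      same (no ¬a) b? f g = sym (hit-false b? (¬a ∘ g))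

    module _ (σ : Fin n → Fin n) (inv : ∀ (f : Fin n → ℕ) → ∑ℕ (f ∘ σ) ≡ ∑ℕ f) where

      zeros : ∑ℕ (λ k → hit (X α β (σ k) ℕ.≟ 0)) ≡ ℓ
      zeros = trans (inv (λ k → hit (X α β k ℕ.≟ 0))) (trans (∑ℕ-cong zero-hits) zero-coords)

      loops-≤ : ∀ (c : Colouring n) → (∀ i → c i ≡ 0 → X α β (σ i) ≡ 0) → ∀ k → hit (c k ℕ.≟ 0) ≤ hit (X α β (σ k) ℕ.≟ 0)
      loops-≤ c h k = le (c k ℕ.≟ 0) (X α β (σ k) ℕ.≟ 0) (h k)
        where
        le : ∀ {A B : Set} (a? : Dec A) (b? : Dec B) → (A → B) → hit a? ≤ hit b?
        le (yes a) b? f = ℕₚ.≤-reflexive (sym (hit-true b? (f a)))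
        le (no _)  b? f = z≤n

      -- The loops have to sit on zero coordinates of the permuted point, and it has exactly ℓ of
      -- them.
      loops-few : ∀ (c : Colouring n) → (∀ i → c i ≡ 0 → X α β (σ i) ≡ 0) → count c 0 ≤ ℓ
      loops-few c h = subst (count c 0 ≤_) zeros (∑ℕ-mono (loops-≤ c h))

      -- Exactly ℓ loops fill all zero coordinates, so no nonloop can sit on one.
      nonloops : ∀ (c : Colouring n) → count c 0 ≡ ℓ → (∀ i → c i ≡ 0 → X α β (σ i) ≡ 0) →
                 ∀ k → c k ≢ 0 → ℓ ≤ toℕ (σ k)
      nonloops c e h k ck≢0 = ℕₚ.≮⇒≥ λ σk<ℓ → contradiction
        (subst₂ _≤_ (hit-true (X α β (σ k) ℕ.≟ 0) (X-low (σ k) σk<ℓ)) (hit-false (c k ℕ.≟ 0) ck≢0)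
          (∑ℕ-tight (loops-≤ c h) (ℕₚ.≤-reflexive (trans zeros (sym e))) k)) λ ()

      A B : Colouring n → ℕ
      A c = ∑ℕ λ k → maskℕ (does (c k ℕ.≟ 2)) (hit (σ k Fin.≟ a))
      B c = ∑ℕ λ k → maskℕ (does (c k ℕ.≟ 2)) (hit (σ k Fin.≟ b))

      -- Each class element carries the floor 2; `A c` and `B c` record whether the heavy
      -- coordinates fall into the class.
      class-sum : ∀ (c : Colouring n) → (∀ k → c k ≢ 0 → ℓ ≤ toℕ (σ k)) →
                  classSumℕ c (X α β ∘ σ) 2 ≡ 2 * count c 2 + (α * A c + β * B c)
      class-sum c high = begin
        ∑ℕ (λ k → maskℕ (does (c k ℕ.≟ 2)) (X α β (σ k)))
          ≡⟨ ∑ℕ-cong (λ k → term (c k ℕ.≟ 2) k λ e → high k λ e′ → contradiction (trans (sym e) e′) λ ()) ⟩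
        ∑ℕ (λ k → 2 * hit (c k ℕ.≟ 2) + (α * Aₖ k + β * Bₖ k))
          ≡⟨ trans (∑ℕ-distrib-+ (λ k → 2 * hit (c k ℕ.≟ 2)) (λ k → α * Aₖ k + β * Bₖ k))
               (cong (∑ℕ (λ k → 2 * hit (c k ℕ.≟ 2)) +_) (∑ℕ-distrib-+ (λ k → α * Aₖ k) (λ k → β * Bₖ k))) ⟩
        ∑ℕ (λ k → 2 * hit (c k ℕ.≟ 2)) + (∑ℕ (λ k → α * Aₖ k) + ∑ℕ (λ k → β * Bₖ k))
          ≡⟨ cong₂ _+_ (∑ℕ-*ˡ 2 (λ k → hit (c k ℕ.≟ 2))) (cong₂ _+_ (∑ℕ-*ˡ α Aₖ) (∑ℕ-*ˡ β Bₖ)) ⟩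
        2 * count c 2 + (α * A c + β * B c) ∎
        where
        open ≡-Reasoning
        Aₖ Bₖ : Fin n → ℕ
        Aₖ k = maskℕ (does (c k ℕ.≟ 2)) (hit (σ k Fin.≟ a))
        Bₖ k = maskℕ (does (c k ℕ.≟ 2)) (hit (σ k Fin.≟ b))
        term : ∀ {P : Set} (p? : Dec P) k → (P → ℓ ≤ toℕ (σ k)) → maskℕ (does p?) (X α β (σ k)) ≡
          2 * hit p? + (α * maskℕ (does p?) (hit (σ k Fin.≟ a)) + β * maskℕ (does p?) (hit (σ k Fin.≟ b)))
        term (yes p) k h = cong (_+ (α * hit (σ k Fin.≟ a) + β * hit (σ k Fin.≟ b))) (floor-high (h p))
        term (no _)  k h = sym (cong₂ _+_ (ℕₚ.*-zeroʳ α) (ℕₚ.*-zeroʳ β))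

      mask-≤ℕ : ∀ b m → maskℕ b m ≤ m
      mask-≤ℕ true  m = ℕₚ.≤-refl
      mask-≤ℕ false m = z≤n

      heavy-≤1 : ∀ (c : Colouring n) i → ∑ℕ (λ k → maskℕ (does (c k ℕ.≟ 2)) (hit (σ k Fin.≟ i))) ≤ 1
      heavy-≤1 c i = subst (∑ℕ (λ k → maskℕ (does (c k ℕ.≟ 2)) (hit (σ k Fin.≟ i))) ≤_)
        (trans (inv (λ k → hit (k Fin.≟ i))) (∑ℕ-point i)) (∑ℕ-mono λ k → mask-≤ℕ (does (c k ℕ.≟ 2)) _)

      module _ {q} (q≤m : q ≤ m) where

        S : Colouring n
        S = block ℓ (ℓ + suc q)

        fits : ℓ + suc q ≤ n
        fits = ℕₚ.+-monoʳ-≤ ℓ (s≤s (ℕₚ.≤-trans q≤m (ℕₚ.n≤1+n m)))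

        S-loops : count S 0 ≡ ℓ
        S-loops = count-block-0 n ℓ (suc q) (ℕₚ.m≤m+n ℓ (2 + m))

        S-class : count S 2 ≡ suc q
        S-class = count-block-2 n ℓ (suc q) fits

        load : ℕ
        load = 2 * suc q + (α * A S + β * B S)

        -- The remaining conditions hold for all α + β = 2m, so membership depends on the place of
        -- the loops and on one number, the load of the class.
        to-poly : (∀ i → S i ≡ 0 → X α β (σ i) ≡ 0) → load ≤ D → Poly S (scale (X α β ∘ σ))
        to-poly h load≤ = polyℕ⇒poly record
          { totalℕ = trans (inv (X α β)) X-total
          ; loopsℕ = h
          ; leℕ    = X-≤ ∘ σ
          ; classℕ = λ i 2≤ → subst (_≤ D)
              (trans (cong (λ p → 2 * p + (α * A S + β * B S)) (sym S-class))
                (trans (sym (class-sum S (nonloops S S-loops h)))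
                  (cong (classSumℕ S (X α β ∘ σ)) (ℕₚ.≤-antisym 2≤ (block-≤2 ℓ (ℓ + suc q) i))))) load≤
          }

        from-poly : Poly S (scale (X α β ∘ σ)) → (∀ i → S i ≡ 0 → X α β (σ i) ≡ 0) × load ≤ D
        from-poly Q with count-attained S 2 (subst (0 <_) (sym S-class) (s≤s z≤n))
        ... | i , Si≡2 = h , subst (_≤ D)
          (trans (cong (classSumℕ S (X α β ∘ σ)) Si≡2)
            (trans (class-sum S (nonloops S S-loops h)) (cong (λ p → 2 * p + (α * A S + β * B S)) S-class)))
          (poly⇒classℕ {c = S} {X α β ∘ σ} Q i (ℕₚ.≤-reflexive (sym Si≡2)))
          where
          h : ∀ i → S i ≡ 0 → X α β (σ i) ≡ 0
          h = poly⇒loopsℕ Q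

-- Moving one unit of weight from the second heavy coordinate to the first changes the
-- feasibility of a class of size q + 1 only when q = k + 1.
module _ (k s q : ℕ) where

  open ℕ-Solver

  private
    cap : ℕ
    cap = 2 * (suc k + s) + 2
    -- Loads for the heavy weights (2s, 2(k + 1)) and (2s + 1, 2k + 1); `A` and `B` say which heavy
    -- coordinates the class contains.
    before after : ℕ → ℕ → ℕ
    before A B = 2 * suc q + (2 * s * A + 2 * suc k * B)
    after  A B = 2 * suc q + (suc (2 * s) * A + suc (2 * k) * B)

    none : before 0 0 ≡ after 0 0
    none = solve 3 (λ k s q →
      con 2 :* (con 1 :+ q) :+ (con 2 :* s :* con 0 :+ con 2 :* (con 1 :+ k) :* con 0) :=
      con 2 :* (con 1 :+ q) :+ ((con 1 :+ con 2 :* s) :* con 0 :+ (con 1 :+ con 2 :* k) :* con 0)) refl k s q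

    both : before 1 1 ≡ after 1 1
    both = solve 3 (λ k s q →
      con 2 :* (con 1 :+ q) :+ (con 2 :* s :* con 1 :+ con 2 :* (con 1 :+ k) :* con 1) :=
      con 2 :* (con 1 :+ q) :+ ((con 1 :+ con 2 :* s) :* con 1 :+ (con 1 :+ con 2 :* k) :* con 1)) refl k s q

    first : after 1 0 ≡ suc (before 1 0)
    first = solve 3 (λ k s q →
      con 2 :* (con 1 :+ q) :+ ((con 1 :+ con 2 :* s) :* con 1 :+ (con 1 :+ con 2 :* k) :* con 0) :=
      con 1 :+ (con 2 :* (con 1 :+ q) :+ (con 2 :* s :* con 1 :+ con 2 :* (con 1 :+ k) :* con 0))) refl k s q

    second : before 0 1 ≡ suc (after 0 1)
    second = solve 3 (λ k s q →
      con 2 :* (con 1 :+ q) :+ (con 2 :* s :* con 0 :+ con 2 :* (con 1 :+ k) :* con 1) :=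
      con 1 :+ (con 2 :* (con 1 :+ q) :+ ((con 1 :+ con 2 :* s) :* con 0 :+ (con 1 :+ con 2 :* k) :* con 1))) refl k s q

    before-first : before 1 0 ≡ 2 * q + (2 * s + 2)
    before-first = solve 3 (λ k s q →
      con 2 :* (con 1 :+ q) :+ (con 2 :* s :* con 1 :+ con 2 :* (con 1 :+ k) :* con 0) :=
      con 2 :* q :+ (con 2 :* s :+ con 2)) refl k s q

    before-second : before 0 1 ≡ 2 * q + (2 * k + 4)
    before-second = solve 3 (λ k s q →
      con 2 :* (con 1 :+ q) :+ (con 2 :* s :* con 0 :+ con 2 :* (con 1 :+ k) :* con 1) :=
      con 2 :* q :+ (con 2 :* k :+ con 4)) refl k s q

    cap-first : cap ≡ 2 * suc k + (2 * s + 2)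
    cap-first = solve 2 (λ k s → con 2 :* (con 1 :+ k :+ s) :+ con 2 := con 2 :* (con 1 :+ k) :+ (con 2 :* s :+ con 2)) refl k s

    cap-second : cap ≡ 2 * s + (2 * k + 4)
    cap-second = solve 2 (λ k s → con 2 :* (con 1 :+ k :+ s) :+ con 2 := con 2 :* s :+ (con 2 :* k :+ con 4)) refl k s

    halve : ∀ {p p′ t x y} → x ≡ 2 * p + t → y ≡ 2 * p′ + t → x ≤ y → p ≤ p′
    halve {p} {p′} {t} refl refl h = ℕₚ.*-cancelˡ-≤ 2 (ℕₚ.+-cancelʳ-≤ t (2 * p) (2 * p′) h)

    double : ∀ {p p′ t x y} → x ≡ 2 * p + t → y ≡ 2 * p′ + t → p ≤ p′ → x ≤ y
    double {t = t} refl refl h = ℕₚ.+-monoˡ-≤ t (ℕₚ.*-monoʳ-≤ 2 h)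

  -- Only a class with the first heavy coordinate alone gains a unit. Its old load and `cap` are
  -- even, so it overflows only from equality, which means q = k + 1.
  before⇒after : ∀ {A B} → A ≤ 1 → B ≤ 1 → q ≢ suc k → before A B ≤ cap → after A B ≤ cap
  before⇒after {0} {0} _ _ _  h = subst (_≤ cap) none h
  before⇒after {1} {1} _ _ _  h = subst (_≤ cap) both h
  before⇒after {0} {1} _ _ _  h = ℕₚ.≤-trans (ℕₚ.n≤1+n (after 0 1)) (subst (_≤ cap) second h)
  before⇒after {1} {0} _ _ q≢ h = subst (_≤ cap) (sym first) (ℕₚ.≤-trans
    (ℕₚ.≤-trans (ℕₚ.≤-reflexive (cong suc before-first)) (ℕₚ.≤-trans (ℕₚ.n≤1+n _)
      (ℕₚ.≤-reflexive (solve 2 (λ q t → con 2 :+ (con 2 :* q :+ t) := con 2 :* (con 1 :+ q) :+ t) refl q (2 * s + 2)))))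
    (double refl cap-first (ℕₚ.≤∧≢⇒< (halve before-first cap-first h) q≢)))
  before⇒after {suc (suc _)} (s≤s ())
  before⇒after {_} {suc (suc _)} _ (s≤s ())

  -- Only a class with the second heavy coordinate alone was heavier before, by one unit; as its old
  -- load and `cap` are even, a load of cap + 1 cannot occur.
  after⇒before : ∀ {A B} → A ≤ 1 → B ≤ 1 → after A B ≤ cap → before A B ≤ cap
  after⇒before {0} {0} _ _ h = subst (_≤ cap) (sym none) h
  after⇒before {1} {1} _ _ h = subst (_≤ cap) (sym both) h
  after⇒before {1} {0} _ _ h = ℕₚ.≤-trans (ℕₚ.n≤1+n (before 1 0)) (subst (_≤ cap) first h)
  after⇒before {0} {1} _ _ h = double before-second cap-second (ℕₚ.≤-pred (ℕₚ.*-cancelˡ-< 2 q (suc s)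
    (ℕₚ.+-cancelʳ-≤ (2 * k + 4) (suc (2 * q)) (2 * suc s) (ℕₚ.≤-trans
      (ℕₚ.≤-reflexive (trans (cong suc (sym before-second)) (cong suc second)))
      (ℕₚ.≤-trans (s≤s (s≤s h)) (ℕₚ.≤-reflexive (trans (cong (2 +_) cap-second)
        (solve 2 (λ s t → con 2 :+ (con 2 :* s :+ t) := con 2 :* (con 1 :+ s) :+ t) refl s (2 * k + 4)))))))))
  after⇒before {suc (suc _)} (s≤s ())
  after⇒before {_} {suc (suc _)} _ (s≤s ())

  before-tight : q ≡ suc k → before 1 0 ≡ cap
  before-tight refl = trans before-first (sym cap-first)

  after-tight : q ≡ suc k → after 1 0 ≡ suc cap
  after-tight e = trans first (cong suc (before-tight e))

-- Separating the Schubert matroids with ℓ loops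

module Separation (ℓ m : ℕ) where

  open TestPoint ℓ m

  permInv : All (λ σ → ∀ (f : Fin n → ℕ) → ∑ℕ (f ∘ lookup σ) ≡ ∑ℕ f) (perms n)
  permInv = perms-∑ℕ n

  testPoint : ℕ → ℕ → Point n
  testPoint α β = scale (X α β)

  schubSum : ℕ → Point n → ℚ
  schubSum q x = symInd (block ℓ (ℓ + suc q)) x

  -- More than ℓ loops would need more than ℓ zero coordinates, whatever the permutation.
  more-loops : ∀ {α β} → α + β ≡ 2 * m → ∀ {ℓ′ p} → ℓ < ℓ′ → ℓ′ ≤ n →
               symInd (block ℓ′ (ℓ′ + p)) (testPoint α β) ≡ 0ℚ
  more-loops {α} {β} e {ℓ′} {p} ℓ<ℓ′ ℓ′≤n = sumOver-zero (All.map (λ {σ} inv → indicator-false λ Q →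
    ℕₚ.<⇒≱ ℓ<ℓ′ (subst (_≤ ℓ) (count-block-0 n ℓ′ p ℓ′≤n)
      (Heavy.loops-few {α} {β} e (lookup σ) inv (block ℓ′ (ℓ′ + p)) (poly⇒loopsℕ Q)))) permInv)

  idσ : Vec (Fin n) n
  idσ = proj₁ (perms-id n)
  idσ∈ : idσ ∈ᴸ perms n
  idσ∈ = proj₁ (proj₂ (perms-id n))
  idσ≡ : ∀ k → lookup idσ k ≡ k
  idσ≡ = proj₂ (proj₂ (perms-id n))
  id-inv : ∀ (f : Fin n → ℕ) → ∑ℕ (f ∘ lookup idσ) ≡ ∑ℕ f
  id-inv f = ∑ℕ-cong (cong f ∘ idσ≡)

  ∑ℕ-pick : ∀ (b : Fin n → Bool) i → ∑ℕ (λ k → maskℕ (b k) (hit (k Fin.≟ i))) ≡ maskℕ (b i) 1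
  ∑ℕ-pick b i = trans (∑ℕ-cong λ k → move (b k) (b i) (k Fin.≟ i) (cong b))
    (trans (∑ℕ-*ˡ (maskℕ (b i) 1) (λ k → hit (k Fin.≟ i)))
      (trans (cong (maskℕ (b i) 1 *_) (∑ℕ-point i)) (ℕₚ.*-identityʳ (maskℕ (b i) 1))))
    where
    move : ∀ u v {A : Set} (a? : Dec A) → (A → u ≡ v) → maskℕ u (hit a?) ≡ maskℕ v 1 * hit a?
    move u     v (yes p) f = trans (cong (λ b → maskℕ b 1) (f p)) (sym (ℕₚ.*-identityʳ (maskℕ v 1)))
    move true  v (no _)  f = sym (ℕₚ.*-zeroʳ (maskℕ v 1))
    move false v (no _)  f = sym (ℕₚ.*-zeroʳ (maskℕ v 1))

  module AtId {q} (q≤m : q ≤ m) {α β} (e : α + β ≡ 2 * m) where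

    open Heavy {α} {β} e

    S-id : Colouring n
    S-id = S (lookup idσ) id-inv q≤m

    Sa : S-id a ≡ 2
    Sa with block ℓ (ℓ + suc q) a | blockView ℓ (ℓ + suc q) a
    ... | _ | loop a<ℓ      = contradiction a<ℓ (ℕₚ.≤⇒≯ (ℕₚ.≤-reflexive (sym toℕ-a)))
    ... | _ | inClass _ _   = refl
    ... | _ | single _ e≤a  = contradiction e≤a (ℕₚ.<⇒≱ (subst₂ _<_ (sym toℕ-a) refl (ℕₚ.m<m+n ℓ (s≤s z≤n))))

    Sb : S-id b ≢ 2
    Sb with block ℓ (ℓ + suc q) b | blockView ℓ (ℓ + suc q) b
    ... | _ | loop _        = λ ()
    ... | _ | inClass _ b<e = contradiction (ℕₚ.+-monoʳ-≤ ℓ (s≤s q≤m)) (ℕₚ.<⇒≱ (subst (_< ℓ + suc q) toℕ-b b<e))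
    ... | _ | single _ _    = λ ()

    A≡1 : A (lookup idσ) id-inv S-id ≡ 1
    A≡1 = trans (∑ℕ-cong λ k → cong (λ j → maskℕ (does (S-id k ℕ.≟ 2)) (hit (j Fin.≟ a))) (idσ≡ k))
      (trans (∑ℕ-pick (λ k → does (S-id k ℕ.≟ 2)) a) (cong (λ b → maskℕ b 1) (dec-true (S-id a ℕ.≟ 2) Sa)))

    B≡0 : B (lookup idσ) id-inv S-id ≡ 0
    B≡0 = trans (∑ℕ-cong λ k → cong (λ j → maskℕ (does (S-id k ℕ.≟ 2)) (hit (j Fin.≟ b))) (idσ≡ k))
      (trans (∑ℕ-pick (λ k → does (S-id k ℕ.≟ 2)) b) (cong (λ b → maskℕ b 1) (dec-false (S-id b ℕ.≟ 2) Sb)))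

    load≡ : load (lookup idσ) id-inv q≤m ≡ 2 * suc q + (α * 1 + β * 0)
    load≡ = cong₂ (λ A B → 2 * suc q + (α * A + β * B)) A≡1 B≡0

    id-loops : ∀ i → S-id i ≡ 0 → X α β (lookup idσ i) ≡ 0
    id-loops i Si≡0 = trans (cong (X α β) (idσ≡ i)) (X-low i (low Si≡0))
      where
      low : S-id i ≡ 0 → toℕ i < ℓ
      low e with block ℓ (ℓ + suc q) i | blockView ℓ (ℓ + suc q) i
      ... | _ | loop i<ℓ = i<ℓ

  module _ (k s : ℕ) (m≡ : suc k + s ≡ m) where

    tight shifted : Point n
    tight   = testPoint (2 * s) (2 * suc k)
    shifted = testPoint (suc (2 * s)) (suc (2 * k))

    tight-sum : 2 * s + 2 * suc k ≡ 2 * m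
    tight-sum = trans (solve 2 (λ k s → con 2 :* s :+ con 2 :* (con 1 :+ k) := con 2 :* (con 1 :+ k :+ s)) refl k s) (cong (2 *_) m≡)
      where open ℕ-Solver

    shifted-sum : suc (2 * s) + suc (2 * k) ≡ 2 * m
    shifted-sum = trans (solve 2 (λ k s → (con 1 :+ con 2 :* s) :+ (con 1 :+ con 2 :* k) := con 2 :* (con 1 :+ k :+ s)) refl k s) (cong (2 *_) m≡)
      where open ℕ-Solver

    cap≡ : 2 * (suc k + s) + 2 ≡ D
    cap≡ = cong (λ m → 2 * m + 2) m≡

    module H = Heavy {2 * s} {2 * suc k} tight-sum
    module H′ = Heavy {suc (2 * s)} {suc (2 * k)} shifted-sum

    module _ {q} (q≤m : q ≤ m) {σ : Vec (Fin n) n} (inv : ∀ (f : Fin n → ℕ) → ∑ℕ (f ∘ lookup σ) ≡ ∑ℕ f) where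

      private
        S : Colouring n
        S = block ℓ (ℓ + suc q)
        A≤1 : H.A (lookup σ) inv S ≤ 1
        A≤1 = H.heavy-≤1 (lookup σ) inv S a
        B≤1 : H.B (lookup σ) inv S ≤ 1
        B≤1 = H.heavy-≤1 (lookup σ) inv S b

      shifted⇒tight : Poly S (shifted ∘ lookup σ) → Poly S (tight ∘ lookup σ)
      shifted⇒tight Q = let loops′ , load≤ = H′.from-poly (lookup σ) inv q≤m Q in
        H.to-poly (lookup σ) inv q≤m
          (λ i Si≡0 → H.X-low (lookup σ i) (H′.X-zero⁻¹ (lookup σ i) (loops′ i Si≡0)))
          (subst (H.load (lookup σ) inv q≤m ≤_) cap≡ (after⇒before k s q A≤1 B≤1
            (subst (H′.load (lookup σ) inv q≤m ≤_) (sym cap≡) load≤)))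

      tight⇒shifted : q ≢ suc k → Poly S (tight ∘ lookup σ) → Poly S (shifted ∘ lookup σ)
      tight⇒shifted q≢ Q = let loops′ , load≤ = H.from-poly (lookup σ) inv q≤m Q in
        H′.to-poly (lookup σ) inv q≤m
          (λ i Si≡0 → H′.X-low (lookup σ i) (H.X-zero⁻¹ (lookup σ i) (loops′ i Si≡0)))
          (subst (H′.load (lookup σ) inv q≤m ≤_) cap≡ (before⇒after k s q A≤1 B≤1 q≢
            (subst (H.load (lookup σ) inv q≤m ≤_) (sym cap≡) load≤)))

    schubSum-other : ∀ {q} → q ≤ m → q ≢ suc k → schubSum q tight ≡ schubSum q shifted
    schubSum-other q≤m q≢ = sumOver-congᴬ (All.map
      (λ {σ} inv → indicator-cong (tight⇒shifted q≤m {σ} inv q≢) (shifted⇒tight q≤m {σ} inv)) permInv)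

    -- No term grows on passing from `tight` to `shifted`, and the identity term drops from 1 to 0:
    -- there the class contains `a` but not `b`, and its load rises from `D` to D + 1.
    schubSum-jump : schubSum (suc k) shifted <ᵣ schubSum (suc k) tight
    schubSum-jump = sumOver-< (All.map (λ {σ} inv → indicator-mono (shifted⇒tight q≤m {σ} inv)) permInv) idσ∈
      (subst₂ _<ᵣ_ (sym (indicator-false not-shifted)) (sym (indicator-true in-tight)) 0<1)
      where
      q≤m : suc k ≤ m
      q≤m = subst (suc k ≤_) m≡ (ℕₚ.m≤m+n (suc k) s)
      module I = AtId q≤m {2 * s} {2 * suc k} tight-sum
      module I′ = AtId q≤m {suc (2 * s)} {suc (2 * k)} shifted-sum
      in-tight : Poly (block ℓ (ℓ + suc (suc k))) (tight ∘ lookup idσ)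
      in-tight = H.to-poly (lookup idσ) id-inv q≤m I.id-loops
        (ℕₚ.≤-reflexive (trans I.load≡ (trans (before-tight k s (suc k) refl) cap≡)))
      not-shifted : ¬ Poly (block ℓ (ℓ + suc (suc k))) (shifted ∘ lookup idσ)
      not-shifted Q = ℕₚ.<⇒≱ (ℕₚ.n<1+n D) (subst (_≤ D)
        (trans I′.load≡ (trans (after-tight k s (suc k) refl) (cong suc cap≡)))
        (proj₂ (H′.from-poly (lookup idσ) id-inv q≤m Q)))

  uniform : Point n
  uniform = testPoint (2 * m) 0

  uniform-sum : 2 * m + 0 ≡ 2 * m
  uniform-sum = ℕₚ.+-identityʳ (2 * m)

  -- Jumps reach only sizes with q = k + 1, and q = 0 has no class condition to violate. Once the
  -- other coefficients vanish, one point with a positive value is enough.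
  schubSum-0 : 0ℚ <ᵣ schubSum 0 uniform
  schubSum-0 = subst (_<ᵣ schubSum 0 uniform) (sumOver-zero (All.map (λ _ → refl) permInv))
    (sumOver-< (All.map (λ {σ} _ → indicator-≥0 (block ℓ (ℓ + 1)) (uniform ∘ lookup σ)) permInv) idσ∈
      (subst (0ℚ <ᵣ_) (sym (indicator-true in-uniform)) 0<1))
    where
    module I = AtId z≤n {2 * m} {0} uniform-sum
    in-uniform : Poly (block ℓ (ℓ + 1)) (uniform ∘ lookup idσ)
    in-uniform = Heavy.to-poly {2 * m} {0} uniform-sum (lookup idσ) id-inv z≤n I.id-loops (ℕₚ.≤-reflexive (trans I.load≡
      (solve 1 (λ m → con 2 :+ (con 2 :* m :* con 1 :+ con 0) := con 2 :* m :+ con 2) refl m)))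
      where open ℕ-Solver

-- Eliminating coefficients block by block

schubVal : ∀ {n} → Point n → ℕ × ℕ → ℚ
schubVal x p = symInd (block (proj₁ p ∸ 1) (proj₂ p ∸ 1)) x

-- Puts ℓ loops in front: the pairs of `sigma n` with at least ℓ loops are the raised pairs of
-- `sigma (n ∸ ℓ)`.
raise : ℕ → ℕ × ℕ → ℕ × ℕ
raise ℓ p = ℓ + proj₁ p , ℓ + proj₂ p

-- A block lists its class sizes in decreasing order, so counting from its end gives `q`, the size
-- minus 1.
position : ∀ {r} → Fin r → ℕ
position k = toℕ (Fin.opposite k)

position-injective : ∀ {r} {j k : Fin r} → position j ≡ position k → j ≡ k
position-injective {j = j} {k} e = trans (sym (Finₚ.opposite-involutive j))
  (trans (cong Fin.opposite (Finₚ.toℕ-injective e)) (Finₚ.opposite-involutive k))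

tailPairs-lookup : ∀ r k → lookup (tailPairs r) k ≡ (1 , position k + 2)
tailPairs-lookup (suc r) Fin.zero    = cong (1 ,_) (trans (sym (ℕₚ.+-suc r 1)) (cong (_+ 2) (sym (Finₚ.toℕ-fromℕ r))))
tailPairs-lookup (suc r) (Fin.suc k) = trans (tailPairs-lookup r k)
  (cong (λ p → 1 , p + 2) (sym (Finₚ.toℕ-inject₁ (Fin.opposite k))))

sigma-shape : ∀ n k → ∃ λ j → ∃ λ q → lookup (sigma n) k ≡ (1 + j , q + (2 + j)) × q + (2 + j) ≤ n
sigma-shape (suc n) = by-split (tri n)
  (λ k → let j , q , e , h = sigma-shape n k in suc j , q ,
    trans (sigma-↑ˡ n k) (trans (cong shiftPair e) (cong (2 + j ,_) (sym (ℕₚ.+-suc q (2 + j))))) ,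
    subst (_≤ suc n) (sym (ℕₚ.+-suc q (2 + j))) (s≤s h))
  (λ k → 0 , position k , trans (sigma-↑ʳ n k) (tailPairs-lookup n k) ,
    subst (_≤ suc n) (ℕₚ.+-comm 2 (position k)) (s≤s (Finₚ.toℕ<n (Fin.opposite k))))

schubVal-raise : ∀ {n} (x : Point n) ℓ j q →
  schubVal x (raise ℓ (1 + j , q + (2 + j))) ≡ symInd (block (ℓ + j) (ℓ + j + suc q)) x
schubVal-raise {n} x ℓ j q = cong₂ (λ a b → symInd {n} (block (a ∸ 1) (b ∸ 1)) x) (ℕₚ.+-suc ℓ j)
  (solve 3 (λ ℓ j q → ℓ :+ (q :+ (con 2 :+ j)) := con 1 :+ (ℓ :+ j :+ (con 1 :+ q))) refl ℓ j q)
  where open ℕ-Solver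

module LastBlock (ℓ m : ℕ) (d : Point (tri (2 + m)))
  (vanish : ∀ (x : Point (ℓ + (2 + m))) → ∑ (λ k → d k ⊛ schubVal x (raise ℓ (lookup (sigma (2 + m)) k))) ≡ 0ℚ) where

  open TestPoint ℓ m using (n)
  open Separation ℓ m

  bot : Point (suc m)
  bot k = d (tri (suc m) ↑ʳ k)

  -- All blocks except the last have more than ℓ loops and vanish at a point with ℓ zero
  -- coordinates.
  restricted : ∀ {α β} → α + β ≡ 2 * m → ∑ (λ k → bot k ⊛ schubSum (position k) (testPoint α β)) ≡ 0ℚ
  restricted {α} {β} e = begin
    ∑ (λ k → bot k ⊛ schubSum (position k) x)
      ≡⟨ ∑-cong (λ k → cong (bot k ⊛_) (last k)) ⟨
    ∑ (λ k → bot k ⊛ g (lookup (tailPairs (suc m)) k))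
      ≡⟨ ℚₚ.+-identityˡ (∑ (λ k → bot k ⊛ g (lookup (tailPairs (suc m)) k))) ⟨
    0ℚ ⊕ ∑ (λ k → bot k ⊛ g (lookup (tailPairs (suc m)) k))
      ≡⟨ cong (_⊕ ∑ (λ k → bot k ⊛ g (lookup (tailPairs (suc m)) k))) (∑-zero λ k →
           trans (cong (d (k ↑ˡ suc m) ⊛_) (earlier k)) (ℚₚ.*-zeroʳ (d (k ↑ˡ suc m)))) ⟨
    ∑ (λ k → d (k ↑ˡ suc m) ⊛ g (shiftPair (lookup (sigma (suc m)) k))) ⊕
    ∑ (λ k → bot k ⊛ g (lookup (tailPairs (suc m)) k))
      ≡⟨ sigma-sum (suc m) d g ⟨
    ∑ (λ k → d k ⊛ g (lookup (sigma (2 + m)) k))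
      ≡⟨ vanish x ⟩
    0ℚ ∎
    where
    open ≡-Reasoning
    x : Point n
    x = testPoint α β
    g : ℕ × ℕ → ℚ
    g p = schubVal x (raise ℓ p)
    last : ∀ k → g (lookup (tailPairs (suc m)) k) ≡ schubSum (position k) x
    last k = trans (cong g (tailPairs-lookup (suc m) k)) (trans (schubVal-raise x ℓ 0 (position k))
      (cong (λ l → symInd {n} (block l (l + suc (position k))) x) (ℕₚ.+-identityʳ ℓ)))
    earlier : ∀ k → g (shiftPair (lookup (sigma (suc m)) k)) ≡ 0ℚ
    earlier k with lookup (sigma (suc m)) k | sigma-shape (suc m) k
    ... | _ | j , q , refl , h = trans
      (trans (cong (λ b → g (2 + j , b)) (sym (ℕₚ.+-suc q (2 + j)))) (schubVal-raise x ℓ (suc j) q))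
      (more-loops {α} {β} e {ℓ + suc j} {suc q} (ℕₚ.m<m+n ℓ (s≤s z≤n)) (ℕₚ.+-monoʳ-≤ ℓ
        (s≤s (ℕₚ.≤-trans (ℕₚ.≤-trans (ℕₚ.m≤n+m j 2) (ℕₚ.m≤n+m (2 + j) q)) h))))

  -- Subtracting the relations at the two neighbouring points leaves one term, whose factor is
  -- nonzero by `schubSum-jump`.
  bot-later : ∀ κ k → position k ≡ suc κ → bot k ≡ 0ℚ
  bot-later κ k pk = product-zero diff-zero λ e →
    ℚₚ.<-irrefl (sym (difference-zero e)) (subst (λ q → schubSum q xₖ′ <ᵣ schubSum q xₖ) (sym pk) (schubSum-jump κ s m≡))
    where
    s : ℕ
    s = m ∸ suc κ
    m≡ : suc κ + s ≡ m
    m≡ = ℕₚ.m+[n∸m]≡n (ℕₚ.≤-pred (subst (_< suc m) pk (Finₚ.toℕ<n (Fin.opposite k))))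
    xₖ xₖ′ : Point n
    xₖ  = tight κ s m≡
    xₖ′ = shifted κ s m≡
    h h′ : Fin (suc m) → ℚ
    h  j = schubSum (position j) xₖ
    h′ j = schubSum (position j) xₖ′
    difference-zero : ∀ {p q} → p ⊖ q ≡ 0ℚ → p ≡ q
    difference-zero {p} {q} e = trans (solve 2 (λ p q → p := (p :- q) :+ q) refl p q)
      (trans (cong (_⊕ q) e) (ℚₚ.+-identityˡ q))
      where open ℚ-Solver
    distribute : ∀ p q r → p ⊛ (q ⊖ r) ≡ p ⊛ q ⊖ p ⊛ r
    distribute = solve 3 (λ p q r → p :* (q :- r) := p :* q :- p :* r) refl
      where open ℚ-Solver
    diff-zero : bot k ⊛ (h k ⊖ h′ k) ≡ 0ℚ
    diff-zero = begin
      bot k ⊛ (h k ⊖ h′ k)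
        ≡⟨ ∑-single {f = λ j → bot j ⊛ (h j ⊖ h′ j)} k (λ j j≢k → trans
             (cong (λ v → bot j ⊛ (v ⊖ h′ j)) (schubSum-other κ s m≡
               (ℕₚ.≤-pred (Finₚ.toℕ<n (Fin.opposite j))) λ pj → j≢k (position-injective (trans pj (sym pk)))))
             (trans (cong (bot j ⊛_) (ℚₚ.+-inverseʳ (h′ j))) (ℚₚ.*-zeroʳ (bot j)))) ⟨
      ∑ (λ j → bot j ⊛ (h j ⊖ h′ j))
        ≡⟨ ∑-cong (λ j → distribute (bot j) (h j) (h′ j)) ⟩
      ∑ (λ j → bot j ⊛ h j ⊖ bot j ⊛ h′ j)
        ≡⟨ ∑-⊖ (λ j → bot j ⊛ h j) (λ j → bot j ⊛ h′ j) ⟩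
      ∑ (λ j → bot j ⊛ h j) ⊖ ∑ (λ j → bot j ⊛ h′ j)
        ≡⟨ cong₂ _⊖_ (restricted {2 * s} {2 * suc κ} (tight-sum κ s m≡))
             (restricted {suc (2 * s)} {suc (2 * κ)} (shifted-sum κ s m≡)) ⟩
      0ℚ ∎
      where open ≡-Reasoning

  bot-first : ∀ k → position k ≡ 0 → bot k ≡ 0ℚ
  bot-first k pk = product-zero
    (trans (sym (∑-single {f = λ j → bot j ⊛ schubSum (position j) uniform} k λ j j≢k → trans
      (cong (_⊛ schubSum (position j) uniform) (others j j≢k (position j) refl)) (ℚₚ.*-zeroˡ (schubSum (position j) uniform))))
      (restricted {2 * m} {0} uniform-sum))
    λ e → ℚₚ.<-irrefl (sym e) (subst (λ q → 0ℚ <ᵣ schubSum q uniform) (sym pk) schubSum-0)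
    where
    others : ∀ j → j ≢ k → ∀ q → position j ≡ q → bot j ≡ 0ℚ
    others j j≢k zero    pj = contradiction (position-injective (trans pj (sym pk))) j≢k
    others j j≢k (suc κ) pj = bot-later κ j pj

  bot-zero : ∀ k → bot k ≡ 0ℚ
  bot-zero k = go (position k) refl
    where
    go : ∀ q → position k ≡ q → bot k ≡ 0ℚ
    go zero    = bot-first k
    go (suc κ) = bot-later κ k

  top-vanish : ∀ (x : Point n) →
    ∑ (λ k → d (k ↑ˡ suc m) ⊛ schubVal x (raise (suc ℓ) (lookup (sigma (suc m)) k))) ≡ 0ℚ
  top-vanish x = begin
    ∑ (λ k → d (k ↑ˡ suc m) ⊛ schubVal x (raise (suc ℓ) (lookup (sigma (suc m)) k)))
      ≡⟨ ∑-cong (λ k → cong (λ p → d (k ↑ˡ suc m) ⊛ schubVal x p) (sym (raise-shift (lookup (sigma (suc m)) k)))) ⟩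
    ∑ (λ k → d (k ↑ˡ suc m) ⊛ schubVal x (raise ℓ (shiftPair (lookup (sigma (suc m)) k))))
      ≡⟨ ℚₚ.+-identityʳ (∑ (λ k → d (k ↑ˡ suc m) ⊛ schubVal x (raise ℓ (shiftPair (lookup (sigma (suc m)) k))))) ⟨
    ∑ (λ k → d (k ↑ˡ suc m) ⊛ schubVal x (raise ℓ (shiftPair (lookup (sigma (suc m)) k)))) ⊕ 0ℚ
      ≡⟨ cong (∑ (λ k → d (k ↑ˡ suc m) ⊛ schubVal x (raise ℓ (shiftPair (lookup (sigma (suc m)) k)))) ⊕_)
           (∑-zero λ k → trans (cong (_⊛ schubVal x (raise ℓ (lookup (tailPairs (suc m)) k))) (bot-zero k))
             (ℚₚ.*-zeroˡ (schubVal x (raise ℓ (lookup (tailPairs (suc m)) k))))) ⟨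
    ∑ (λ k → d (k ↑ˡ suc m) ⊛ schubVal x (raise ℓ (shiftPair (lookup (sigma (suc m)) k)))) ⊕
    ∑ (λ k → bot k ⊛ schubVal x (raise ℓ (lookup (tailPairs (suc m)) k)))
      ≡⟨ sigma-sum (suc m) d (λ p → schubVal x (raise ℓ p)) ⟨
    ∑ (λ k → d k ⊛ schubVal x (raise ℓ (lookup (sigma (2 + m)) k)))
      ≡⟨ vanish x ⟩
    0ℚ ∎
    where
    open ≡-Reasoning
    raise-shift : ∀ p → raise ℓ (shiftPair p) ≡ raise (suc ℓ) p
    raise-shift (a , b) = cong₂ _,_ (ℕₚ.+-suc ℓ a) (ℕₚ.+-suc ℓ b)

-- Induction over the blocks: the coefficients with exactly ℓ loops vanish first, which leaves the
-- same relation for ℓ + 1. As `tri 0` and `tri 1` are 0, those sizes have no coefficients.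
schubert-independent : ∀ n′ ℓ {n} → ℓ + n′ ≡ n → (d : Point (tri n′)) →
  (∀ (x : Point n) → ∑ (λ k → d k ⊛ schubVal x (raise ℓ (lookup (sigma n′) k))) ≡ 0ℚ) → ∀ k → d k ≡ 0ℚ
schubert-independent (suc (suc m)) ℓ refl d vanish = by-split (tri (suc m))
  (schubert-independent (suc m) (suc ℓ) (sym (ℕₚ.+-suc ℓ (suc m))) (λ k → d (k ↑ˡ suc m)) (LastBlock.top-vanish ℓ m d vanish))
  (LastBlock.bot-zero ℓ m d vanish)

-- Matroids and colourings

pairSet : ∀ {n} → Fin n → Fin n → Subset n
pairSet i j = Vec.tabulate λ k → ⌊ k Fin.≟ i ⌋ ∨ ⌊ k Fin.≟ j ⌋

lookup-pairSet : ∀ {n} (i j k : Fin n) → lookup (pairSet i j) k ≡ ⌊ k Fin.≟ i ⌋ ∨ ⌊ k Fin.≟ j ⌋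
lookup-pairSet i j k = Vecₚ.lookup∘tabulate _ k

subInd-pairSet : ∀ {n} (i j k : Fin n) → subInd (pairSet i j) k ≡ pairInd i j k
subInd-pairSet i j k = cong (λ b → if b then 1ℚ else 0ℚ) (lookup-pairSet i j k)

lookup-ext : ∀ {n} {A : Set} {u v : Vec A n} → (∀ k → lookup u k ≡ lookup v k) → u ≡ v
lookup-ext {u = u} {v} e = trans (sym (Vecₚ.tabulate∘lookup u)) (trans (Vecₚ.tabulate-cong e) (Vecₚ.tabulate∘lookup v))

pairSet-comm : ∀ {n} (i j : Fin n) → pairSet i j ≡ pairSet j i
pairSet-comm i j = Vecₚ.tabulate-cong λ k → ∨-comm ⌊ k Fin.≟ i ⌋ ⌊ k Fin.≟ j ⌋

∈-pairSetˡ : ∀ {n} (i j : Fin n) → i ∈ pairSet i j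
∈-pairSetˡ i j = Vecₚ.lookup⇒[]= i (pairSet i j) (trans (lookup-pairSet i j i) here-i)
  where
  here-i : ⌊ i Fin.≟ i ⌋ ∨ ⌊ i Fin.≟ j ⌋ ≡ true
  here-i with i Fin.≟ i
  ... | yes _  = refl
  ... | no i≢i = contradiction refl i≢i

∈-pairSetʳ : ∀ {n} (i j : Fin n) → j ∈ pairSet i j
∈-pairSetʳ i j = subst (j ∈_) (pairSet-comm j i) (∈-pairSetˡ j i)

∈-pairSet⁻ : ∀ {n} {i j k : Fin n} → k ∈ pairSet i j → k ≡ i ⊎ k ≡ j
∈-pairSet⁻ {i = i} {j} {k} k∈ = cases (trans (sym (lookup-pairSet i j k)) (Vecₚ.[]=⇒lookup k∈))
  where
  cases : ⌊ k Fin.≟ i ⌋ ∨ ⌊ k Fin.≟ j ⌋ ≡ true → k ≡ i ⊎ k ≡ j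
  cases e with k Fin.≟ i | k Fin.≟ j
  ... | yes k≡i | _       = inj₁ k≡i
  ... | no _    | yes k≡j = inj₂ k≡j
  cases () | no _ | no _

bit : Bool → ℕ
bit b = if b then 1 else 0

card-∑ : ∀ {n} (B : Subset n) → ∣ B ∣ ≡ ∑ℕ (λ k → bit (lookup B k))
card-∑ []          = refl
card-∑ (true ∷ B)  = cong suc (card-∑ B)
card-∑ (false ∷ B) = card-∑ B

bit-pair : ∀ {n} {i j : Fin n} → i ≢ j → ∀ k → bit (lookup (pairSet i j) k) ≡ hit (k Fin.≟ i) + hit (k Fin.≟ j)
bit-pair {i = i} {j} i≢j k = trans (cong bit (lookup-pairSet i j k)) (go (k Fin.≟ i) (k Fin.≟ j) λ { refl refl → i≢j refl })
  where
  go : ∀ {A B : Set} (a? : Dec A) (b? : Dec B) → (A → ¬ B) → bit (⌊ a? ⌋ ∨ ⌊ b? ⌋) ≡ hit a? + hit b?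
  go (yes a) (yes b) ex = contradiction b (ex a)
  go (yes _) (no _)  _  = refl
  go (no _)  (yes _) _  = refl
  go (no _)  (no _)  _  = refl

pair-sum : ∀ {n} (i j : Fin n) → ∑ℕ (λ k → hit (k Fin.≟ i) + hit (k Fin.≟ j)) ≡ 2
pair-sum i j = trans (∑ℕ-distrib-+ (λ k → hit (k Fin.≟ i)) (λ k → hit (k Fin.≟ j))) (cong₂ _+_ (∑ℕ-point i) (∑ℕ-point j))

card-pairSet : ∀ {n} {i j : Fin n} → i ≢ j → ∣ pairSet i j ∣ ≡ 2
card-pairSet {i = i} {j} i≢j = trans (card-∑ (pairSet i j)) (trans (∑ℕ-cong (bit-pair i≢j)) (pair-sum i j))

card-singleton : ∀ {n} (i : Fin n) → ∣ pairSet i i ∣ ≡ 1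
card-singleton i = trans (card-∑ (pairSet i i)) (trans (∑ℕ-cong λ k → trans (cong bit (lookup-pairSet i i k)) (go (k Fin.≟ i))) (∑ℕ-point i))
  where
  go : ∀ {A : Set} (a? : Dec A) → bit (⌊ a? ⌋ ∨ ⌊ a? ⌋) ≡ hit a?
  go (yes _) = refl
  go (no _)  = refl

-- Two distinct members give a pair inside `B`; both sets have two elements, so `∑ℕ-tight` makes
-- them equal.
card-2⇒pair : ∀ {n} (B : Subset n) → ∣ B ∣ ≡ 2 → ∃ λ i → ∃ λ j → i ≢ j × B ≡ pairSet i j
card-2⇒pair {n} B card with Finₚ.any? (λ i → lookup B i Boolₚ.≟ true)
... | no none = contradiction (trans (sym (trans (card-∑ B) (∑ℕ-zero λ k → off (lookup B k) λ e → none (k , e)))) card) λ ()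
  where
  off : ∀ b → b ≢ true → bit b ≡ 0
  off true  f = contradiction refl f
  off false f = refl
... | yes (i , Bi) with Finₚ.any? (λ j → lookup B j Boolₚ.≟ true ×-dec ¬? (j Fin.≟ i))
...   | no none = contradiction (subst₂ _≤_ (trans (sym (card-∑ B)) card) (∑ℕ-point i)
        (∑ℕ-mono λ k → le (lookup B k) (k Fin.≟ i) λ Bk k≢i → none (k , Bk , k≢i))) λ { (s≤s ()) }
  where
  le : ∀ {A : Set} b (a? : Dec A) → (b ≡ true → ¬ ¬ A) → bit b ≤ hit a?
  le false a?     f = z≤n
  le true (yes _) f = s≤s z≤n
  le true (no ¬a) f = contradiction ¬a (f refl)
...   | yes (j , Bj , j≢i) = i , j , j≢i ∘ sym , lookup-ext λ k → bit-injective (lookup B k) (lookup (pairSet i j) k)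
        (trans (ℕₚ.≤-antisym (∑ℕ-tight below (ℕₚ.≤-reflexive (trans (trans (sym (card-∑ B)) card) (sym (pair-sum i j)))) k) (below k))
          (sym (bit-pair (j≢i ∘ sym) k)))
  where
  bit-injective : ∀ b b′ → bit b ≡ bit b′ → b ≡ b′
  bit-injective true  true  _ = refl
  bit-injective false false _ = refl
  below : ∀ k → hit (k Fin.≟ i) + hit (k Fin.≟ j) ≤ bit (lookup B k)
  below k = go (k Fin.≟ i) (k Fin.≟ j) (λ { refl refl → j≢i refl }) (λ { refl → Bi }) (λ { refl → Bj })
    where
    go : ∀ {P Q : Set} {b} (p? : Dec P) (q? : Dec Q) → (P → ¬ Q) → (P → b ≡ true) → (Q → b ≡ true) → hit p? + hit q? ≤ bit b
    go (yes p) (yes q) ex _ _ = contradiction q (ex p)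
    go (yes p) (no _)  _  f _ = ℕₚ.≤-reflexive (cong bit (sym (f p)))
    go (no _)  (yes q) _  _ g = ℕₚ.≤-reflexive (cong bit (sym (g q)))
    go (no _)  (no _)  _  _ _ = z≤n

swap-pairSet : ∀ {n} {x y z : Fin n} → x ≢ y → (pairSet y x [ x ]≔ outside) [ z ]≔ inside ≡ pairSet y z
swap-pairSet {x = x} {y} {z} x≢y = lookup-ext λ k → trans (at k) (sym (lookup-pairSet y z k))
  where
  at : ∀ k → lookup ((pairSet y x [ x ]≔ outside) [ z ]≔ inside) k ≡ ⌊ k Fin.≟ y ⌋ ∨ ⌊ k Fin.≟ z ⌋
  at k with k Fin.≟ z
  ... | yes refl = trans (Vecₚ.lookup∘update z (pairSet y x [ x ]≔ outside) inside) (sym (∨-zeroʳ ⌊ z Fin.≟ y ⌋))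
  ... | no k≢z = trans (Vecₚ.lookup∘update′ k≢z (pairSet y x [ x ]≔ outside) inside)
    (trans (inner (k Fin.≟ x)) (sym (∨-identityʳ ⌊ k Fin.≟ y ⌋)))
    where
    inner : Dec (k ≡ x) → lookup (pairSet y x [ x ]≔ outside) k ≡ ⌊ k Fin.≟ y ⌋
    inner (yes refl) = trans (Vecₚ.lookup∘update k (pairSet y x) outside) off
      where
      off : false ≡ ⌊ k Fin.≟ y ⌋
      off with k Fin.≟ y
      ... | yes k≡y = contradiction k≡y x≢y
      ... | no _    = refl
    inner (no k≢x) = trans (Vecₚ.lookup∘update′ k≢x (pairSet y x) outside) (trans (lookup-pairSet y x k) off)
      where
      off : ⌊ k Fin.≟ y ⌋ ∨ ⌊ k Fin.≟ x ⌋ ≡ ⌊ k Fin.≟ y ⌋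
      off with k Fin.≟ x
      ... | yes k≡x = contradiction k≡x k≢x
      ... | no _    = ∨-identityʳ ⌊ k Fin.≟ y ⌋

indep-sym : ∀ {n} {c : Colouring n} {i j} → Indep c i j → Indep c j i
indep-sym (i≢j , ci , cj , sep) = i≢j ∘ sym , cj , ci , λ e → trans e (sep (sym e))

-- Being equal or in a common class is transitive among nonloops, so `y` cannot depend on both `k`
-- and `l`.
indep-exchange : ∀ {n} {c : Colouring n} {y k l} → c y ≢ 0 → Indep c k l → Indep c y k ⊎ Indep c y l
indep-exchange {c = c} {y} {k} {l} cy (k≢l , ck , cl , sep) with indep? c y k | indep? c y l
... | yes p | _     = inj₁ p
... | no _  | yes p = inj₂ p
... | no p  | no q  with parallel ck p | parallel cl q
  where
  parallel : ∀ {j} → c j ≢ 0 → ¬ Indep c y j → y ≡ j ⊎ (c y ≡ c j × c y ≢ 1)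
  parallel {j} cj dep with y Fin.≟ j | c y ℕ.≟ c j | c y ℕ.≟ 1
  ... | yes e | _      | _       = inj₁ e
  ... | no _  | yes e  | no cy≢1 = inj₂ (e , cy≢1)
  ... | no ne | no ce  | _       = contradiction (ne , cy , cj , λ e → contradiction e ce) dep
  ... | no ne | _      | yes cy1 = contradiction (ne , cy , cj , λ _ → cy1) dep
...   | inj₁ refl        | inj₁ refl     = contradiction refl k≢l
...   | inj₁ refl        | inj₂ (e , n1) = contradiction (sep e) n1
...   | inj₂ (e , n1)    | inj₁ refl     = contradiction (trans e (sep (sym e))) n1
...   | inj₂ (e , n1)    | inj₂ (e′ , _) = contradiction (trans e (sep (trans (sym e) e′))) n1

_≐_ : ∀ {n} → (Point n → Set) → (Point n → Set) → Set
P ≐ Q = (∀ {y} → P y → Q y) × (∀ {y} → Q y → P y)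

module FromColouring {n} (c : Colouring n) {i₀ j₀} (ind₀ : Indep c i₀ j₀) where

  IsPair : Subset n → Set
  IsPair B = ∃ λ i → ∃ λ j → Indep c i j × B ≡ pairSet i j

  isPair? : ∀ B → Dec (IsPair B)
  isPair? B = Finₚ.any? λ i → Finₚ.any? λ j → indep? c i j ×-dec Vecₚ.≡-dec Boolₚ._≟_ B (pairSet i j)

  exchangePair : ∀ {x y k l} → Indep c x y → Indep c k l → x ∉ pairSet k l →
    ∃ λ z → z ∈ pairSet k l × z ∉ pairSet y x × IsPair ((pairSet y x [ x ]≔ outside) [ z ]≔ inside)
  exchangePair {x} {y} {k} {l} (x≢y , _ , cy , _) kl x∉ with indep-exchange cy kl
  ... | inj₁ yk = k , ∈-pairSetˡ k l , (λ k∈ → [ (λ e → proj₁ yk (sym e)) , (λ { refl → x∉ (∈-pairSetˡ k l) }) ]′ (∈-pairSet⁻ k∈)) ,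
    y , k , yk , swap-pairSet x≢y
  ... | inj₂ yl = l , ∈-pairSetʳ k l , (λ l∈ → [ (λ e → proj₁ yl (sym e)) , (λ { refl → x∉ (∈-pairSetʳ k l) }) ]′ (∈-pairSet⁻ l∈)) ,
    y , l , yl , swap-pairSet x≢y

  exchange′ : ∀ B₁ B₂ → IsPair B₁ → IsPair B₂ → ∀ x → x ∈ B₁ → x ∉ B₂ →
    ∃ λ z → z ∈ B₂ × z ∉ B₁ × IsPair ((B₁ [ x ]≔ outside) [ z ]≔ inside)
  exchange′ _ _ (i , j , ij , refl) (k , l , kl , refl) x x∈ x∉ with ∈-pairSet⁻ x∈
  ... | inj₂ refl = exchangePair (indep-sym ij) kl x∉
  ... | inj₁ refl = subst (λ B → ∃ λ z → z ∈ pairSet k l × z ∉ B × IsPair ((B [ x ]≔ outside) [ z ]≔ inside))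
    (pairSet-comm j i) (exchangePair ij kl x∉)

  matroid : Matroid2 n
  matroid = record
    { isBasis  = λ B → ⌊ isPair? B ⌋
    ; rank2    = λ B b → let i , j , ij , e = toWitness {a? = isPair? B} b in trans (cong ∣_∣ e) (card-pairSet (proj₁ ij))
    ; nonempty = pairSet i₀ j₀ , fromWitness {a? = isPair? (pairSet i₀ j₀)} (i₀ , j₀ , ind₀ , refl)
    ; exchange = λ B₁ B₂ b₁ b₂ x x∈ x∉ →
        let z , z∈ , z∉ , p = exchange′ B₁ B₂ (toWitness {a? = isPair? B₁} b₁) (toWitness {a? = isPair? B₂} b₂) x x∈ x∉ in
        z , z∈ , z∉ , fromWitness {a? = isPair? ((B₁ [ x ]≔ outside) [ z ]≔ inside)} p
    }

  vertices : MatVert matroid ≐ Vert c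
  vertices =
    (λ { (B , b , y≡) → let i , j , ij , e = toWitness {a? = isPair? B} b in
         i , j , ij , λ k → trans (y≡ k) (trans (cong (λ B → subInd B k) e) (subInd-pairSet i j k)) }) ,
    (λ { (i , j , ij , y≡) → pairSet i j , fromWitness {a? = isPair? (pairSet i j)} (i , j , ij , refl) ,
         λ k → trans (y≡ k) (sym (subInd-pairSet i j k)) })

-- The parallel classes of a matroid

first : ∀ {n} → (Fin n → Bool) → ℕ
first {zero}  f = 0
first {suc n} f = if f Fin.zero then 0 else suc (first (f ∘ Fin.suc))

first-cong : ∀ {n} {f g : Fin n → Bool} → (∀ k → f k ≡ g k) → first f ≡ first g
first-cong {zero}  e = refl
first-cong {suc n} e = cong₂ (λ b m → if b then 0 else suc m) (e Fin.zero) (first-cong (e ∘ Fin.suc))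

first-≤ : ∀ {n} (f : Fin n → Bool) → first f ≤ n
first-≤ {zero}  f = z≤n
first-≤ {suc n} f with f Fin.zero
... | true  = z≤n
... | false = s≤s (first-≤ (f ∘ Fin.suc))

first-true : ∀ {n} (f : Fin n → Bool) k → f k ≡ true → ∃ λ j → f j ≡ true × toℕ j ≡ first f
first-true {suc n} f k fk with f Fin.zero in f0
... | true = Fin.zero , f0 , refl
first-true {suc n} f Fin.zero    fk | false = contradiction (trans (sym fk) f0) λ ()
first-true {suc n} f (Fin.suc k) fk | false with first-true (f ∘ Fin.suc) k fk
... | j , fj , e = Fin.suc j , fj , cong suc e

module FromMatroid {n} (M : Matroid2 n) where

  Adj : Fin n → Fin n → Set
  Adj i j = T (isBasis M (pairSet i j))

  adj? : ∀ i j → Dec (Adj i j)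
  adj? i j = T? (isBasis M (pairSet i j))

  adj-sym : ∀ {i j} → Adj i j → Adj j i
  adj-sym {i} {j} = subst (T ∘ isBasis M) (pairSet-comm i j)

  adj-irrefl : ∀ {i} → ¬ Adj i i
  adj-irrefl {i} a = contradiction (trans (sym (rank2 M (pairSet i i) a)) (card-singleton i)) λ ()

  adj⇒≢ : ∀ {i j} → Adj i j → i ≢ j
  adj⇒≢ a refl = adj-irrefl a

  NonLoop : Fin n → Set
  NonLoop i = ∃ (Adj i)

  nonLoop? : ∀ i → Dec (NonLoop i)
  nonLoop? i = Finₚ.any? (adj? i)

  -- Suppose {i, m} is a basis. For a partner k′ of `k` outside it, exchanging k′ in {k, k′} yields
  -- {k, i} or {k, m}. That `k` is a nonloop matters, since a loop is adjacent to nothing.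
  nonadj-trans : ∀ {i k m} → NonLoop k → ¬ Adj i k → ¬ Adj k m → ¬ Adj i m
  nonadj-trans {i} {k} {m} (k′ , kk′) ¬ik ¬km im with k′ Fin.≟ i | k′ Fin.≟ m
  ... | yes refl | _ = ¬ik (adj-sym kk′)
  ... | no _ | yes refl = ¬km kk′
  ... | no k′≢i | no k′≢m with exchange M (pairSet k k′) (pairSet i m) kk′ im k′ (∈-pairSetʳ k k′)
          (λ k′∈ → [ k′≢i , k′≢m ]′ (∈-pairSet⁻ k′∈))
  ...   | y , y∈ , _ , b = [ (λ { refl → ¬ik (adj-sym ky) }) , (λ { refl → ¬km ky }) ]′ (∈-pairSet⁻ y∈)
    where
    ky : Adj k y
    ky = subst (T ∘ isBasis M) (swap-pairSet (adj⇒≢ kk′ ∘ sym)) b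

  -- Without the condition on `j`, a loop would pass as parallel to every element.
  parallel? : ∀ i j → Dec (NonLoop j × ¬ Adj i j)
  parallel? i j = nonLoop? j ×-dec ¬? (adj? i j)

  representative : Fin n → ℕ
  representative i = first λ j → ⌊ parallel? i j ⌋

  -- A class gets 2 plus the index of its least element. Singleton classes also receive such a
  -- colour, and colour 1 does not occur; their sizes are neutralized by the truncated `∸ 1` in the
  -- expansion.
  colour : Colouring n
  colour i = if ⌊ nonLoop? i ⌋ then 2 + representative i else 0

  bounded : ∀ i → colour i < 2 + suc n
  bounded i with nonLoop? i
  ... | yes _ = s≤s (s≤s (s≤s (first-≤ λ j → ⌊ parallel? i j ⌋)))
  ... | no _  = s≤s z≤n

  colour-nonLoop : ∀ {i} → NonLoop i → colour i ≡ 2 + representative i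
  colour-nonLoop {i} nl with nonLoop? i
  ... | yes _ = refl
  ... | no ¬l = contradiction nl ¬l

  nonLoop-colour : ∀ {i} → colour i ≢ 0 → NonLoop i
  nonLoop-colour {i} ci with nonLoop? i
  ... | yes nl = nl
  ... | no _   = contradiction refl ci

  representative-parallel : ∀ {i} → NonLoop i → ∃ λ f → NonLoop f × ¬ Adj i f × toℕ f ≡ representative i
  representative-parallel {i} nl with first-true (λ j → ⌊ parallel? i j ⌋) i (dec-yes (parallel? i i) (nl , adj-irrefl))
    where
    dec-yes : ∀ {A : Set} (a? : Dec A) → A → ⌊ a? ⌋ ≡ true
    dec-yes (yes _) _ = refl
    dec-yes (no ¬a) a = contradiction a ¬a
  ... | f , par , e = let nf , ¬if = toWitness {a? = parallel? i f} (subst T (sym par) tt) in f , nf , ¬if , e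

  ⌊⌋-cong : ∀ {A B : Set} (a? : Dec A) (b? : Dec B) → (A → B) → (B → A) → ⌊ a? ⌋ ≡ ⌊ b? ⌋
  ⌊⌋-cong (yes _) (yes _) _ _ = refl
  ⌊⌋-cong (yes a) (no ¬b) f _ = contradiction (f a) ¬b
  ⌊⌋-cong (no ¬a) (yes b) _ g = contradiction (g b) ¬a
  ⌊⌋-cong (no _)  (no _)  _ _ = refl

  -- Nonadjacent nonloops are parallel to the same elements, hence have the same representative;
  -- `sep` would then make a colour of at least 2 equal to 1.
  indep⇒adj : ∀ {i j} → Indep colour i j → Adj i j
  indep⇒adj {i} {j} (_ , ci , cj , sep) with adj? i j
  ... | yes a = a
  ... | no ¬a = contradiction (trans (sym (colour-nonLoop ni)) (sep same)) λ ()
    where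
    ni : NonLoop i
    ni = nonLoop-colour ci
    nj : NonLoop j
    nj = nonLoop-colour cj
    same : colour i ≡ colour j
    same = trans (colour-nonLoop ni) (trans (cong (λ m → 2 + m) (first-cong λ k → ⌊⌋-cong (parallel? i k) (parallel? j k)
      (λ { (nk , ¬ik) → nk , nonadj-trans ni (¬a ∘ adj-sym) ¬ik })
      (λ { (nk , ¬jk) → nk , nonadj-trans nj ¬a ¬jk }))) (sym (colour-nonLoop nj)))

  adj⇒indep : ∀ {i j} → Adj i j → Indep colour i j
  adj⇒indep {i} {j} a = adj⇒≢ a , coloured (j , a) , coloured (i , adj-sym a) , λ e → contradiction a (separate e)
    where
    coloured : ∀ {i} → NonLoop i → colour i ≢ 0
    coloured nl e = contradiction (trans (sym (colour-nonLoop nl)) e) λ ()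
    separate : colour i ≡ colour j → ¬ Adj i j
    separate e with representative-parallel (j , a) | representative-parallel (i , adj-sym a)
    ... | f , nf , ¬if , ef | g , _ , ¬jg , eg = nonadj-trans nf ¬if (subst (λ h → ¬ Adj h j) g≡f (¬jg ∘ adj-sym))
      where
      g≡f : g ≡ f
      g≡f = Finₚ.toℕ-injective (trans eg (trans (sym (ℕₚ.suc-injective (ℕₚ.suc-injective
        (trans (sym (colour-nonLoop (j , a))) (trans e (colour-nonLoop (i , adj-sym a))))))) (sym ef)))

  vertices : MatVert M ≐ Vert colour
  vertices =
    (λ { (B , b , y≡) → let i , j , i≢j , e = card-2⇒pair B (rank2 M B b) in
         i , j , adj⇒indep (subst (T ∘ isBasis M) e b) ,
         λ k → trans (y≡ k) (trans (cong (λ B → subInd B k) e) (subInd-pairSet i j k)) }) ,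
    (λ { (i , j , ij , y≡) → pairSet i j , indep⇒adj ij , λ k → trans (y≡ k) (sym (subInd-pairSet i j k)) })

  some-indep : ∃ λ i → ∃ λ j → Indep colour i j
  some-indep = let B , b = nonempty M ; i , j , _ , e = card-2⇒pair B (rank2 M B b) in
    i , j , adj⇒indep (subst (T ∘ isBasis M) e b)

-- Schubert expansions

schub-vertices : ∀ n k → schub n k ≐ Vert (block (proj₁ (lookup (sigma n) k) ∸ 1) (proj₂ (lookup (sigma n) k) ∸ 1))
schub-vertices n k = schub⇒vert n _ _ , vert⇒schub n _ _

normaliser : ℕ → ℚ
normaliser n = (ℤ.+ 1 ℚ./ (n !)) {{n !≢0}}

normaliser≢0 : ∀ n → normaliser n ≢ 0ℚ
normaliser≢0 n e = ℚₚ.<-irrefl (sym e) (ℚₚ.positive⁻¹ (normaliser n) {{ℚₚ.normalize-pos 1 (n !) {{n !≢0}}}})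

module _ {n} {P : Point n → Set} {c : Colouring n} (P≐ : P ≐ Vert c) where

  indVal-value : ∀ {z v} → IndVal P z v → v ≡ indicator c z
  indVal-value (inj₁ (h , v≡)) = trans v≡ (sym (indicator-true (hull⇒poly (hull-map id (proj₁ P≐) h))))
  indVal-value (inj₂ (¬h , v≡)) = trans v≡ (sym (indicator-false (¬h ∘ hull-map id (proj₂ P≐) ∘ poly⇒hull)))

  indVal-indicator : ∀ z → IndVal P z (indicator c z)
  indVal-indicator z with poly? c z
  ... | yes Q = inj₁ (hull-map id (proj₂ P≐) (poly⇒hull Q) , refl)
  ... | no ¬Q = inj₂ (¬Q ∘ hull⇒poly ∘ hull-map id (proj₁ P≐) , refl)

  symVal-value : ∀ {x q} → SymVal n P x q → q ≡ normaliser n ⊛ symInd c x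
  symVal-value {x} (vs , pw , q≡) = trans q≡ (cong (normaliser n ⊛_) (go pw))
    where
    go : ∀ {σs vs} → Pointwise (λ σ v → IndVal P (λ i → x (lookup σ i)) v) σs vs →
         sumℚ vs ≡ sumOver σs (λ σ → indicator c (x ∘ lookup σ))
    go []       = refl
    go (p ∷ ps) = cong₂ _⊕_ (indVal-value p) (go ps)

  -- Supplies the values that `IsSchubExp` assumes, so that an expansion yields an equation at every
  -- point.
  symVal-symInd : ∀ x → SymVal n P x (normaliser n ⊛ symInd c x)
  symVal-symInd x = map (λ σ → indicator c (x ∘ lookup σ)) (perms n) , go (perms n) , refl
    where
    go : ∀ σs → Pointwise (λ σ v → IndVal P (λ i → x (lookup σ i)) v) σs (map (λ σ → indicator c (x ∘ lookup σ)) σs)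
    go []       = []
    go (σ ∷ σs) = indVal-indicator (x ∘ lookup σ) ∷ go σs

schubCombination : ∀ {n} → Point (tri n) → Point n → ℚ
schubCombination {n} a x = ∑ λ k → a k ⊛ schubVal x (lookup (sigma n) k)

∑-factor : ∀ {d} s (a h : Point d) → ∑ (λ k → a k ⊛ (s ⊛ h k)) ≡ s ⊛ ∑ (λ k → a k ⊛ h k)
∑-factor s a h = trans
  (∑-cong λ k → solve 3 (λ a s h → a :* (s :* h) := s :* (a :* h)) refl (a k) s (h k))
  (∑-*ˡ s (λ k → a k ⊛ h k))
  where open ℚ-Solver

module _ {n} (M : Matroid2 n) {c : Colouring n} (M≐ : MatVert M ≐ Vert c) where

  expansion⇒isSchubExp : ∀ a → (∀ x → symInd c x ≡ schubCombination a x) → IsSchubExp n M a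
  expansion⇒isSchubExp a e x q qs Mq Sq = begin
    q
      ≡⟨ symVal-value M≐ {x} Mq ⟩
    normaliser n ⊛ symInd c x
      ≡⟨ cong (normaliser n ⊛_) (e x) ⟩
    normaliser n ⊛ schubCombination a x
      ≡⟨ ∑-factor (normaliser n) a (λ k → schubVal x (lookup (sigma n) k)) ⟨
    ∑ (λ k → a k ⊛ (normaliser n ⊛ schubVal x (lookup (sigma n) k)))
      ≡⟨ ∑-cong (λ k → cong (a k ⊛_) (symVal-value (schub-vertices n k) {x} (Sq k))) ⟨
    ∑ (λ k → a k ⊛ qs k)
      ≡⟨ Σℚ≡∑ (tri n) (λ k → a k ⊛ qs k) ⟨
    Σℚ (tri n) (λ k → a k ⊛ qs k) ∎
    where open ≡-Reasoning

  isSchubExp⇒expansion : ∀ a → IsSchubExp n M a → ∀ x →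
                         normaliser n ⊛ symInd c x ≡ normaliser n ⊛ schubCombination a x
  isSchubExp⇒expansion a exp x = begin
    normaliser n ⊛ symInd c x
      ≡⟨ exp x (normaliser n ⊛ symInd c x) (λ k → normaliser n ⊛ schubVal x (lookup (sigma n) k))
           (symVal-symInd M≐ x) (λ k → symVal-symInd (schub-vertices n k) x) ⟩
    Σℚ (tri n) (λ k → a k ⊛ (normaliser n ⊛ schubVal x (lookup (sigma n) k)))
      ≡⟨ Σℚ≡∑ (tri n) (λ k → a k ⊛ (normaliser n ⊛ schubVal x (lookup (sigma n) k))) ⟩
    ∑ (λ k → a k ⊛ (normaliser n ⊛ schubVal x (lookup (sigma n) k)))
      ≡⟨ ∑-factor (normaliser n) a (λ k → schubVal x (lookup (sigma n) k)) ⟩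
    normaliser n ⊛ schubCombination a x ∎
    where open ≡-Reasoning

  -- The difference of two expansions is a vanishing combination of Schubert values, once the
  -- nonzero normalizing factor is cancelled.
  schubExp-unique : ∀ a b → IsSchubExp n M a → IsSchubExp n M b → ∀ k → a k ≡ b k
  schubExp-unique a b expa expb k = begin
    a k                ≡⟨ solve 2 (λ a b → a := (a :- b) :+ b) refl (a k) (b k) ⟩
    (a k ⊖ b k) ⊕ b k  ≡⟨ cong (_⊕ b k) (schubert-independent n 0 refl d vanish k) ⟩
    0ℚ ⊕ b k           ≡⟨ ℚₚ.+-identityˡ (b k) ⟩
    b k                ∎
    where
    open ≡-Reasoning
    open ℚ-Solver
    d : Point (tri n)
    d k = a k ⊖ b k
    difference : ∀ x → schubCombination d x ≡ schubCombination a x ⊖ schubCombination b x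
    difference x = trans
      (∑-cong λ k → solve 3 (λ a b h → (a :- b) :* h := a :* h :- b :* h) refl
        (a k) (b k) (schubVal x (lookup (sigma n) k)))
      (∑-⊖ (λ k → a k ⊛ schubVal x (lookup (sigma n) k)) (λ k → b k ⊛ schubVal x (lookup (sigma n) k)))
    vanish : ∀ x → schubCombination d x ≡ 0ℚ
    vanish x = product-zero {schubCombination d x} {normaliser n} (begin
      schubCombination d x ⊛ normaliser n
        ≡⟨ cong (_⊛ normaliser n) (difference x) ⟩
      (schubCombination a x ⊖ schubCombination b x) ⊛ normaliser n
        ≡⟨ solve 3 (λ p q s → (p :- q) :* s := s :* p :- s :* q) refl
             (schubCombination a x) (schubCombination b x) (normaliser n) ⟩
      normaliser n ⊛ schubCombination a x ⊖ normaliser n ⊛ schubCombination b x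
        ≡⟨ cong₂ _⊖_ (isSchubExp⇒expansion a expa x) (isSchubExp⇒expansion b expb x) ⟨
      normaliser n ⊛ symInd c x ⊖ normaliser n ⊛ symInd c x
        ≡⟨ ℚₚ.+-inverseʳ (normaliser n ⊛ symInd c x) ⟩
      0ℚ ∎) (normaliser≢0 n)

-- The sum over colour classes and the column evaluated on Schubert values are both `G 0` plus the
-- same `excess`.
colouring-expansion : ∀ {n} (c : Colouring n) K → (∀ i → c i < 2 + K) → ∀ {r} {u : Vec ℕ r} {y} →
  (∀ G → ∑ (λ (t : Fin K) → G (count c (2 + toℕ t) ∸ 1) ⊖ G 0) ≡ excess u G) →
  Column u n (count c 0) y → ∀ x → symInd c x ≡ schubCombination y x
colouring-expansion {n} c K bounded {r} {u} {y} sizes≡ C x = begin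
  symInd c x
    ≡⟨ symInd-expansion c K bounded
         (subst (count c 0 <_) (column-size C) (ℕₚ.m<m+n (count c 0) (s≤s z≤n))) x ⟩
  G 0 ⊕ ∑ (λ (t : Fin K) → G (count c (2 + toℕ t) ∸ 1) ⊖ G 0)
    ≡⟨ cong (G 0 ⊕_) (sizes≡ G) ⟩
  G 0 ⊕ excess u G
    ≡⟨ cong₂ _⊕_ (value 0) (excess-cong u value) ⟨
  schubVal x (1 + ℓ , 2 + ℓ) ⊕ excess u (λ q → schubVal x (1 + ℓ , q + (2 + ℓ)))
    ≡⟨ column-sum C (schubVal x) ⟨
  schubCombination y x ∎
  where
  open ≡-Reasoning
  ℓ : ℕ
  ℓ = count c 0
  G : ℕ → ℚ
  G q = symInd {n} (block ℓ (ℓ + suc q)) x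
  value : ∀ q → schubVal x (1 + ℓ , q + (2 + ℓ)) ≡ G q
  value = schubVal-raise x 0 ℓ

column⇒schubExp : ∀ {n y} → HasColumn n y → Σ (Matroid2 n) λ M → IsSchubExp n M y
column⇒schubExp {y = y} (r , u , ℓ , w≤ , C) with column-size C
... | refl with colouring-exists u ℓ w≤
...   | c , K , bounded , loops≡ , sizes≡ , _ , _ , ind =
  FromColouring.matroid c ind , expansion⇒isSchubExp (FromColouring.matroid c ind) (FromColouring.vertices c ind) y
    (colouring-expansion c K bounded sizes≡ (subst (λ l → Column u _ l y) (sym loops≡) C))

-- The vector `a` is known only through the equation it satisfies. The class sizes of `M` give a
-- column `y` satisfying it too, and uniqueness identifies the two.
schubExp⇒column : ∀ {n a} (M : Matroid2 n) → IsSchubExp n M a → HasColumn n a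
schubExp⇒column {n} {a} M exp = go
  where
  open FromMatroid M
  resize : ∀ {r} (u : Vec ℕ r) ℓ {n} → ℓ + (2 + r) ≡ n → ∃ λ y → Column u n ℓ y
  resize u ℓ refl = column-exists u ℓ
  go : HasColumn n a
  go with some-indep
  ... | _ , _ , ind with classSizes colour (suc n) ind
  ...   | r , u , size , w≤ , sizes≡ with resize u (count colour 0) size
  ...     | y , C = r , u , count colour 0 , w≤ , column-cong
    (schubExp-unique M vertices y a (expansion⇒isSchubExp M vertices y (colouring-expansion colour (suc n) bounded sizes≡ C)) exp) C

theorem3p6 : (m : ℕ) (y : Fin (tri (4 + m)) → ℚ) →
    (InHull (ColO m) y → Omega (4 + m) y) × (Omega (4 + m) y → InHull (ColO m) y)
theorem3p6 m y =
  -- Points and weights stay as they are; only the property of the generators is exchanged.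
  (λ { (ps , cols , conv) → ps , All.map (column⇒schubExp ∘ colO⇒column m) cols , conv }) ,
  (λ { (ps , exps , conv) → ps , All.map (λ { (M , exp) → column⇒colO m (schubExp⇒column M exp) }) exps , conv })
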